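{- Let $T$ be a caterpillar with bipartition $X$ and $Y$, and let $t=\max\{|X|,|Y|\}$. Then every $3$-connected bipartite graph $G$ with minimum degree $\delta(G)\geq t+3$ contains a subgraph $T'$ that is a caterpillar isomorphic to $T$ and such that $G-V(T')$ is still $3$-connected.
   Context: All graphs are finite and undirected, without loops or multiple edges. $\delta(G)$ is the minimum degree of $G$. For $S\subseteq V(G)$, $G-S$ is the graph obtained from $G$ by deleting the vertices of $S$ (and all incident edges). The connectivity $\kappa(G)$ is the minimum size of a vertex set $S$ such that $G-S$ is disconnected or has only one vertex; $G$ is $k$-connected if $\kappa(G)\geq k$. A caterpillar is a tree containing a single path (the spine) such that every edge of the tree is incident to a vertex of this path. The bipartition $X,Y$ of a tree is its partition into two independent sets. -}

module Defs where

open import Data.Fin.Base using (Fin)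
open import Data.Fin.Subset
  using (Subset; _∈_; _∉_; _⊆_; _∪_; _∩_; _─_; ∣_∣; Nonempty; ⊥)
open import Data.Fin.Subset.Properties using (_∈?_; x∈p∧x∉q⇒x∈p─q)
open import Data.List.Base using (List; []; _∷_; _∷ʳ_; length; map; filter; allFin)
open import Data.List.Extrema.Nat using (min)
import Data.List.Membership.Propositional as List
open import Data.List.Relation.Unary.All using (All)
open import Data.List.Relation.Unary.Linked using (Linked)
open import Data.List.Relation.Unary.Unique.Propositional using (Unique)
open import Data.Nat.Base using (ℕ; _≤_; _≥_)
open import Data.Product.Base using (∃; ∃-syntax; _×_; _,_; proj₁)
open import Data.Sum.Base using (_⊎_)
open import Data.Vec.Base using (tabulate)
open import Function.Bundles using (_↔_; _⇔_; Inverse)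
open import Level using (0ℓ)
open import Relation.Binary.Construct.Closure.ReflexiveTransitive using (Star)
open import Relation.Binary.Core using (Rel)
open import Relation.Binary.Definitions using (Decidable; Symmetric)
open import Relation.Binary.PropositionalEquality.Core using (_≡_; _≢_)
open import Relation.Nullary.Decidable.Core using (does; _×-dec_; ¬?)
open import Relation.Nullary.Negation.Core using (¬_)

-- A graph whose vertex set is an arbitrary subset of Fin n, so that subgraphs
-- and vertex deletions are again graphs over the same Fin n.
record Graph (n : ℕ) : Set₁ where
  field
    V       : Subset n
    Adj     : Rel (Fin n) 0ℓ
    Adj?    : Decidable Adj
    sym     : Symmetric Adj
    irrefl  : ∀ {v} → ¬ Adj v v
    Adj⇒∈V : ∀ {u v} → Adj u v → u ∈ V

open Graph public using (V)

private
  variable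
    m n : ℕ

Adj : (G : Graph n) → Rel (Fin n) 0ℓ
Adj = Graph.Adj

infixl 6 _-_
_-_ : Graph n → Subset n → Graph n
G - S = record
  { V       = V G ─ S
  ; Adj     = λ u v → Adj G u v × u ∉ S × v ∉ S
  ; Adj?    = λ u v → Graph.Adj? G u v ×-dec (¬? (u ∈? S) ×-dec ¬? (v ∈? S))
  ; sym     = λ (uv , u∉S , v∉S) → Graph.sym G uv , v∉S , u∉S
  ; irrefl  = λ (vv , _) → Graph.irrefl G vv
  ; Adj⇒∈V = λ (uv , u∉S , _) → x∈p∧x∉q⇒x∈p─q (Graph.Adj⇒∈V G uv) u∉S
  }

record IsSubgraph (H G : Graph n) : Set where
  field
    V⊆V     : V H ⊆ V G
    Adj⇒Adj : ∀ {u v} → Adj H u v → Adj G u v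

Vertex : Graph n → Set
Vertex G = ∃[ v ] v ∈ V G

record _≅_ (G : Graph m) (H : Graph n) : Set where
  field
    vertices : Vertex G ↔ Vertex H
  open Inverse vertices using (to)
  field
    edges : ∀ u v → Adj G (proj₁ u) (proj₁ v) ⇔ Adj H (proj₁ (to u)) (proj₁ (to v))

neighbours : Graph n → Fin n → Subset n
neighbours G v = tabulate (λ u → does (Graph.Adj? G v u))

degree : Graph n → Fin n → ℕ
degree G v = ∣ neighbours G v ∣

-- Each vertex of G has degree below ∣ V G ∣, so the default value ∣ V G ∣ passed to min
-- affects the result only for the graph without vertices, where δ is 0.
δ : Graph n → ℕ
δ {n} G = min ∣ V G ∣ (map (degree G) (filter (_∈? V G) (allFin n)))

-- The graph without vertices counts as connected.
Connected : Graph n → Set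
Connected G = ∀ {u v} → u ∈ V G → v ∈ V G → Star (Adj G) u v

Separates : (G : Graph n) → Subset n → Set
Separates G S = ¬ Connected (G - S) ⊎ ∣ V (G - S) ∣ ≡ 1

-- IsConnectivity G k expresses κ(G) = k. The minimum exists exactly when G has
-- a vertex; in particular the graph without vertices is not k-connected.
record IsConnectivity (G : Graph n) (k : ℕ) : Set where
  field
    attained : ∃[ S ] S ⊆ V G × Separates G S × ∣ S ∣ ≡ k
    minimal  : ∀ S → S ⊆ V G → Separates G S → k ≤ ∣ S ∣

IsConnected[_] : ℕ → Graph n → Set
IsConnected[ k ] G = ∃[ κ ] IsConnectivity G κ × κ ≥ k

Independent : (G : Graph n) → Subset n → Set
Independent G S = ∀ {u v} → u ∈ S → v ∈ S → ¬ Adj G u v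

-- A part may be empty, as is unavoidable for the one-vertex tree.
record IsBipartition (G : Graph n) (X Y : Subset n) : Set where
  field
    cover        : X ∪ Y ≡ V G
    disjoint     : X ∩ Y ≡ ⊥
    independentˡ : Independent G X
    independentʳ : Independent G Y

Bipartite : Graph n → Set
Bipartite G = ∃[ X ] ∃[ Y ] IsBipartition G X Y

-- A single vertex is a path.
record IsPath (G : Graph n) (p : List (Fin n)) : Set where
  field
    nonempty : p ≢ []
    inside   : All (_∈ V G) p
    linked   : Linked (Adj G) p
    unique   : Unique p

-- The cycle through v and vs, in this order, and back to v.
record IsCycle (G : Graph n) (v : Fin n) (vs : List (Fin n)) : Set where
  field
    long   : length vs ≥ 2
    linked : Linked (Adj G) (v ∷ (vs ∷ʳ v))
    unique : Unique (v ∷ vs)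

record IsTree (G : Graph n) : Set where
  field
    nonempty  : Nonempty (V G)
    connected : Connected G
    acyclic   : ∀ v vs → ¬ IsCycle G v vs

record IsCaterpillar (G : Graph n) : Set where
  field
    isTree      : IsTree G
    spine       : List (Fin n)
    spineIsPath : IsPath G spine
    incident    : ∀ {u v} → Adj G u v → u List.∈ spine ⊎ v List.∈ spine

-- A set B with at least four vertices outside a copy T' of T is inseparable if no two vertices of G − T'
-- separate two of its members. Every bipartite graph of minimum degree 3, hence G − T', contains such a set.
-- Choose T' and B with B as large as possible. If B misses a vertex v of G − T', let C be the component of v in
-- G − T' − B.
--
-- If C is attached to three vertices of B, then the centre of a shortest tripod in C joining these can be added
-- to B. Otherwise follow a path of G from v to B that avoids the at most two vertices x, y to which C is
-- attached. When the path meets a vertex z of T', take a shortest tripod U in C joining x, y and z. A vertex of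
-- C off U has at most three neighbours in U ∪ {x, y, z}, so at least t others in T' − z and C − U, which
-- suffices to reroute the copy of T through C − U so as to release z (this step uses that T is a caterpillar).
-- Since U still links x and y, the set B stays inseparable, and the component has grown along the path.
-- Eventually it is attached to one more vertex of B.
--
-- The search for a copy of T with 3-connected complement is finite, so it is enough to refute its failure;
-- under this assumption the extremal choices above need no decision procedures.
module Submission where

open import Defs
open import Data.Bool.Base using (Bool; true; false)
import Data.Bool.Properties as Bool
open import Data.Empty using (⊥; ⊥-elim)
open import Data.Fin.Base using (Fin; zero; suc; toℕ)
open import Data.Fin.Properties using (_≟_; any?; all?; suc-injective; toℕ-injective; toℕ<n)
open import Data.Fin.Subset
  using (Subset; inside; outside; _∈_; _∉_; _⊆_; _⊂_; _∪_; _∩_; _─_; ⁅_⁆; ∣_∣)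
open import Data.Fin.Subset.Properties
  using (_∈?_; _⊆?_; anySubset?; p⊂q⇒∣p∣<∣q∣; ∣p∣≤n; p⊆p∪q; q⊆p∪q; x∈p∪q⁻; x∈p∪q⁺; x∈p∩q⁻; x∈p∩q⁺;
         x∈⁅x⁆; x∈⁅y⁆⇒x≡y; p─q⊆p; x∈p∧x∉q⇒x∈p─q)
open import Data.List.Base using (List; []; _∷_; _∷ʳ_; _++_; length; map; filter; allFin)
open import Data.List.Extrema.Nat using (min≤xs)
import Data.List.Membership.DecPropositional as DecMembership
open import Data.List.Membership.Propositional using () renaming (_∈_ to _∈ˡ_; _∉_ to _∉ˡ_)
open import Data.List.Membership.Propositional.Properties
  using (∈-map⁺; ∈-++⁺ˡ; ∈-++⁺ʳ; ∈-filter⁺; ∈-allFin)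
open import Data.List.Properties using (length-map; map-++)
open import Data.List.Relation.Unary.All as All using (All)
import Data.List.Relation.Unary.All.Properties as All
import Data.List.Relation.Unary.AllPairs as AllPairs
open import Data.List.Relation.Unary.Any using (here; there)
import Data.List.Relation.Unary.Linked as Listᴸ
import Data.List.Relation.Unary.Linked.Properties as Linked
open import Data.List.Relation.Unary.Unique.Propositional using (Unique)
open import Data.Nat.Base using (ℕ; zero; suc; _+_; _≤_; _<_; _≥_; _⊔_; z≤n; s≤s)
open import Data.Nat.Induction using (<-rec)
import Data.Nat.Properties as ℕ
open import Data.Nat.Solver using (module +-*-Solver)
open import Data.Product.Base using (Σ; ∃-syntax; _×_; _,_; proj₁; proj₂)
open import Data.Sum.Base using (_⊎_; inj₁; inj₂; [_,_]′)
open import Data.Unit.Base using (⊤; tt)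
open import Data.Vec.Base using (Vec; []; _∷_; here; there; lookup; tabulate)
import Data.Vec.Properties as Vec
open import Data.Vec.Properties.WithK using ([]=-irrelevant)
open import Function.Base using (_∘_; id; case_of_)
open import Function.Bundles using (mk↔ₛ′; mk⇔)
open import Relation.Binary.Construct.Closure.ReflexiveTransitive as Star using (Star; ε; _◅_; _◅◅_)
open import Relation.Binary.Definitions using (tri<; tri≈; tri>)
open import Relation.Binary.PropositionalEquality.Core
  using (_≡_; _≢_; refl; sym; trans; cong; subst; subst₂)
open import Relation.Nullary.Decidable using (decidable-stable; dec-true)
open import Relation.Nullary.Decidable.Core
  using (Dec; yes; no; does; map′; ¬?; _×-dec_; _⊎-dec_; _→-dec_)
open import Relation.Nullary.Negation.Core using (¬_; contradiction)

-- The bound of three is where bipartiteness and the choice of a shortest tripod enter. On one leg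
-- the neighbours of a vertex `w` of C are never consecutive, for lack of triangles, and never more
-- than two apart, since the way over `w` would be shorter. So a leg carries at most two, and a
-- fourth neighbour altogether would let `w` shorten the tripod, mostly as its new centre. The 3 in
-- t + 3 serves once more: the neighbours of a vertex in the copy lie in one class of T, so at least
-- three remain outside. This gives G - T' minimum degree 3, and it forces C to have a vertex off U,
-- without which no rerouting could begin. An exchange may hand much of C over to the copy, so the
-- size of the component is no measure of progress. The path is therefore taken in G, not in G - T':
-- its remainder survives every exchange and becomes shorter. C may be attached to fewer than two
-- vertices of B. The missing ends of the tripod are then filled by repeating an end or by z, so
-- tripods with coinciding ends are allowed and one exchange serves all cases.

-- Counting distinct elements of undecided predicates.

AtLeast : ∀ {n} → ℕ → (Fin n → Set) → Set
AtLeast zero    P = ⊤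
AtLeast (suc k) P = ∃[ x ] P x × AtLeast k (λ y → P y × y ≢ x)

-- `f` may use the proof of `P x`, because the preimages and charges counted later are computed from
-- such proofs. Injectivity is therefore demanded across all proofs.
AtLeast-map : ∀ {n m} k {P : Fin n → Set} {Q : Fin m → Set} (f : ∀ x → P x → Fin m) →
  (∀ x p → Q (f x p)) → (∀ x y p q → f x p ≡ f y q → x ≡ y) → AtLeast k P → AtLeast k Q
AtLeast-map zero    f into inj _              = tt
AtLeast-map (suc k) f into inj (x , px , pts) =
  f x px , into x px ,
  AtLeast-map k (λ y p → f y (proj₁ p))
    (λ y p → into y (proj₁ p) , λ eq → proj₂ p (inj y x (proj₁ p) px eq))
    (λ y z p q → inj y z (proj₁ p) (proj₁ q)) pts

AtLeast-mono : ∀ {n} k {P Q : Fin n → Set} → (∀ {x} → P x → Q x) → AtLeast k P → AtLeast k Q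
AtLeast-mono k P⇒Q = AtLeast-map k (λ x _ → x) (λ _ → P⇒Q) (λ _ _ _ _ eq → eq)

AtLeast-≤ : ∀ {n j k} {P : Fin n → Set} → j ≤ k → AtLeast k P → AtLeast j P
AtLeast-≤ z≤n       _              = tt
AtLeast-≤ (s≤s j≤k) (x , px , pts) = x , px , AtLeast-≤ j≤k pts

AtLeast-add : ∀ {n} k {P Q : Fin n → Set} y → Q y → (∀ {x} → P x → Q x × x ≢ y) →
  AtLeast k P → AtLeast (suc k) Q
AtLeast-add k y qy P⇒Q pts = y , qy , AtLeast-mono k P⇒Q pts

AtLeast-remove : ∀ {n} k {P : Fin n → Set} y → AtLeast (suc k) P → AtLeast k (λ x → P x × x ≢ y)
AtLeast-remove zero    y _              = tt
AtLeast-remove (suc k) y (x , px , pts) with x ≟ y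
... | yes refl = pts
... | no  x≢y  = x , (px , x≢y) ,
  AtLeast-mono k (λ ((p , z≢x) , z≢y) → (p , z≢y) , z≢x) (AtLeast-remove k y pts)

AtLeast-discard : ∀ {n} k {P Q : Fin n → Set} ys → (∀ {x} → P x → x ∈ˡ ys ⊎ Q x) →
  AtLeast (length ys + k) P → AtLeast k Q
AtLeast-discard k []       split = AtLeast-mono k (λ p → [ (λ ()) , id ]′ (split p))
AtLeast-discard k (y ∷ ys) split pts = AtLeast-discard k ys split′ (AtLeast-remove _ y pts)
  where
  split′ : ∀ {x} → _ → x ∈ˡ ys ⊎ _
  split′ (p , x≢y) with split p
  ... | inj₁ (here x≡y) = contradiction x≡y x≢y
  ... | inj₁ (there x∈) = inj₁ x∈
  ... | inj₂ q          = inj₂ q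

AtLeast-covered : ∀ {n} k {P : Fin n → Set} ys → (∀ {x} → P x → x ∈ˡ ys) → AtLeast k P → k ≤ length ys
AtLeast-covered zero    ys       cover _              = z≤n
AtLeast-covered (suc k) []       cover (x , px , _)   = case cover px of λ ()
AtLeast-covered (suc k) (y ∷ ys) cover pts = s≤s (AtLeast-covered k ys cover′ (AtLeast-remove k y pts))
  where
  cover′ : ∀ {x} → _ → x ∈ˡ ys
  cover′ (p , x≢y) with cover p
  ... | here x≡y = contradiction x≡y x≢y
  ... | there x∈ = x∈

-- Stated with k = b + j so that the bound b on the elements of Q leaves j others.
AtLeast-outside : ∀ {n} b j {P Q : Fin n → Set} → (∀ x → Dec (Q x)) →
  ¬ AtLeast (suc b) (λ x → P x × Q x) → AtLeast (b + j) P → AtLeast j (λ x → P x × ¬ Q x)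
AtLeast-outside b       zero    Q? few pts = tt
AtLeast-outside zero    (suc j) Q? few pts =
  AtLeast-mono (suc j) (λ {x} p → p , λ q → few (x , (p , q) , tt)) pts
AtLeast-outside {n} (suc b) (suc j) {P} {Q} Q? few (x , px , pts) with Q? x
... | yes qx = AtLeast-mono (suc j) (λ ((p , _) , ¬q) → p , ¬q)
  (AtLeast-outside b (suc j) Q? (λ more → few (x , (px , qx) ,
    AtLeast-mono (suc b) (λ ((p , y≢x) , q) → (p , q) , y≢x) more)) pts)
... | no ¬qx = x , (px , ¬qx) , AtLeast-mono j (λ ((p , y≢x) , ¬q) → (p , ¬q) , y≢x)
  (AtLeast-outside (suc b) j {λ y → P y × y ≢ x} Q?
    (λ more → few (AtLeast-mono (suc (suc b)) (λ ((p , _) , q) → p , q) more))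
    (subst (λ k → AtLeast k (λ y → P y × y ≢ x)) (ℕ.+-suc b j) pts))

AtLeast-⊎ : ∀ {n} j k {P Q : Fin n → Set} → (∀ {x} → P x → ¬ Q x) →
  AtLeast j P → AtLeast k Q → AtLeast (j + k) (λ x → P x ⊎ Q x)
AtLeast-⊎ zero    k disjoint _              qs = AtLeast-mono k inj₂ qs
AtLeast-⊎ (suc j) k disjoint (x , px , ps) qs = x , inj₁ px ,
  AtLeast-mono (j + k)
    (λ { (inj₁ (p , y≢x)) → inj₁ p , y≢x ; (inj₂ q) → inj₂ q , λ { refl → disjoint px q } })
    (AtLeast-⊎ j k (disjoint ∘ proj₁) ps qs)

AtLeast-subset : ∀ {n} (p : Subset n) → AtLeast ∣ p ∣ (_∈ p)
AtLeast-subset []            = tt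
AtLeast-subset (outside ∷ p) =
  AtLeast-map ∣ p ∣ (λ x _ → suc x) (λ _ → there) (λ _ _ _ _ → suc-injective) (AtLeast-subset p)
AtLeast-subset (inside ∷ p)  = zero , here ,
  AtLeast-map ∣ p ∣ (λ x _ → suc x) (λ _ x∈p → there x∈p , λ ()) (λ _ _ _ _ → suc-injective) (AtLeast-subset p)

elements : ∀ {n} → Subset n → List (Fin n)
elements []            = []
elements (outside ∷ p) = map suc (elements p)
elements (inside  ∷ p) = zero ∷ map suc (elements p)

length-elements : ∀ {n} (p : Subset n) → length (elements p) ≡ ∣ p ∣
length-elements []            = refl
length-elements (outside ∷ p) = trans (length-map suc (elements p)) (length-elements p)
length-elements (inside  ∷ p) = cong suc (trans (length-map suc (elements p)) (length-elements p))

∈-elements : ∀ {n} {p : Subset n} {x} → x ∈ p → x ∈ˡ elements p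
∈-elements {p = inside  ∷ p} here       = here refl
∈-elements {p = inside  ∷ p} (there x∈) = there (∈-map⁺ suc (∈-elements x∈))
∈-elements {p = outside ∷ p} (there x∈) = ∈-map⁺ suc (∈-elements x∈)

AtLeast-subset-≤ : ∀ {n} k {p : Subset n} → AtLeast k (_∈ p) → k ≤ ∣ p ∣
AtLeast-subset-≤ k {p} pts =
  subst (k ≤_) (length-elements p) (AtLeast-covered k (elements p) ∈-elements pts)

-- Any predicate on a finite type is a subset as long as the goal is ⊥.
comprehension : ∀ {n} (P : Fin n → Set) →
  ((p : Subset n) → (∀ {x} → x ∈ p → P x) → (∀ {x} → P x → x ∈ p) → ⊥) → ⊥
comprehension {zero}  P k = k [] (λ ()) (λ {x} → case x of λ ())
comprehension {suc n} P k = comprehension (P ∘ suc) λ p sound complete →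
  (λ ¬P₀ → k (outside ∷ p) (λ { (there x∈) → sound x∈ })
    (λ { {zero} P₀ → ⊥-elim (¬P₀ P₀) ; {suc x} Px → there (complete Px) }))
  (λ P₀ → k (inside ∷ p) (λ { here → P₀ ; (there x∈) → sound x∈ })
    (λ { {zero} _ → here ; {suc x} Px → there (complete Px) }))

-- Deciding reachability in a finite relation.

module Reachability {n} {R : Fin n → Fin n → Set} (R? : ∀ u v → Dec (R u v)) where

  -- Warshall's recursion: the interior vertices of a `Via k` connection have index below `k`, so
  -- `Via n` amounts to `Star R` and is decided by recursion on `k`.
  data Via : ℕ → Fin n → Fin n → Set where
    stay   : ∀ {u} → Via 0 u u
    edge   : ∀ {u v} → R u v → Via 0 u v
    weaken : ∀ {k u v} → Via k u v → Via (suc k) u v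
    join   : ∀ {k u v} w → toℕ w ≡ k → Via k u w → Via k w v → Via (suc k) u v

  via? : ∀ k u v → Dec (Via k u v)
  via? zero u v = map′ [ (λ { refl → stay }) , edge ]′ (λ { stay → inj₁ refl ; (edge e) → inj₂ e })
                    (u ≟ v ⊎-dec R? u v)
  via? (suc k) u v =
    map′ [ weaken , (λ (w , w≡k , p , q) → join w w≡k p q) ]′
         (λ { (weaken p) → inj₁ p ; (join w w≡k p q) → inj₂ (w , w≡k , p , q) })
      (via? k u v ⊎-dec any? λ w → toℕ w ℕ.≟ k ×-dec (via? k u w ×-dec via? k w v))

  to-pivot : ∀ {k u w} → toℕ w ≡ k → Via (suc k) u w → Via k u w
  to-pivot w≡k (weaken p)         = p
  to-pivot w≡k (join w′ eq p q)   = subst (λ x → Via _ _ x) (toℕ-injective (trans eq (sym w≡k))) p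

  from-pivot : ∀ {k w v} → toℕ w ≡ k → Via (suc k) w v → Via k w v
  from-pivot w≡k (weaken p)       = p
  from-pivot w≡k (join w′ eq p q) = subst (λ x → Via _ x _) (toℕ-injective (trans eq (sym w≡k))) q

  -- If `w` is the pivot of index `k`, both connections are trimmed at `w`. Otherwise, if both pass
  -- through this pivot, what lies between the two passages is a detour and is dropped.
  Via-trans : ∀ k {u w v} → toℕ w < k → Via k u w → Via k w v → Via k u v
  Via-trans (suc k) {u} {w} {v} w<1+k p q with ℕ.m≤n⇒m<n∨m≡n (ℕ.≤-pred w<1+k)
  ... | inj₂ w≡k = join w w≡k (to-pivot w≡k p) (from-pivot w≡k q)
  ... | inj₁ w<k = go p q
    where
    go : Via (suc k) u w → Via (suc k) w v → Via (suc k) u v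
    go (weaken p)       (weaken q)         = weaken (Via-trans k w<k p q)
    go (weaken p)       (join x eq q₁ q₂)  = join x eq (Via-trans k w<k p q₁) q₂
    go (join x eq p₁ p₂) (weaken q)        = join x eq p₁ (Via-trans k w<k p₂ q)
    go (join x eq p₁ _) (join y eq′ _ q₂)  =
      join x eq p₁ (subst (λ z → Via k z v) (toℕ-injective (trans eq′ (sym eq))) q₂)

  lift : ∀ k {u v} → Via 0 u v → Via k u v
  lift zero    p = p
  lift (suc k) p = weaken (lift k p)

  complete : ∀ {u v} → Star R u v → Via n u v
  complete ε        = lift n stay
  complete (_◅_ {j = w} e p) = Via-trans n (toℕ<n w) (lift n (edge e)) (complete p)

  sound : ∀ {k u v} → Via k u v → Star R u v
  sound stay           = ε
  sound (edge e)       = e ◅ ε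
  sound (weaken p)     = sound p
  sound (join w _ p q) = sound p ◅◅ sound q

  reachable? : ∀ u v → Dec (Star R u v)
  reachable? u v = map′ sound complete (via? n u v)

-- Two-coloured graphs and links that avoid two vertices.

opposite : ∀ {a b c : Bool} → a ≢ b → a ≢ c → b ≡ c
opposite {_}     {false} {false} _   _   = refl
opposite {_}     {true}  {true}  _   _   = refl
opposite {false} {false} {true}  a≢b _   = contradiction refl a≢b
opposite {true}  {false} {true}  _   a≢c = contradiction refl a≢c
opposite {false} {true}  {false} _   a≢c = contradiction refl a≢c
opposite {true}  {true}  {false} a≢b _   = contradiction refl a≢b

record ColouredGraph (n : ℕ) : Set₁ where
  field
    Vert     : Fin n → Set
    Vert?    : ∀ u → Dec (Vert u)
    E        : Fin n → Fin n → Set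
    E?       : ∀ u v → Dec (E u v)
    E-sym    : ∀ {u v} → E u v → E v u
    E⇒Vert   : ∀ {u v} → E u v → Vert u
    colour   : Fin n → Bool
    colour-≢ : ∀ {u v} → E u v → colour u ≢ colour v

  E-irrefl : ∀ {u} → ¬ E u u
  E-irrefl e = colour-≢ e refl

  no-triangle : ∀ {u v w} → E u v → E v w → ¬ E u w
  no-triangle uv vw uw = colour-≢ uw (opposite (colour-≢ (E-sym uv)) (colour-≢ vw))

  -- The empty walk asks for no proof of `P`: every vertex is linked to itself, even one outside
  -- `P`. Pieces with a single or a dummy attachment rely on this.
  Linked : (Fin n → Set) → Fin n → Fin n → Set
  Linked P = Star (λ u v → E u v × P u × P v)

  linked-mono : ∀ {P Q : Fin n → Set} → (∀ {u} → P u → Q u) → ∀ {u v} → Linked P u v → Linked Q u v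
  linked-mono P⇒Q = Star.map λ (e , p , q) → e , P⇒Q p , P⇒Q q

  linked-sym : ∀ {P u v} → Linked P u v → Linked P v u
  linked-sym = Star.reverse λ (e , p , q) → E-sym e , q , p

  linked-target : ∀ {P : Fin n → Set} {u v} → P u → Linked P u v → P v
  linked-target Pu ε                   = Pu
  linked-target _  ((_ , _ , Pw) ◅ p) = linked-target Pw p

  linked? : ∀ {P : Fin n → Set} → (∀ u → Dec (P u)) → ∀ u v → Dec (Linked P u v)
  linked? P? = Reachability.reachable? λ u v → E? u v ×-dec (P? u ×-dec P? v)

  -- `σ` and `τ` may coincide or lie outside `P`, so quantifying over both covers the deletion of at
  -- most two vertices.
  Cut : (Fin n → Set) → Fin n → Fin n → Fin n → Set
  Cut P σ τ u = P u × u ≢ σ × u ≢ τ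

  Inseparable : (Fin n → Set) → Subset n → Set
  Inseparable P B = ∀ σ τ {b b′} → b ∈ B → b′ ∈ B → b ≢ σ → b ≢ τ → b′ ≢ σ → b′ ≢ τ →
    Linked (Cut P σ τ) b b′

  MinDegree : ℕ → Set
  MinDegree k = ∀ {u} → Vert u → AtLeast k (E u)

  TwoCutsConnect : Set
  TwoCutsConnect = ∀ σ τ {u v} → Vert u → Vert v → u ≢ σ → u ≢ τ → v ≢ σ → v ≢ τ → Linked (Cut Vert σ τ) u v

  linked-cut? : ∀ {P : Fin n → Set} → (∀ u → Dec (P u)) → ∀ σ τ u v → Dec (Linked (Cut P σ τ) u v)
  linked-cut? P? σ τ = linked? λ u → P? u ×-dec (¬? (u ≟ σ) ×-dec ¬? (u ≟ τ))

-- A set with at least four elements.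
Big : ∀ {n} → Subset n → Set
Big B = ∀ p q r → ∃[ b ] b ∈ B × b ≢ p × b ≢ q × b ≢ r

-- Walks through a vertex set and shortest tripods.

module Walks {n} (G : ColouredGraph n) (C : Fin n → Set) where
  open ColouredGraph G

  -- All vertices but the last are required to lie in `C`; the ends of a tripod will usually lie
  -- outside the component that carries it.
  data Walk (τ : Fin n) : ℕ → Fin n → Set where
    []   : Walk τ 0 τ
    step : ∀ {k u v} → C u → E u v → Walk τ k v → Walk τ (suc k) u

  data At {τ} : ∀ {k u} → Walk τ k u → ℕ → Fin n → Set where
    here  : ∀ {k u} {ω : Walk τ k u} → At ω 0 u
    there : ∀ {k u v p i} {c : C u} {e : E u v} {ω : Walk τ k v} → At ω i p → At (step c e ω) (suc i) p

  On : ∀ {τ k u} → Walk τ k u → Fin n → Set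
  On ω p = ∃[ i ] At ω i p

  at-unique : ∀ {τ k u i p q} {ω : Walk τ k u} → At ω i p → At ω i q → p ≡ q
  at-unique here      here      = refl
  at-unique (there x) (there y) = at-unique x y

  at-consecutive : ∀ {τ k u i p q} {ω : Walk τ k u} → At ω i p → At ω (suc i) q → E p q
  at-consecutive {ω = step _ e _} here (there here) = e
  at-consecutive (there x) (there y)                = at-consecutive x y

  at? : ∀ {τ k u} (ω : Walk τ k u) i → Dec (∃[ p ] At ω i p)
  at? ω            zero    = yes (_ , here)
  at? []           (suc i) = no λ ()
  at? (step c e ω) (suc i) = map′ (λ (p , x) → p , there x) (λ { (p , there x) → p , x }) (at? ω i)

  on? : ∀ {τ k u} (ω : Walk τ k u) p → Dec (On ω p)
  on? {τ} [] p = map′ (λ { refl → 0 , here }) (λ { (_ , here) → refl }) (p ≟ τ)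
  on? (step {u = u} c e ω) p =
    map′ (λ { (inj₁ refl) → 0 , here ; (inj₂ (i , x)) → suc i , there x })
         (λ { (_ , here) → inj₁ refl ; (_ , there x) → inj₂ (_ , x) })
         (p ≟ u ⊎-dec on? ω p)

  suffix : ∀ {τ k u i p} {ω : Walk τ k u} → At ω i p → ∃[ j ] Walk τ j p × i + j ≡ k
  suffix {k = k} {ω = ω} here = k , ω , refl
  suffix (there x) with suffix x
  ... | j , ω′ , eq = j , ω′ , cong suc eq

  start-inside : ∀ {τ k u i p} {ω : Walk τ k u} → At ω i p → C p → C u
  start-inside here                   Cp = Cp
  start-inside {ω = step c _ _} (there x) Cp = c

  interior-< : ∀ {τ k u i j p q} {ω : Walk τ k u} → i < j → At ω i p → At ω j q → C p
  interior-< {ω = step c _ _} _ here (there _)          = c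
  interior-< (s≤s i<j) (there x) (there y)              = interior-< i<j x y

  -- Used to move the centre of a tripod to `p`: the other end is reached by backing up the leg to
  -- the old centre and going on from there.
  retreat : ∀ {τ σ k b u i p} {ω : Walk τ k u} → At ω i p → C p → Walk σ b u → Walk σ (i + b) p
  retreat here Cp ω′ = ω′
  retreat {σ = σ} {b = b} {ω = step c e ω} (there {p = p} {i = i} x) Cp ω′ =
    subst (λ k → Walk σ k p) (ℕ.+-suc i b) (retreat x Cp (step (start-inside x Cp) (E-sym e) ω′))

  end-or-inside : ∀ {τ k u i p} {ω : Walk τ k u} → At ω i p → p ≡ τ ⊎ C p
  end-or-inside {ω = []}         here      = inj₁ refl
  end-or-inside {ω = step c _ _} here      = inj₂ c
  end-or-inside                  (there x) = end-or-inside x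

  walk-end : ∀ {τ k u} (ω : Walk τ k u) → At ω k τ
  walk-end []           = here
  walk-end (step c e ω) = there (walk-end ω)

  linked-walk : ∀ {τ u} → C u → ∀ {v} → Linked C u v → E v τ → ∃[ k ] Walk τ k u
  linked-walk Cu ε e = 1 , step Cu e []
  linked-walk Cu ((uv , _ , Cv) ◅ p) e with linked-walk Cv p e
  ... | k , ω = suc k , step Cu uv ω

  -- Minimality ranges over all centres as well as all walks. Neither distinct ends nor disjoint
  -- legs are built in.
  record MinTripod (x y z : Fin n) : Set where
    field
      {a b c}    : ℕ
      {centre}   : Fin n
      centre∈C   : C centre
      walkˣ      : Walk x a centre
      walkʸ      : Walk y b centre
      walkᶻ      : Walk z c centre
      minimal    : ∀ {v a′ b′ c′} → C v → Walk x a′ v → Walk y b′ v → Walk z c′ v →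
                   a + b + c ≤ a′ + b′ + c′

  minTripod : ∀ {x y z a b c u} → C u → Walk x a u → Walk y b u → Walk z c u →
    (MinTripod x y z → ⊥) → ⊥
  minTripod {x} {y} {z} Cu ωˣ ωʸ ωᶻ none = <-rec
    (λ k → ∀ {a b c u} → a + b + c ≡ k → C u → Walk x a u → Walk y b u → Walk z c u → ⊥)
    (λ { _ rec refl Cu ωˣ ωʸ ωᶻ → none record
      { centre∈C = Cu ; walkˣ = ωˣ ; walkʸ = ωʸ ; walkᶻ = ωᶻ
      ; minimal = λ Cv ωˣ′ ωʸ′ ωᶻ′ → ℕ.≮⇒≥ λ lt → rec lt refl Cv ωˣ′ ωʸ′ ωᶻ′ } })
    _ refl Cu ωˣ ωʸ ωᶻ

  -- The neighbours of w on a leg of length a, apart from the centre of the tripod.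
  data Hits (w τ : Fin n) {a u} (ω : Walk τ a u) : List (Fin n) → Set where
    none : Hits w τ ω []
    one  : ∀ {i a′ p} → At ω (suc i) p → E w p → Walk τ a′ w → a′ + i ≡ a → Hits w τ ω (p ∷ [])
    two  : ∀ {i a′ p q} → At ω (suc i) p → C p → E w p → Walk τ a′ w → suc (suc (a′ + i)) ≡ a →
           Hits w τ ω (p ∷ q ∷ [])

  firstHit : ∀ {τ k u} w (ω : Walk τ k u) →
    (∀ {i p} → At ω i p → ¬ E w p) ⊎
    ∃[ i ] ∃[ p ] At ω i p × E w p × (∀ {j q} → At ω j q → E w q → i ≤ j)
  firstHit {u = u} w ω with E? w u
  firstHit {u = u} w ω | yes e = inj₂ (0 , u , here , e , λ _ _ → z≤n)
  firstHit w [] | no ¬e = inj₁ λ { here e → ¬e e }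
  firstHit w (step c e ω) | no ¬e with firstHit w ω
  ... | inj₁ miss = inj₁ λ { here f → ¬e f ; (there x) f → miss x f }
  ... | inj₂ (i , p , x , f , first) =
    inj₂ (suc i , p , there x , f , λ { here g → contradiction g ¬e ; (there y) g → s≤s (first y g) })

  -- Two hits of w on a shortest leg are two apart: a longer gap gives a shortcut, a gap of 1 a triangle.
  hits : ∀ {τ k u w} (ω : Walk τ k u) → C w → (∀ {j} → Walk τ j u → k ≤ j) →
    ∃[ ps ] Hits w τ ω ps × (∀ {i p} → At ω (suc i) p → E w p → p ∈ˡ ps)
  hits [] Cw short = [] , none , λ ()
  hits {τ} {suc k} {u} {w} ω₀@(step {v = v} Cu uv ω) Cw short with firstHit w ω
  ... | inj₁ miss = [] , none , λ { (there x) e → contradiction e (miss x) }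
  ... | inj₂ (i , p , x , wp , first) = second (at? ω (suc (suc i)))
    where
    close : ∀ {j q} → At ω j q → E w q → i < j → j ≡ suc (suc i)
    close {j} {q} y wq i<j with ℕ.m≤n⇒m<n∨m≡n i<j
    ... | inj₂ refl = contradiction wq (no-triangle wp (at-consecutive x y))
    ... | inj₁ i+2≤j = ℕ.≤-antisym short′ i+2≤j
      where
      Cp = interior-< i<j x y
      advance : ∀ {k u i p} {ω : Walk τ k u} → At ω i p → ∀ {l} → Walk τ l p → Walk τ (i + l) u
      advance here ω′ = ω′
      advance {ω = step c e _} (there z) ω′ = step c e (advance z ω′)
      short′ : j ≤ suc (suc i)
      short′ with suffix y
      ... | l , ω′ , j+l≡k = ℕ.+-cancelʳ-≤ l j (suc (suc i))
        (subst (_≤ suc (suc i) + l) (sym j+l≡k)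
          (subst (k ≤_) (trans (ℕ.+-suc i (suc l)) (cong suc (ℕ.+-suc i l)))
            (ℕ.≤-pred (short (step Cu uv (advance x (step Cp (E-sym wp) (step Cw wq ω′))))))))
    same : ∀ {j q} → At ω j q → E w q → q ≡ p ⊎ j ≡ suc (suc i)
    same y wq with ℕ.m≤n⇒m<n∨m≡n (first y wq)
    ... | inj₂ refl = inj₁ (at-unique y x)
    ... | inj₁ i<j  = inj₂ (close y wq i<j)
    single : (∀ {q} → At ω (suc (suc i)) q → ¬ E w q) →
      ∃[ ps ] Hits w τ ω₀ ps × (∀ {i p} → At ω₀ (suc i) p → E w p → p ∈ˡ ps)
    single miss with suffix x
    ... | l , ω′ , eq = p ∷ [] , one (there x) wp (step Cw wp ω′) (cong suc (trans (ℕ.+-comm l i) eq)) ,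
      λ { (there y) wq → case same y wq of λ { (inj₁ q≡p) → here q≡p ; (inj₂ refl) → contradiction wq (miss y) } }
    second : Dec (∃[ q ] At ω (suc (suc i)) q) →
      ∃[ ps ] Hits w τ ω₀ ps × (∀ {i p} → At ω₀ (suc i) p → E w p → p ∈ˡ ps)
    second (no out) = single λ y _ → out (_ , y)
    second (yes (q , y)) with E? w q
    ... | no ¬wq = single λ y′ wq′ → ¬wq (subst (E w) (at-unique y′ y) wq′)
    ... | yes wq with suffix y
    ... | l , ω′ , eq = p ∷ q ∷ [] ,
      two (there x) (interior-< (ℕ.m≤n⇒m≤1+n ℕ.≤-refl) x y) wp (step Cw wq ω′)
        (cong suc (trans (cong (λ m → suc (suc m)) (ℕ.+-comm l i)) eq)) ,
      λ { (there y′) wq′ → case same y′ wq′ of λ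
        { (inj₁ q≡p) → here q≡p ; (inj₂ refl) → there (here (at-unique y′ y)) } }

-- Neighbours of a vertex on the legs of a shortest tripod.

excess : ∀ {m k} j → m ≡ k + suc j → ¬ m ≤ k
excess {k = k} j refl = ℕ.m+1+n≰m k

two-two-count : ∀ {a b c a′ i b′ j} → suc (suc (a′ + i)) ≡ a → suc (suc (b′ + j)) ≡ b →
  ¬ a + b + c ≤ a′ + b′ + suc (suc i + c)
two-two-count {c = c} {a′} {i} {b′} {j} refl refl = excess (suc j) (identity a′ i b′ j c)
  where
  identity : ∀ a i b j c → suc (suc (a + i)) + suc (suc (b + j)) + c
                         ≡ a + b + suc (suc i + c) + suc (suc j)
  identity = solve 5 (λ a i b j c → con 2 :+ (a :+ i) :+ (con 2 :+ (b :+ j)) :+ c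
    := a :+ b :+ (con 2 :+ i :+ c) :+ (con 2 :+ j)) refl
    where
    open +-*-Solver

one-one-one-count : ∀ {a b c a′ b′ c′ i j k} → a′ + suc i ≡ a → b′ + suc j ≡ b → c′ + suc k ≡ c →
  ¬ a + b + c ≤ a′ + b′ + c′
one-one-one-count {a′ = a} {b} {c} {i} {j} {k} refl refl refl =
  excess (suc (suc (i + j + k))) (identity a b c i j k)
  where
  identity : ∀ a b c i j k → (a + suc i) + (b + suc j) + (c + suc k) ≡ a + b + c + suc (suc (suc (i + j + k)))
  identity = solve 6 (λ a b c i j k → (a :+ (con 1 :+ i)) :+ (b :+ (con 1 :+ j)) :+ (c :+ (con 1 :+ k))
    := a :+ b :+ c :+ (con 3 :+ (i :+ j :+ k))) refl
    where
    open +-*-Solver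

module Tripods {n} (G : ColouredGraph n) (C : Fin n → Set) where
  open ColouredGraph G
  open Walks G C
  open MinTripod

  rotate : ∀ {x y z} → MinTripod x y z → MinTripod y z x
  rotate M = record
    { centre∈C = centre∈C M ; walkˣ = walkʸ M ; walkʸ = walkᶻ M ; walkᶻ = walkˣ M
    ; minimal = λ {_} {b′} {c′} {a′} Cv ωʸ ωᶻ ωˣ → ℕ.≤-trans (ℕ.≤-reflexive (turn (a M) (b M) (c M)))
        (ℕ.≤-trans (minimal M Cv ωˣ ωʸ ωᶻ) (ℕ.≤-reflexive (sym (turn a′ b′ c′)))) }
    where
    turn : ∀ a b c → b + c + a ≡ a + b + c
    turn a b c = trans (ℕ.+-comm (b + c) a) (sym (ℕ.+-assoc a b c))

  OnLegs : ∀ {x y z} → MinTripod x y z → Fin n → Set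
  OnLegs M p = On (walkˣ M) p ⊎ On (walkʸ M) p ⊎ On (walkᶻ M) p

  onLegs? : ∀ {x y z} (M : MinTripod x y z) p → Dec (OnLegs M p)
  onLegs? M p = on? (walkˣ M) p ⊎-dec (on? (walkʸ M) p ⊎-dec on? (walkᶻ M) p)

  leg-shortest : ∀ {x y z} (M : MinTripod x y z) {j} → Walk x j (centre M) → a M ≤ j
  leg-shortest M {j} ω = ℕ.+-cancelʳ-≤ (b M) (a M) j
    (ℕ.+-cancelʳ-≤ (c M) (a M + b M) (j + b M) (minimal M (centre∈C M) ω (walkʸ M) (walkᶻ M)))

  -- Take `w` as the centre. The legs to `x` and `y` go through the second hits, which saves `i + 2`
  -- and `j + 2`; the leg to `z` goes through the first hit on the `x`-leg and back to the old
  -- centre, which costs only `i + 2`.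
  two-two : ∀ {x y z w ps qs p₁ p₂ q₁ q₂} (M : MinTripod x y z) → C w →
    ps ≡ p₁ ∷ p₂ ∷ [] → qs ≡ q₁ ∷ q₂ ∷ [] → Hits w x (walkˣ M) ps → Hits w y (walkʸ M) qs → ⊥
  two-two M Cw refl refl (two at Cp e ωˣ aeq) (two _ _ _ ωʸ beq) =
    two-two-count aeq beq (minimal M Cw ωˣ ωʸ (step Cw e (retreat at Cp (walkᶻ M))))

  -- With `w` as the centre no leg becomes longer, and the one with two hits becomes shorter by at
  -- least two.
  two-one-one : ∀ {x y z w ps qs rs p₁ p₂ q r} (M : MinTripod x y z) → C w →
    ps ≡ p₁ ∷ p₂ ∷ [] → qs ≡ q ∷ [] → rs ≡ r ∷ [] →
    Hits w x (walkˣ M) ps → Hits w y (walkʸ M) qs → Hits w z (walkᶻ M) rs → ⊥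
  two-one-one M Cw refl refl refl
    (two {i} {a′} _ _ _ ωˣ aeq) (one {j} {b′} _ _ ωʸ beq) (one {k} {c′} _ _ ωᶻ ceq) =
    ℕ.<⇒≱ (ℕ.+-mono-<-≤ (ℕ.+-mono-<-≤ a′<a (bound beq)) (bound ceq)) (minimal M Cw ωˣ ωʸ ωᶻ)
    where
    bound : ∀ {m k l} → m + k ≡ l → m ≤ l
    bound {m} {k} refl = ℕ.m≤m+n m k
    a′<a : a′ < a M
    a′<a = subst (suc a′ ≤_) aeq (s≤s (ℕ.m≤n⇒m≤1+n (ℕ.m≤m+n a′ i)))

  hits-≤2 : ∀ {w τ k u ps} {ω : Walk τ k u} → Hits w τ ω ps → length ps ≤ 2
  hits-≤2 none            = z≤n
  hits-≤2 (one _ _ _ _)   = s≤s z≤n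
  hits-≤2 (two _ _ _ _ _) = s≤s (s≤s z≤n)

  -- Four hits need two legs with two hits each, or the pattern two, one, one; up to rotation both
  -- are excluded.
  hits-≤3 : ∀ {x y z w ps qs rs} (M : MinTripod x y z) → C w →
    Hits w x (walkˣ M) ps → Hits w y (walkʸ M) qs → Hits w z (walkᶻ M) rs →
    length (ps ++ qs ++ rs) ≤ 3
  hits-≤3 M Cw none none h = ℕ.m≤n⇒m≤1+n (hits-≤2 h)
  hits-≤3 M Cw none (one _ _ _ _) h = s≤s (hits-≤2 h)
  hits-≤3 M Cw none (two _ _ _ _ _) none = s≤s (s≤s z≤n)
  hits-≤3 M Cw none (two _ _ _ _ _) (one _ _ _ _) = ℕ.≤-refl
  hits-≤3 M Cw (one _ _ _ _) none h = s≤s (hits-≤2 h)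
  hits-≤3 M Cw (one _ _ _ _) (one _ _ _ _) none = s≤s (s≤s z≤n)
  hits-≤3 M Cw (one _ _ _ _) (one _ _ _ _) (one _ _ _ _) = ℕ.≤-refl
  hits-≤3 M Cw (one _ _ _ _) (two _ _ _ _ _) none = ℕ.≤-refl
  hits-≤3 M Cw (two _ _ _ _ _) none none = s≤s (s≤s z≤n)
  hits-≤3 M Cw (two _ _ _ _ _) none (one _ _ _ _) = ℕ.≤-refl
  hits-≤3 M Cw (two _ _ _ _ _) (one _ _ _ _) none = ℕ.≤-refl
  hits-≤3 M Cw h@(two _ _ _ _ _) h′@(one _ _ _ _) h″@(one _ _ _ _) =
    ⊥-elim (two-one-one M Cw refl refl refl h h′ h″)
  hits-≤3 M Cw h@(one _ _ _ _) h′@(two _ _ _ _ _) h″@(one _ _ _ _) =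
    ⊥-elim (two-one-one (rotate M) Cw refl refl refl h′ h″ h)
  hits-≤3 M Cw h@(one _ _ _ _) h′@(one _ _ _ _) h″@(two _ _ _ _ _) =
    ⊥-elim (two-one-one (rotate (rotate M)) Cw refl refl refl h″ h h′)
  hits-≤3 M Cw h@(two _ _ _ _ _) h′@(two _ _ _ _ _) _ = ⊥-elim (two-two M Cw refl refl h h′)
  hits-≤3 M Cw h@(two _ _ _ _ _) (one _ _ _ _) h″@(two _ _ _ _ _) =
    ⊥-elim (two-two (rotate (rotate M)) Cw refl refl h″ h)
  hits-≤3 M Cw h@(two _ _ _ _ _) none h″@(two _ _ _ _ _) =
    ⊥-elim (two-two (rotate (rotate M)) Cw refl refl h″ h)
  hits-≤3 M Cw none h′@(two _ _ _ _ _) h″@(two _ _ _ _ _) =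
    ⊥-elim (two-two (rotate M) Cw refl refl h′ h″)
  hits-≤3 M Cw (one _ _ _ _) h′@(two _ _ _ _ _) h″@(two _ _ _ _ _) =
    ⊥-elim (two-two (rotate M) Cw refl refl h′ h″)

  one-from-centre : ∀ {τ k u w i p} {ω : Walk τ k u} → E w u → At ω (suc i) p → E w p → ∃[ j ] i ≡ suc j
  one-from-centre {i = suc j} wu at wp = j , refl
  one-from-centre {i = zero}  wu at wp = contradiction wp (no-triangle wu (at-consecutive here at))

  -- The leg that goes from the centre to `w` and on through the second hit has length `a′ + 1`,
  -- less than `a′ + i + 2`.
  ¬two-from-centre : ∀ {x y z w ps p q} (M : MinTripod x y z) → C w → E w (centre M) →
    ps ≡ p ∷ q ∷ [] → ¬ Hits w x (walkˣ M) ps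
  ¬two-from-centre M Cw e refl (two {i} {a′} at Cp wp ω aeq) =
    excess i (trans (sym aeq) (sym (ℕ.+-suc (suc a′) i))) (leg-shortest M (step (centre∈C M) (E-sym e) ω))

  -- No leg has two hits. If all three had one, it would lie at position two or later, for lack of
  -- triangles, and `w` as the centre would shorten every leg.
  hits-≤2-from-centre : ∀ {x y z w ps qs rs} (M : MinTripod x y z) → C w → E w (centre M) →
    Hits w x (walkˣ M) ps → Hits w y (walkʸ M) qs → Hits w z (walkᶻ M) rs →
    length (ps ++ qs ++ rs) ≤ 2
  hits-≤2-from-centre M Cw e h@(two _ _ _ _ _) _ _ = ⊥-elim (¬two-from-centre M Cw e refl h)
  hits-≤2-from-centre M Cw e none h@(two _ _ _ _ _) _ = ⊥-elim (¬two-from-centre (rotate M) Cw e refl h)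
  hits-≤2-from-centre M Cw e (one _ _ _ _) h@(two _ _ _ _ _) _ =
    ⊥-elim (¬two-from-centre (rotate M) Cw e refl h)
  hits-≤2-from-centre M Cw e none none h = hits-≤2 h
  hits-≤2-from-centre M Cw e none (one _ _ _ _) none = s≤s z≤n
  hits-≤2-from-centre M Cw e none (one _ _ _ _) (one _ _ _ _) = ℕ.≤-refl
  hits-≤2-from-centre M Cw e none (one _ _ _ _) h@(two _ _ _ _ _) =
    ⊥-elim (¬two-from-centre (rotate (rotate M)) Cw e refl h)
  hits-≤2-from-centre M Cw e (one _ _ _ _) none none = s≤s z≤n
  hits-≤2-from-centre M Cw e (one _ _ _ _) none (one _ _ _ _) = ℕ.≤-refl
  hits-≤2-from-centre M Cw e (one _ _ _ _) none h@(two _ _ _ _ _) =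
    ⊥-elim (¬two-from-centre (rotate (rotate M)) Cw e refl h)
  hits-≤2-from-centre M Cw e (one _ _ _ _) (one _ _ _ _) none = ℕ.≤-refl
  hits-≤2-from-centre M Cw e (one _ _ _ _) (one _ _ _ _) h@(two _ _ _ _ _) =
    ⊥-elim (¬two-from-centre (rotate (rotate M)) Cw e refl h)
  hits-≤2-from-centre M Cw e (one p₁ e₁ ωˣ aeq) (one p₂ e₂ ωʸ beq) (one p₃ e₃ ωᶻ ceq)
    with one-from-centre e p₁ e₁ | one-from-centre e p₂ e₂ | one-from-centre e p₃ e₃
  ... | i , refl | j , refl | k , refl =
    ⊥-elim (one-one-one-count aeq beq ceq (minimal M Cw ωˣ ωʸ ωᶻ))

  -- The centre lies on all three legs, so `Hits` leaves it out and it is counted once: if `w` is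
  -- adjacent to it, at most two hits remain.
  legs-≤3 : ∀ {x y z} (M : MinTripod x y z) {w} → C w →
    ∃[ ps ] length ps ≤ 3 × (∀ {p} → OnLegs M p → E w p → p ∈ˡ ps)
  legs-≤3 M {w} Cw with hits (walkˣ M) Cw (leg-shortest M) | hits (walkʸ M) Cw (leg-shortest (rotate M))
    | hits (walkᶻ M) Cw (leg-shortest (rotate (rotate M))) | E? w (centre M)
  ... | ps , hˣ , coverˣ | qs , hʸ , coverʸ | rs , hᶻ , coverᶻ | yes e =
    centre M ∷ ps ++ qs ++ rs , s≤s (hits-≤2-from-centre M Cw e hˣ hʸ hᶻ) , λ
      { (inj₁ (zero , here)) _ → here refl
      ; (inj₂ (inj₁ (zero , here))) _ → here refl
      ; (inj₂ (inj₂ (zero , here))) _ → here refl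
      ; (inj₁ (suc i , at)) wp → there (∈-++⁺ˡ (coverˣ at wp))
      ; (inj₂ (inj₁ (suc i , at))) wp → there (∈-++⁺ʳ ps (∈-++⁺ˡ (coverʸ at wp)))
      ; (inj₂ (inj₂ (suc i , at))) wp → there (∈-++⁺ʳ ps (∈-++⁺ʳ qs (coverᶻ at wp))) }
  ... | ps , hˣ , coverˣ | qs , hʸ , coverʸ | rs , hᶻ , coverᶻ | no ¬e =
    ps ++ qs ++ rs , hits-≤3 M Cw hˣ hʸ hᶻ , λ
      { (inj₁ (zero , here)) wp → contradiction wp ¬e
      ; (inj₂ (inj₁ (zero , here))) wp → contradiction wp ¬e
      ; (inj₂ (inj₂ (zero , here))) wp → contradiction wp ¬e
      ; (inj₁ (suc i , at)) wp → ∈-++⁺ˡ (coverˣ at wp)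
      ; (inj₂ (inj₁ (suc i , at))) wp → ∈-++⁺ʳ ps (∈-++⁺ˡ (coverʸ at wp))
      ; (inj₂ (inj₂ (suc i , at))) wp → ∈-++⁺ʳ ps (∈-++⁺ʳ qs (coverᶻ at wp)) }

-- Vertices off the legs, and legs that avoid two given vertices.

off-legs-count : ∀ {i l a b c j} → suc (suc i) + l ≡ a → 1 + j ≡ c → ¬ a + b + c ≤ suc l + suc b + j
off-legs-count {i} {l} {b = b} {j = j} refl refl = excess i (identity i l b j)
  where
  identity : ∀ i l b j → suc (suc i) + l + b + (1 + j) ≡ suc l + suc b + j + suc i
  identity = solve 4 (λ i l b j → con 2 :+ i :+ l :+ b :+ (con 1 :+ j)
    := con 1 :+ l :+ (con 1 :+ b) :+ j :+ (con 1 :+ i)) refl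
    where
    open +-*-Solver

disjoint-count : ∀ {i l j r a b c} → suc i + l ≡ a → suc j + r ≡ b → ¬ a + b + c ≤ l + r + (suc i + c)
disjoint-count {i} {l} {j} {r} {c = c} refl refl = excess j (identity i l j r c)
  where
  identity : ∀ i l j r c → suc i + l + (suc j + r) + c ≡ l + r + (suc i + c) + suc j
  identity = solve 5 (λ i l j r c → con 1 :+ i :+ l :+ (con 1 :+ j :+ r) :+ c
    := l :+ r :+ (con 1 :+ i :+ c) :+ (con 1 :+ j)) refl
    where
    open +-*-Solver

module TripodFacts {n} (G : ColouredGraph n) (C : Fin n → Set) where
  open ColouredGraph G
  open Walks G C
  open Tripods G C
  open MinTripod

  linked-at : ∀ {Q : Fin n → Set} {τ k u i p} {ω : Walk τ k u} → (∀ {q} → On ω q → Q q) → At ω i p → Linked Q u p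
  linked-at onQ here = ε
  linked-at {ω = step _ e _} onQ (there x) =
    (e , onQ (0 , here) , onQ (1 , there here)) ◅ linked-at (λ (i , y) → onQ (suc i , there y)) x

  linked-end : ∀ {Q : Fin n → Set} {τ k u} (ω : Walk τ k u) → (∀ {q} → On ω q → Q q) → Linked Q u τ
  linked-end ω onQ = linked-at onQ (walk-end ω)

  first-step : ∀ {τ k u} (ω : Walk τ k u) → u ≡ τ ⊎ ∃[ v ] At ω 1 v
  first-step []           = inj₁ refl
  first-step (step _ _ _) = inj₂ (_ , there here)

  node : ∀ {τ k u} → Walk τ k u → ℕ → List (Fin n)
  node ω i with at? ω i
  ... | yes (p , _) = p ∷ []
  ... | no _        = []

  node-≤1 : ∀ {τ k u} (ω : Walk τ k u) i → length (node ω i) ≤ 1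
  node-≤1 ω i with at? ω i
  ... | yes _ = ℕ.≤-refl
  ... | no _  = z≤n

  ∈-node : ∀ {τ k u i p} {ω : Walk τ k u} → At ω i p → p ∈ˡ node ω i
  ∈-node {i = i} {ω = ω} x with at? ω i
  ... | yes (_ , y) = here (at-unique x y)
  ... | no  out     = contradiction (_ , x) out

  centre-neighbour : ∀ {x y z i p} (M : MinTripod x y z) → At (walkˣ M) i p → E (centre M) p → i ≡ 1
  centre-neighbour {i = zero}  M here e = contradiction e E-irrefl
  centre-neighbour {i = suc zero} M at e = refl
  centre-neighbour {i = suc (suc i)} M at e with suffix at
  ... | l , ω , eq = contradiction (leg-shortest M (step (centre∈C M) e ω))
    (excess i (trans (sym eq) (cong suc (trans (cong suc (ℕ.+-comm i l)) (sym (ℕ.+-suc l i))))))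

  module _ {x y z} (M : MinTripod x y z) where

    Near : Fin n → Fin n → Set
    Near w p = E w p × p ≢ z × (C p ⊎ p ≡ x ⊎ p ≡ y)

    -- Let `v` be the vertex after the centre on the `z`-leg, and suppose that the legs cover `C`.
    -- If `v` is `z`, the centre has no near neighbours but the first vertices of the other two
    -- legs. If not, `v` is near only to the centre and to its successor: any other neighbour on a
    -- leg would give a shorter tripod centred at `v`, or a shorter `z`-leg. Either way there are at
    -- most two. `Near` omits `z`, a vertex of the copy, since degrees are counted outside the copy.
    off-leg : ¬ C z → (∀ {w} → C w → AtLeast 3 (Near w)) → (∀ {w} → C w → ¬ OnLegs M w → ⊥) → ⊥
    off-leg z∉C degree absurd with first-step (walkᶻ M)
    ... | inj₁ refl = z∉C (centre∈C M)
    ... | inj₂ (v , v-at-1) = [ v≡z-case , v∈C-case ]′ (end-or-inside v-at-1)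
      where
      u = centre M
      covered : ∀ {p} → C p ⊎ p ≡ x ⊎ p ≡ y → OnLegs M p
      covered {p} (inj₁ Cp) with onLegs? M p
      ... | yes on = on
      ... | no off = ⊥-elim (absurd Cp off)
      covered (inj₂ (inj₁ refl)) = inj₁ (_ , walk-end (walkˣ M))
      covered (inj₂ (inj₂ refl)) = inj₂ (inj₁ (_ , walk-end (walkʸ M)))
      too-few : ∀ {w} ps qs → length ps ≤ 1 → length qs ≤ 1 → C w → (∀ {p} → Near w p → p ∈ˡ ps ++ qs) → ⊥
      too-few []          []          _ _ Cw cover = case AtLeast-covered 3 _ cover (degree Cw) of λ ()
      too-few (_ ∷ [])    []          _ _ Cw cover = case AtLeast-covered 3 _ cover (degree Cw) of λ { (s≤s ()) }
      too-few []          (_ ∷ [])    _ _ Cw cover = case AtLeast-covered 3 _ cover (degree Cw) of λ { (s≤s ()) }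
      too-few (_ ∷ [])    (_ ∷ [])    _ _ Cw cover = case AtLeast-covered 3 _ cover (degree Cw) of λ { (s≤s (s≤s ())) }
      too-few (_ ∷ _ ∷ _) _           (s≤s ()) _ _ _
      too-few _           (_ ∷ _ ∷ _) _ (s≤s ()) _ _
      v≡z-case : v ≡ z → ⊥
      v≡z-case v≡z = too-few (node (walkˣ M) 1) (node (walkʸ M) 1) (node-≤1 (walkˣ M) 1) (node-≤1 (walkʸ M) 1)
        (centre∈C M) cover
        where
        cover : ∀ {p} → Near u p → p ∈ˡ node (walkˣ M) 1 ++ node (walkʸ M) 1
        cover (e , p≢z , near) with covered near
        ... | inj₁ (i , at) with centre-neighbour M at e
        ... | refl = ∈-++⁺ˡ (∈-node at)
        cover (e , p≢z , near) | inj₂ (inj₁ (i , at)) with centre-neighbour (rotate M) at e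
        ... | refl = ∈-++⁺ʳ (node (walkˣ M) 1) (∈-node at)
        cover (e , p≢z , near) | inj₂ (inj₂ (i , at)) with centre-neighbour (rotate (rotate M)) at e
        ... | refl = contradiction (trans (at-unique at v-at-1) v≡z) p≢z
      v∈C-case : C v → ⊥
      v∈C-case Cv with suffix v-at-1
      ... | j , ωᶻ , c≡ = too-few (u ∷ []) (node (walkᶻ M) 2) ℕ.≤-refl (node-≤1 (walkᶻ M) 2) Cv cover
        where
        uv : E u v
        uv = at-consecutive here v-at-1
        cover : ∀ {p} → Near v p → p ∈ˡ u ∷ node (walkᶻ M) 2
        cover (e , p≢z , near) with covered near
        ... | inj₁ (zero , here) = here refl
        ... | inj₁ (suc zero , at) = contradiction e (no-triangle (E-sym uv) (at-consecutive here at))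
        ... | inj₁ (suc (suc i) , at) with suffix at
        ... | l , ωˣ , a≡ = contradiction (minimal M Cv (step Cv e ωˣ) (step Cv (E-sym uv) (walkʸ M)) ωᶻ)
                              (off-legs-count {i} a≡ c≡)
        cover (e , p≢z , near) | inj₂ (inj₁ (zero , here)) = here refl
        cover (e , p≢z , near) | inj₂ (inj₁ (suc zero , at)) =
          contradiction e (no-triangle (E-sym uv) (at-consecutive here at))
        cover (e , p≢z , near) | inj₂ (inj₁ (suc (suc i) , at)) with suffix at
        ... | l , ωʸ , b≡ = contradiction (minimal M Cv (step Cv (E-sym uv) (walkˣ M)) (step Cv e ωʸ) ωᶻ)
          λ le → off-legs-count {i} b≡ c≡ (subst (b M + a M + c M ≤_) (cong (_+ j) (ℕ.+-comm (suc (a M)) (suc l)))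
                   (subst (_≤ suc (a M) + suc l + j) (cong (_+ c M) (ℕ.+-comm (a M) (b M))) le))
        cover (e , p≢z , near) | inj₂ (inj₂ (zero , here)) = here refl
        cover (e , p≢z , near) | inj₂ (inj₂ (suc zero , at)) =
          contradiction (subst (E v) (at-unique at v-at-1) e) E-irrefl
        cover (e , p≢z , near) | inj₂ (inj₂ (suc (suc zero) , at)) = there (∈-node at)
        cover (e , p≢z , near) | inj₂ (inj₂ (suc (suc (suc i)) , at)) with suffix at
        ... | l , ω , eq = contradiction
          (leg-shortest (rotate (rotate M)) (step (centre∈C M) uv (step Cv e ω)))
          (excess i (trans (sym eq) (cong (λ m → suc (suc m)) (trans (cong suc (ℕ.+-comm i l)) (sym (ℕ.+-suc l i))))))

    -- A common vertex in `C` could be the centre: `z` is reached by backing up the `x`-leg, and the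
    -- first `j + 1` steps of the `y`-leg are saved.
    legs-disjoint : ∀ {i j p} → ¬ C x → ¬ C y → x ≢ y → At (walkˣ M) (suc i) p → At (walkʸ M) (suc j) p → ⊥
    legs-disjoint x∉C y∉C x≢y atˣ atʸ with end-or-inside atˣ | end-or-inside atʸ
    ... | inj₁ refl | inj₁ refl = x≢y refl
    ... | inj₁ refl | inj₂ Cx   = x∉C Cx
    ... | inj₂ Cy   | inj₁ refl = y∉C Cy
    ... | inj₂ Cp   | inj₂ _ with suffix atˣ | suffix atʸ
    ... | l , ωˣ , a≡ | r , ωʸ , b≡ =
      disjoint-count a≡ b≡ (minimal M Cp ωˣ ωʸ (retreat atˣ Cp (walkᶻ M)))

    clash : ∀ {p} → ¬ C x → ¬ C y → x ≢ y → p ≢ centre M → On (walkˣ M) p → On (walkʸ M) p → ⊥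
    clash x∉C y∉C x≢y p≢u (zero  , here) _              = p≢u refl
    clash x∉C y∉C x≢y p≢u (suc i , at)   (zero , here)  = p≢u refl
    clash x∉C y∉C x≢y p≢u (suc i , at)   (suc j , at′)  = legs-disjoint x∉C y∉C x≢y at at′

  Avoids : ∀ {τ k u} → Walk τ k u → Fin n → Fin n → Set
  Avoids ω p q = ∀ {r} → On ω r → r ≢ p × r ≢ q

  blocked? : ∀ {τ k u} (ω : Walk τ k u) p q → (On ω p ⊎ On ω q) ⊎ Avoids ω p q
  blocked? ω p q with on? ω p | on? ω q
  ... | yes on | _      = inj₁ (inj₁ on)
  ... | no  _  | yes on = inj₁ (inj₂ on)
  ... | no off | no off′ = inj₂ λ on → (λ { refl → off on }) , (λ { refl → off′ on })

  -- The legs share only the centre, so each of `p` and `q` blocks at most one of the three.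
  free-leg : ∀ {x y z p q} (M : MinTripod x y z) → ¬ C x → ¬ C y → ¬ C z → x ≢ y → y ≢ z → x ≢ z →
    p ≢ centre M → q ≢ centre M →
    Avoids (walkˣ M) p q ⊎ Avoids (walkʸ M) p q ⊎ Avoids (walkᶻ M) p q
  free-leg {p = p} {q} M x∉C y∉C z∉C x≢y y≢z x≢z p≢u q≢u
    with blocked? (walkˣ M) p q | blocked? (walkʸ M) p q | blocked? (walkᶻ M) p q
  ... | inj₂ free | _         | _         = inj₁ free
  ... | inj₁ _    | inj₂ free | _         = inj₂ (inj₁ free)
  ... | inj₁ _    | inj₁ _    | inj₂ free = inj₂ (inj₂ free)
  ... | inj₁ bˣ   | inj₁ bʸ   | inj₁ bᶻ   = ⊥-elim (pigeonhole bˣ bʸ bᶻ)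
    where
    xy : ∀ {s} → s ≢ centre M → On (walkˣ M) s → On (walkʸ M) s → ⊥
    xy = clash M x∉C y∉C x≢y
    yz : ∀ {s} → s ≢ centre M → On (walkʸ M) s → On (walkᶻ M) s → ⊥
    yz = clash (rotate M) y∉C z∉C y≢z
    xz : ∀ {s} → s ≢ centre M → On (walkˣ M) s → On (walkᶻ M) s → ⊥
    xz s≢u onˣ onᶻ = clash (rotate (rotate M)) z∉C x∉C (x≢z ∘ sym) s≢u onᶻ onˣ
    pigeonhole : On (walkˣ M) p ⊎ On (walkˣ M) q → On (walkʸ M) p ⊎ On (walkʸ M) q →
                 On (walkᶻ M) p ⊎ On (walkᶻ M) q → ⊥
    pigeonhole (inj₁ s) (inj₁ t) _        = xy p≢u s t
    pigeonhole (inj₂ s) (inj₂ t) _        = xy q≢u s t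
    pigeonhole (inj₁ s) (inj₂ _) (inj₁ t) = xz p≢u s t
    pigeonhole (inj₁ _) (inj₂ s) (inj₂ t) = yz q≢u s t
    pigeonhole (inj₂ _) (inj₁ s) (inj₁ t) = yz p≢u s t
    pigeonhole (inj₂ s) (inj₁ _) (inj₂ t) = xz q≢u s t

-- An inseparable set in a graph of minimum degree three.

-- C is shrunk as long as some cut separates it, where the at most two vertices x, y attaching C to the
-- rest of P count as adjacent because they are linked outside C. A minimal C is inseparable.
module Block {n} (G : ColouredGraph n) (P : Fin n → Set) (P? : ∀ u → Dec (P u))
  (degree : ∀ {u} → P u → AtLeast 3 (λ v → ColouredGraph.E G u v × P v))
  (found : ∀ B → (∀ {u} → u ∈ B → P u) → ColouredGraph.Inseparable G P B → Big B → ⊥) where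
  open ColouredGraph G

  Rest : Subset n → Fin n → Set
  Rest C u = P u × u ∉ C

  -- Equal `x` and `y` stand for a single attachment, and vertices outside `P` for none; `outer` is
  -- then the empty walk.
  record Piece (C : Subset n) (x y : Fin n) : Set where
    field
      {member} : Fin n
      member∈C : member ∈ C
      C⊆P      : ∀ {u} → u ∈ C → P u
      closed   : ∀ {u v} → u ∈ C → E u v → P v → v ∈ C ⊎ v ≡ x ⊎ v ≡ y
      x∉C      : x ∉ C
      y∉C      : y ∉ C
      outer    : Linked (Rest C) x y

  module Torso {C x y} (piece : Piece C x y) (minimal : ∀ {K σ τ} → K ⊂ C → Piece K σ τ → ⊥) where
    open Piece piece

    H : Fin n → Set
    H u = P u × (u ∈ C ⊎ u ≡ x ⊎ u ≡ y)

    -- The last two alternatives are the virtual edge of the torso.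
    Step : Fin n → Fin n → Set
    Step u v = E u v ⊎ (u ≡ x × v ≡ y) ⊎ (u ≡ y × v ≡ x)

    step-sym : ∀ {u v} → Step u v → Step v u
    step-sym (inj₁ e)              = inj₁ (E-sym e)
    step-sym (inj₂ (inj₁ (p , q))) = inj₂ (inj₂ (q , p))
    step-sym (inj₂ (inj₂ (p , q))) = inj₂ (inj₁ (q , p))

    Joined : Fin n → Fin n → Fin n → Fin n → Set
    Joined σ τ = Star (λ u v → Step u v × Cut H σ τ u × Cut H σ τ v)

    joined-sym : ∀ {σ τ u v} → Joined σ τ u v → Joined σ τ v u
    joined-sym = Star.reverse λ (s , p , q) → step-sym s , q , p

    joined-target : ∀ {σ τ u v} → Cut H σ τ u → Joined σ τ u v → Cut H σ τ v
    joined-target h ε                  = h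
    joined-target _ ((_ , _ , h) ◅ js) = joined-target h js

    in-cut : ∀ {σ τ c} → c ∈ C → c ≢ σ → c ≢ τ → Cut H σ τ c
    in-cut c∈C c≢σ c≢τ = (C⊆P c∈C , inj₁ c∈C) , c≢σ , c≢τ

    record Apart (σ τ c c′ : Fin n) : Set where
      field
        c∈C    : c ∈ C
        c′∈C   : c′ ∈ C
        c-cut  : Cut H σ τ c
        c′-cut : Cut H σ τ c′
        apart  : ¬ Joined σ τ c c′

    -- `x` and `y` are adjacent in the torso, so the sides of `c` and `c′` cannot both meet them.
    -- The pair is handed on in the order in which the side of its first member avoids both.
    side : ∀ {σ τ c c′} → Apart σ τ c c′ →
      (∀ {c c′} → Apart σ τ c c′ → ¬ Joined σ τ c x → ¬ Joined σ τ c y → ⊥) → ⊥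
    side {σ} {τ} {c} {c′} A k = k A (other ∘ inj₁) (other ∘ inj₂)
      where
      open Apart A
      swapped : Apart σ τ c′ c
      swapped = record { c∈C = c′∈C ; c′∈C = c∈C ; c-cut = c′-cut ; c′-cut = c-cut ; apart = apart ∘ joined-sym }
      meet : ∀ {p q} → Step p q → Joined σ τ c p → Joined σ τ c′ q → ⊥
      meet s cp c′q = apart (cp ◅◅ (s , joined-target c-cut cp , joined-target c′-cut c′q) ◅ joined-sym c′q)
      other : Joined σ τ c x ⊎ Joined σ τ c y → ⊥
      other (inj₁ cx) = k swapped (λ c′x → apart (cx ◅◅ joined-sym c′x))
                                  (λ c′y → meet (inj₂ (inj₁ (refl , refl))) cx c′y)
      other (inj₂ cy) = k swapped (λ c′x → meet (inj₂ (inj₂ (refl , refl))) cy c′x)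
                                  (λ c′y → apart (cy ◅◅ joined-sym c′y))

    -- The side `K` of `c` is attached only to `σ` and `τ` and misses `c′`. Once these two are
    -- linked outside `K`, it is a smaller piece.
    smaller : ∀ {σ τ c c′} → Apart σ τ c c′ → ¬ Joined σ τ c x → ¬ Joined σ τ c y →
      (∀ {K} → K ⊂ C → (∀ {u} → u ∈ K → Joined σ τ c u) → (∀ {u} → Joined σ τ c u → u ∈ K) →
       Linked (Rest K) σ τ) → ⊥
    smaller {σ} {τ} {c} {c′} A ¬cx ¬cy link = comprehension (Joined σ τ c) λ K sound complete →
      let inside : ∀ {u} → u ∈ K → u ∈ C
          inside u∈K = case proj₂ (proj₁ (joined-target c-cut (sound u∈K))) of λ
            { (inj₁ u∈C)         → u∈C
            ; (inj₂ (inj₁ refl)) → contradiction (sound u∈K) ¬cx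
            ; (inj₂ (inj₂ refl)) → contradiction (sound u∈K) ¬cy }
          K⊂C : K ⊂ C
          K⊂C = inside , c′ , c′∈C , apart ∘ sound
          near : ∀ {u v} → u ∈ K → E u v → P v → v ∈ K ⊎ v ≡ σ ⊎ v ≡ τ
          near {u} {v} u∈K e Pv = case v ≟ σ of λ
            { (yes v≡σ) → inj₂ (inj₁ v≡σ)
            ; (no v≢σ) → case v ≟ τ of λ
              { (yes v≡τ) → inj₂ (inj₂ v≡τ)
              ; (no v≢τ) → inj₁ (complete (sound u∈K ◅◅
                  (inj₁ e , joined-target c-cut (sound u∈K) ,
                   (Pv , closed (inside u∈K) e Pv) , v≢σ , v≢τ) ◅ ε)) } }
      in minimal K⊂C record
        { member∈C = complete ε ; C⊆P = λ u∈K → C⊆P (inside u∈K) ; closed = near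
        ; x∉C = λ σ∈K → proj₁ (proj₂ (joined-target c-cut (sound σ∈K))) refl
        ; y∉C = λ τ∈K → proj₂ (proj₂ (joined-target c-cut (sound τ∈K))) refl
        ; outer = link K⊂C sound complete }
      where
      open Apart A

    one-cut : ∀ {σ c c′} → c ∈ C → c′ ∈ C → c ≢ σ → c′ ≢ σ → ¬ ¬ Joined σ σ c c′
    one-cut c∈C c′∈C c≢σ c′≢σ ¬j = side
      (record { c∈C = c∈C ; c′∈C = c′∈C ; c-cut = in-cut c∈C c≢σ c≢σ ; c′-cut = in-cut c′∈C c′≢σ c′≢σ ; apart = ¬j })
      -- Both attachments of the smaller piece are `σ`, which the empty walk links to itself.
      λ A ¬cx ¬cy → smaller A ¬cx ¬cy λ _ _ _ → ε

    follow : ∀ {K u v} → K ⊂ C → Step u v → Rest K u → Rest K v → Linked (Rest K) u v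
    follow K⊂C (inj₁ e) p q = (e , p , q) ◅ ε
    follow K⊂C (inj₂ (inj₁ (refl , refl))) p q =
      linked-mono (λ (Pu , u∉C) → Pu , u∉C ∘ proj₁ K⊂C) outer
    follow K⊂C (inj₂ (inj₂ (refl , refl))) p q =
      linked-sym (linked-mono (λ (Pu , u∉C) → Pu , u∉C ∘ proj₁ K⊂C) outer)

    -- A walk from a to c that avoids ρ must leave the complement of K through the other cut vertex ω.
    first-exit : ∀ {σ τ K c ρ ω} → K ⊂ C → (∀ {u} → H u → u ≢ ρ → u ≢ ω → Cut H σ τ u) →
      (∀ {u} → u ∈ K → Joined σ τ c u) → (∀ {u} → Joined σ τ c u → u ∈ K) → ω ∉ K →
      ∀ {a} → Joined ρ ρ a c → Cut H σ τ a → a ∉ K → Linked (Rest K) a ω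
    first-exit K⊂C cut sound complete ω∉K ε a-cut a∉K = contradiction (complete ε) a∉K
    first-exit {ω = ω} K⊂C cut sound complete ω∉K {a} (_◅_ {j = b} (s , (Ha , a≢ρ , _) , (Hb , b≢ρ , _)) js) a-cut a∉K
      with b ≟ ω
    ... | yes refl = follow K⊂C s (proj₁ Ha , a∉K) (proj₁ Hb , ω∉K)
    ... | no b≢ω   = follow K⊂C s (proj₁ Ha , a∉K) (proj₁ Hb , b∉K) ◅◅
                     first-exit K⊂C cut sound complete ω∉K js b-cut b∉K
      where
      b-cut = cut Hb b≢ρ b≢ω
      b∉K : b ∉ _
      b∉K b∈K = a∉K (complete (sound b∈K ◅◅ (step-sym s , b-cut , a-cut) ◅ ε))

    -- To link `σ` and `τ` outside `K`, delete only one of them: by `one-cut` there is still a walk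
    -- from `c′` to `c`, and it can enter `K` only after meeting the other. So both are linked to
    -- `c′` outside `K`.
    two-cut : ∀ {σ τ c c′} → c ∈ C → c′ ∈ C → c ≢ σ → c ≢ τ → c′ ≢ σ → c′ ≢ τ → ¬ ¬ Joined σ τ c c′
    two-cut {σ} {τ} u∈C v∈C u≢σ u≢τ v≢σ v≢τ ¬j = side
      (record { c∈C = u∈C ; c′∈C = v∈C ; c-cut = in-cut u∈C u≢σ u≢τ ; c′-cut = in-cut v∈C v≢σ v≢τ ; apart = ¬j })
      resolve
      where
      resolve : ∀ {c c′} → Apart σ τ c c′ → ¬ Joined σ τ c x → ¬ Joined σ τ c y → ⊥
      resolve A ¬cx ¬cy =
        one-cut c′∈C c∈C (proj₁ (proj₂ c′-cut)) (proj₁ (proj₂ c-cut)) λ avoid-σ →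
        one-cut c′∈C c∈C (proj₂ (proj₂ c′-cut)) (proj₂ (proj₂ c-cut)) λ avoid-τ →
        smaller A ¬cx ¬cy λ K⊂C sound complete →
          linked-sym (first-exit K⊂C (λ h p q → h , q , p) sound complete
            (λ σ∈K → proj₁ (proj₂ (joined-target c-cut (sound σ∈K))) refl) avoid-τ c′-cut (apart ∘ sound))
          ◅◅ first-exit K⊂C (λ h p q → h , p , q) sound complete
            (λ τ∈K → proj₂ (proj₂ (joined-target c-cut (sound τ∈K))) refl) avoid-σ c′-cut (apart ∘ sound)
        where
        open Apart A

    linked-cut-swap : ∀ {σ τ u v} → Linked (Cut P σ τ) u v → Linked (Cut P τ σ) u v
    linked-cut-swap = linked-mono λ (p , q , r) → p , r , q

    -- A cut vertex σ outside C only matters where it breaks the link from x to y, so cutting x or y instead suffices.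
    cut-outside : ∀ {σ τ c c′} → σ ∉ C → c ∈ C → c′ ∈ C → c ≢ σ → c ≢ τ → c′ ≢ σ → c′ ≢ τ →
      ¬ ¬ Linked (Cut P σ τ) c c′
    cut-outside {σ} {τ} σ∉C c∈C c′∈C c≢σ c≢τ c′≢σ c′≢τ ¬l with σ ≟ y
    ... | yes refl = two-cut c∈C c′∈C c≢σ c≢τ c′≢σ c′≢τ λ j → ¬l (Star.map
      (λ { (inj₁ e , ((Pu , _) , u≢ , u≢′) , ((Pv , _) , v≢ , v≢′)) → e , (Pu , u≢ , u≢′) , (Pv , v≢ , v≢′)
         ; (inj₂ (inj₁ (_ , refl)) , _ , (_ , v≢ , _)) → contradiction refl v≢
         ; (inj₂ (inj₂ (refl , _)) , (_ , u≢ , _) , _) → contradiction refl u≢ }) j)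
    ... | no σ≢y = two-cut c∈C c′∈C (≢x c∈C) c≢τ (≢x c′∈C) c′≢τ λ j → ¬l (Star.map
      (λ { (inj₁ e , (Hu , u≢ , u≢′) , (Hv , v≢ , v≢′)) →
             e , (proj₁ Hu , ≢σ Hu u≢ , u≢′) , (proj₁ Hv , ≢σ Hv v≢ , v≢′)
         ; (inj₂ (inj₁ (refl , _)) , (_ , u≢ , _) , _) → contradiction refl u≢
         ; (inj₂ (inj₂ (_ , refl)) , _ , (_ , v≢ , _)) → contradiction refl v≢ }) j)
      where
      ≢x : ∀ {u} → u ∈ C → u ≢ x
      ≢x u∈C refl = x∉C u∈C
      ≢σ : ∀ {u} → H u → u ≢ x → u ≢ σ
      ≢σ (_ , inj₁ u∈C) _ refl         = σ∉C u∈C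
      ≢σ (_ , inj₂ (inj₁ u≡x)) u≢x _   = u≢x u≡x
      ≢σ (_ , inj₂ (inj₂ refl)) _ y≡σ  = σ≢y (sym y≡σ)

    inseparable : Inseparable P C
    inseparable σ τ {c} {c′} c∈C c′∈C c≢σ c≢τ c′≢σ c′≢τ =
      decidable-stable (linked-cut? P? σ τ c c′) λ ¬l → by-place ¬l (σ ∈? C) (τ ∈? C)
      where
      by-place : ¬ Linked (Cut P σ τ) c c′ → Dec (σ ∈ C) → Dec (τ ∈ C) → ⊥
      by-place ¬l (no σ∉C) _ = cut-outside σ∉C c∈C c′∈C c≢σ c≢τ c′≢σ c′≢τ ¬l
      by-place ¬l _ (no τ∉C) =
        cut-outside τ∉C c∈C c′∈C c≢τ c≢σ c′≢τ c′≢σ λ l → ¬l (linked-cut-swap l)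
      by-place ¬l (yes σ∈C) (yes τ∈C) = two-cut c∈C c′∈C c≢σ c≢τ c′≢σ c′≢τ λ j → ¬l (Star.kleisliStar id convert j)
        where
        -- With both cut vertices in `C`, the link outside `C` avoids them and can replace the
        -- virtual edge.
        around : Linked (Cut P σ τ) x y
        around = linked-mono (λ (Pu , u∉C) → Pu , (λ { refl → u∉C σ∈C }) , (λ { refl → u∉C τ∈C })) outer
        convert : ∀ {u v} → Step u v × Cut H σ τ u × Cut H σ τ v → Linked (Cut P σ τ) u v
        convert (inj₁ e , ((Pu , _) , u≢) , ((Pv , _) , v≢)) = (e , (Pu , u≢) , (Pv , v≢)) ◅ ε
        convert (inj₂ (inj₁ (refl , refl)) , _) = around
        convert (inj₂ (inj₂ (refl , refl)) , _) = linked-sym around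

    inner-neighbour : ∃[ w ] E member w × w ∈ C
    inner-neighbour = proj₁ found-one , proj₁ (proj₂ found-one)
      where
      leave : ∀ {v} → E member v × P v → v ∈ˡ x ∷ y ∷ [] ⊎ (E member v × v ∈ C)
      leave (e , Pv) with closed member∈C e Pv
      ... | inj₁ v∈C         = inj₂ (e , v∈C)
      ... | inj₂ (inj₁ refl) = inj₁ (here refl)
      ... | inj₂ (inj₂ refl) = inj₁ (there (here refl))
      found-one : AtLeast 1 (λ v → E member v × v ∈ C)
      found-one = AtLeast-discard 1 (x ∷ y ∷ []) leave (degree (C⊆P member∈C))

    -- Two adjacent vertices of C have six different neighbours, at most two of which lie outside C.
    big : Big C
    big p q r = proj₁ found-one , proj₁ (proj₂ found-one)
      where
      w = proj₁ inner-neighbour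
      mw = proj₁ (proj₂ inner-neighbour)
      w∈C = proj₂ (proj₂ inner-neighbour)
      S = x ∷ y ∷ p ∷ q ∷ r ∷ []
      Good : Fin n → Set
      Good v = v ∈ C × v ≢ p × v ≢ q × v ≢ r
      avoid : ∀ {v} → v ∈ C ⊎ v ≡ x ⊎ v ≡ y → v ∈ˡ S ⊎ Good v
      avoid (inj₂ (inj₁ refl)) = inj₁ (here refl)
      avoid (inj₂ (inj₂ refl)) = inj₁ (there (here refl))
      avoid {v} (inj₁ v∈C) with v ≟ p | v ≟ q | v ≟ r
      ... | yes v≡ | _      | _      = inj₁ (there (there (here v≡)))
      ... | no _   | yes v≡ | _      = inj₁ (there (there (there (here v≡))))
      ... | no _   | no _   | yes v≡ = inj₁ (there (there (there (there (here v≡)))))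
      ... | no v≢p | no v≢q | no v≢r = inj₂ (v∈C , v≢p , v≢q , v≢r)
      leave : ∀ {v} → (E member v × P v) ⊎ (E w v × P v) → v ∈ˡ S ⊎ Good v
      leave (inj₁ (e , Pv)) = avoid (closed member∈C e Pv)
      leave (inj₂ (e , Pv)) = avoid (closed w∈C e Pv)
      found-one : AtLeast 1 Good
      found-one = AtLeast-discard 1 S leave (AtLeast-⊎ 3 3 (λ (mv , _) (wv , _) → no-triangle mw wv mv)
        (degree (C⊆P member∈C)) (degree (C⊆P w∈C)))

  shrink : ∀ f {C x y} → ∣ C ∣ < f → Piece C x y → ⊥
  shrink (suc f) {C} (s≤s ∣C∣≤f) piece = found C (Piece.C⊆P piece) inseparable big
    where
    open Torso piece (λ K⊂C → shrink f (ℕ.<-≤-trans (p⊂q⇒∣p∣<∣q∣ K⊂C) ∣C∣≤f))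

  -- The first piece is all of `P`. It has no attachments, so the dummy `o` outside `P` takes the
  -- place of both.
  block : ∀ {u o} → P u → ¬ P o → ⊥
  block {u} {o} Pu ¬Po = comprehension P λ C sound complete → shrink (suc ∣ C ∣) ℕ.≤-refl record
    { member∈C = complete Pu ; C⊆P = sound ; closed = λ _ _ Pv → inj₁ (complete Pv)
    ; x∉C = ¬Po ∘ sound ; y∉C = ¬Po ∘ sound ; outer = ε {x = o} }

-- Combs, partial embeddings and greedy extension.

update : ∀ {A B : Set} → (∀ (x y : A) → Dec (x ≡ y)) → (A → B) → A → B → A → B
update _≟ᴬ_ f x b y with y ≟ᴬ x
... | yes _ = b
... | no _  = f y

update-≡ : ∀ {A B : Set} (_≟ᴬ_ : ∀ (x y : A) → Dec (x ≡ y)) (f : A → B) x b → update _≟ᴬ_ f x b x ≡ b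
update-≡ _≟ᴬ_ f x b with x ≟ᴬ x
... | yes _  = refl
... | no x≢x = contradiction refl x≢x

update-≢ : ∀ {A B : Set} (_≟ᴬ_ : ∀ (x y : A) → Dec (x ≡ y)) (f : A → B) x b {y} → y ≢ x →
  update _≟ᴬ_ f x b y ≡ f y
update-≢ _≟ᴬ_ f x b {y} y≢x with y ≟ᴬ x
... | yes y≡x = contradiction y≡x y≢x
... | no _    = refl

-- home u is the position on the spine of u itself or, for a vertex off the spine, of its only neighbour.
record Comb (m t : ℕ) : Set₁ where
  field
    Node       : Fin m → Set
    Node?      : ∀ u → Dec (Node u)
    Adjacent   : Fin m → Fin m → Set
    adj-sym    : ∀ {u v} → Adjacent u v → Adjacent v u
    colourᵀ    : Fin m → Bool
    colourᵀ-≢  : ∀ {u v} → Adjacent u v → colourᵀ u ≢ colourᵀ v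
    class-≤    : ∀ β → ¬ AtLeast (suc t) (λ u → Node u × colourᵀ u ≡ β)
    s          : ℕ
    spine      : ℕ → Fin m
    home       : Fin m → ℕ
    home<s     : ∀ {u} → Node u → home u < s
    spine-node : ∀ {i} → i < s → Node (spine i)
    home-spine : ∀ {i} → i < s → home (spine i) ≡ i
    spine-adj  : ∀ {i} → suc i < s → Adjacent (spine i) (spine (suc i))
    leaf-adj   : ∀ {u} → Node u → u ≢ spine (home u) → Adjacent u (spine (home u))
    adj-cases  : ∀ {u v} → Adjacent u v →
      (u ≡ spine (home u) × v ≡ spine (home v) × (home v ≡ suc (home u) ⊎ home u ≡ suc (home v))) ⊎
      (home u ≡ home v × (u ≡ spine (home u) ⊎ v ≡ spine (home v)))

  spine-injective : ∀ {i j} → i < s → j < s → spine i ≡ spine j → i ≡ j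
  spine-injective i<s j<s eq = trans (sym (home-spine i<s)) (trans (cong home eq) (home-spine j<s))

  leaf-neighbour : ∀ {u v} → u ≢ spine (home u) → Adjacent u v → v ≡ spine (home u)
  leaf-neighbour leaf a with adj-cases a
  ... | inj₁ (spinal , _)        = contradiction spinal leaf
  ... | inj₂ (_ , inj₁ spinal)   = contradiction spinal leaf
  ... | inj₂ (eq , inj₂ spinal)  = trans spinal (cong spine (sym eq))

module Embeddings {m n t} (T : Comb m t) (G : ColouredGraph n) where
  open Comb T
  open ColouredGraph G

  record Embeds (D : Fin m → Set) (R : Fin n → Set) (φ : Fin m → Fin n) : Set where
    field
      into      : ∀ {u} → D u → R (φ u)
      injective : ∀ {u v} → D u → D v → φ u ≡ φ v → u ≡ v
      hom       : ∀ {u v} → D u → D v → Adjacent u v → E (φ u) (φ v)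
      coloured  : ∀ {u} → D u → colour (φ u) ≡ colourᵀ u
  open Embeds

  restrict : ∀ {D D′ R φ} → (∀ {u} → D′ u → D u) → Embeds D R φ → Embeds D′ R φ
  restrict D′⇒D e = record
    { into = λ d → into e (D′⇒D d) ; injective = λ d d′ → injective e (D′⇒D d) (D′⇒D d′)
    ; hom = λ d d′ → hom e (D′⇒D d) (D′⇒D d′) ; coloured = λ d → coloured e (D′⇒D d) }

  -- As `v` is the only neighbour of `u` in the domain, one edge has to be checked; two-colouring
  -- forces the colour of `r`.
  extend : ∀ {D R φ u v r} → Embeds D R φ →
    ¬ D u → D v → Adjacent u v → (∀ {w} → D w → Adjacent u w → w ≡ v) →
    R r → E (φ v) r → (∀ {w} → D w → φ w ≢ r) → Embeds (λ w → D w ⊎ w ≡ u) R (update _≟_ φ u r)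
  extend {D} {R} {φ} {u} {v} {r} e ¬Du Dv uv unique Rr vr fresh = record
    { into = λ { (inj₁ d) → subst R (sym (old d)) (into e d) ; (inj₂ refl) → subst R (sym new) Rr }
    ; injective = λ
      { (inj₁ d) (inj₁ d′) eq → injective e d d′ (trans (sym (old d)) (trans eq (old d′)))
      ; (inj₁ d) (inj₂ refl) eq → contradiction (trans (sym (old d)) (trans eq new)) (fresh d)
      ; (inj₂ refl) (inj₁ d) eq → contradiction (trans (sym (old d)) (trans (sym eq) new)) (fresh d)
      ; (inj₂ refl) (inj₂ refl) _ → refl }
    ; hom = λ
      { (inj₁ d) (inj₁ d′) a → subst (λ x → E x _) (sym (old d)) (subst (E _) (sym (old d′)) (hom e d d′ a))
      ; (inj₁ d) (inj₂ refl) a → attach d (adj-sym a)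
      ; (inj₂ refl) (inj₁ d) a → E-sym (attach d a)
      ; (inj₂ refl) (inj₂ refl) a → contradiction refl (colourᵀ-≢ a) }
    ; coloured = λ
      { (inj₁ d) → trans (cong colour (old d)) (coloured e d)
      ; (inj₂ refl) → trans (cong colour new) (opposite (colour-≢ vr)
          (λ eq → colourᵀ-≢ uv (trans (sym eq) (coloured e Dv)))) } }
    where
    old : ∀ {w} → D w → update _≟_ φ u r w ≡ φ w
    old d = update-≢ _≟_ φ u r λ { refl → ¬Du d }
    new : update _≟_ φ u r u ≡ r
    new = update-≡ _≟_ φ u r
    attach : ∀ {w} → D w → Adjacent u w → E (update _≟_ φ u r w) (update _≟_ φ u r u)
    attach {w} d a = subst (λ x → E x (update _≟_ φ u r u)) (sym (old d)) (subst (E (φ w)) (sym new)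
      (subst (λ x → E (φ x) r) (sym (unique d a)) vr))

  -- The t neighbours of φ v cannot all be used: together with u their preimages would overfill the class of u.
  fresh-neighbour : ∀ {D R φ u v} → Embeds D R φ → (∀ {w} → D w → Node w) → Node u → ¬ D u → D v →
    Adjacent u v → AtLeast t (λ r → E (φ v) r × R r) →
    (∀ r → E (φ v) r → R r → (∀ {w} → D w → φ w ≢ r) → ⊥) → ⊥
  fresh-neighbour {D} {R} {φ} {u} {v} e D⊆Node u-node ¬Du Dv uv many none =
    comprehension D λ p sound complete →
      let preimage : ∀ r → E (φ v) r × R r → ∃[ w ] w ∈ p × φ w ≡ r
          preimage r (vr , Rr) = case any? (λ w → w ∈? p ×-dec φ w ≟ r) of λ
            { (yes found)  → found
            ; (no missing) → ⊥-elim (none r vr Rr λ Dw eq → missing (_ , complete Dw , eq)) }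
      in class-≤ (colourᵀ u) (AtLeast-add t u (u-node , refl) (λ q → q)
           (AtLeast-map t (λ r q → proj₁ (preimage r q))
             (λ r q → let (w , w∈p , eq) = preimage r q in
               (D⊆Node (sound w∈p) ,
                opposite (λ c → colour-≢ (proj₁ q) (trans (coloured e Dv)
                           (trans c (trans (sym (coloured e (sound w∈p))) (cong colour eq)))))
                         (λ c → colourᵀ-≢ uv (sym c))) ,
               λ eq′ → ¬Du (subst D eq′ (sound w∈p)))
             (λ r r′ q q′ eq → trans (sym (proj₂ (proj₂ (preimage r q))))
                                 (trans (cong φ eq) (proj₂ (proj₂ (preimage r′ q′)))))
             many))

  module _ {D₀ : Fin m → Set} {R φ₀} (e₀ : Embeds D₀ R φ₀) (D₀⊆Node : ∀ {u} → D₀ u → Node u)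
    (spine⊆D₀ : ∀ {i} → i < s → D₀ (spine i))
    (room : ∀ {u} → Node u → ¬ D₀ u → AtLeast t (λ r → E (φ₀ (spine (home u))) r × R r)) where

    -- A leaf is adjacent only to its spine vertex, which is already placed. Agreement with `φ₀` on
    -- `D₀` is carried along because `room` speaks of images under `φ₀`.
    add-leaves : ∀ us → (∀ φ → Embeds (λ w → D₀ w ⊎ (w ∈ˡ us × Node w)) R φ → (∀ {w} → D₀ w → φ w ≡ φ₀ w) → ⊥) → ⊥
    add-leaves [] done = done φ₀ (restrict (λ { (inj₁ d) → d }) e₀) (λ _ → refl)
    add-leaves (u ∷ us) done = add-leaves us step
      where
      step : ∀ φ → Embeds (λ w → D₀ w ⊎ (w ∈ˡ us × Node w)) R φ → (∀ {w} → D₀ w → φ w ≡ φ₀ w) → ⊥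
      step φ e agree with Node? u
      ... | no ¬node = done φ (restrict (λ
        { (inj₁ d) → inj₁ d ; (inj₂ (here refl , node)) → contradiction node ¬node
        ; (inj₂ (there w∈ , node)) → inj₂ (w∈ , node) }) e) agree
      ... | yes node = new old
        where
        -- `D₀` need not be decidable. If `u` is already placed, nothing is to be done, and this
        -- refutation of that case is what placing it uses.
        old : ¬ (D₀ u ⊎ (u ∈ˡ us × Node u))
        old d = done φ (restrict (λ
          { (inj₁ d) → inj₁ d ; (inj₂ (here refl , _)) → d
          ; (inj₂ (there w∈ , node)) → inj₂ (w∈ , node) }) e) agree
        new : ¬ (D₀ u ⊎ (u ∈ˡ us × Node u)) → ⊥
        new ¬Du = fresh-neighbour e (λ { (inj₁ d) → D₀⊆Node d ; (inj₂ (_ , node)) → node }) node ¬Du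
          (inj₁ parent) (leaf-adj node leaf)
          (subst (λ x → AtLeast t (λ r → E x r × R r)) (sym (agree parent)) (room node (¬Du ∘ inj₁)))
          λ r vr Rr fresh → done (update _≟_ φ u r)
            (restrict (λ { (inj₁ d) → inj₁ (inj₁ d) ; (inj₂ (here eq , _)) → inj₂ eq
                         ; (inj₂ (there w∈ , node)) → inj₁ (inj₂ (w∈ , node)) })
              (extend e ¬Du (inj₁ parent) (leaf-adj node leaf) (λ _ → leaf-neighbour leaf) Rr vr fresh))
            λ {w} d → trans (update-≢ _≟_ φ u r λ { refl → ¬Du (inj₁ d) }) (agree d)
          where
          parent : D₀ (spine (home u))
          parent = spine⊆D₀ (home<s node)
          leaf : u ≢ spine (home u)
          leaf eq = ¬Du (inj₁ (subst D₀ (sym eq) parent))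

    complete-leaves : (∀ φ → Embeds Node R φ → ⊥) → ⊥
    complete-leaves done = add-leaves (allFin m) λ φ e _ → done φ (restrict (λ node → inj₂ (∈-allFin _ , node)) e)

  module Greedy {R : Fin n → Set} (rich : ∀ {r} → R r → AtLeast t (λ r′ → E r r′ × R r′)) where

    Prefix : ℕ → Fin m → Set
    Prefix i w = ∃[ j ] j ≤ i × w ≡ spine j

    embed-spine : ∀ i → i < s → ∀ {r₀} → R r₀ → colour r₀ ≡ colourᵀ (spine 0) →
      (∀ φ → Embeds (Prefix i) R φ → ⊥) → ⊥
    embed-spine zero _ {r₀} R₀ c₀ done = done (λ _ → r₀) record
      { into = λ _ → R₀
      ; injective = λ { (_ , z≤n , refl) (_ , z≤n , refl) _ → refl }
      ; hom = λ { (_ , z≤n , refl) (_ , z≤n , refl) a → contradiction refl (colourᵀ-≢ a) }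
      ; coloured = λ { (_ , z≤n , refl) → c₀ } }
    embed-spine (suc i) i<s R₀ c₀ done = embed-spine i i′<s R₀ c₀ λ φ e →
      fresh-neighbour e (λ { (j , j≤i , refl) → spine-node (ℕ.≤-<-trans j≤i i′<s) }) (spine-node i<s) new
        (i , ℕ.≤-refl , refl) (adj-sym (spine-adj i<s)) (rich (into e (i , ℕ.≤-refl , refl)))
        λ r vr Rr fresh → done (update _≟_ φ (spine (suc i)) r) (restrict split
          (extend e new (i , ℕ.≤-refl , refl) (adj-sym (spine-adj i<s)) last Rr vr fresh))
      where
      i′<s : i < s
      i′<s = ℕ.<-trans (ℕ.n<1+n i) i<s
      new : ¬ Prefix i (spine (suc i))
      new (j , j≤i , eq) = ℕ.<⇒≢ (s≤s j≤i) (sym (spine-injective i<s (ℕ.≤-<-trans j≤i i′<s) eq))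
      last : ∀ {w} → Prefix i w → Adjacent (spine (suc i)) w → w ≡ spine i
      last (j , j≤i , refl) a with adj-cases a
      ... | inj₁ (_ , _ , inj₁ eq) = contradiction
        (trans (sym (home-spine (ℕ.≤-<-trans j≤i i′<s))) (trans eq (cong suc (home-spine i<s))))
        (ℕ.<⇒≢ (ℕ.m≤n⇒m≤1+n (s≤s j≤i)))
      ... | inj₁ (_ , _ , inj₂ eq) = cong spine (sym (ℕ.suc-injective
        (trans (sym (home-spine i<s)) (trans eq (cong suc (home-spine (ℕ.≤-<-trans j≤i i′<s)))))))
      ... | inj₂ (eq , _) = contradiction
        (trans (sym (home-spine (ℕ.≤-<-trans j≤i i′<s))) (trans (sym eq) (home-spine i<s))) (ℕ.<⇒≢ (s≤s j≤i))
      split : ∀ {w} → Prefix (suc i) w → Prefix i w ⊎ w ≡ spine (suc i)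
      split (j , j≤ , eq) with ℕ.m≤n⇒m<n∨m≡n j≤
      ... | inj₁ j<   = inj₁ (j , ℕ.≤-pred j< , eq)
      ... | inj₂ refl = inj₂ eq

    embed : ∀ {k} → s ≡ suc k → ∀ {r₀} → R r₀ → colour r₀ ≡ colourᵀ (spine 0) → (∀ φ → Embeds Node R φ → ⊥) → ⊥
    embed {k} refl R₀ c₀ done = embed-spine k ℕ.≤-refl R₀ c₀ λ φ e →
      complete-leaves e (λ { (j , j≤k , refl) → spine-node (s≤s j≤k) })
        (λ {i} i<s → i , ℕ.≤-pred i<s , refl)
        (λ {u} node _ → rich (into e (home u , ℕ.≤-pred (home<s node) , refl))) done

-- Rerouting a copy around one of its vertices.

-- Rerouting a copy φ of the comb T around one of its vertices φ u₀, through a set D off the copy in which every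
-- vertex keeps t neighbours. A stretch of the spine that contains the position c of u₀ is replaced by a path in D.
-- If such a path w₁ … w in D can be neither extended nor joined to the old spine on the right, then every
-- neighbour of w in D accounts for an old vertex that is not adjacent to w, which leaves fewer than t neighbours.
module Reroute {m n t} (T : Comb m t) (G : ColouredGraph n) {R₀ : Fin n → Set} {φ : Fin m → Fin n}
  (φ-embeds : Embeddings.Embeds T G (Comb.Node T) R₀ φ) {u₀ : Fin m} (u₀-node : Comb.Node T u₀)
  (D : Fin n → Set) (D-new : ∀ {r u} → D r → Comb.Node T u → r ≢ φ u) where

  open Comb T
  open ColouredGraph G
  open Embeddings T G
  open Embeds

  Image : Fin n → Set
  Image r = ∃[ u ] Node u × φ u ≡ r

  New : Fin n → Set
  New r = (D r ⊎ Image r) × r ≢ φ u₀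

  D⊆New : ∀ {r} → D r → New r
  D⊆New Dr = inj₁ Dr , D-new Dr u₀-node

  module _ (rich : ∀ {w} → D w → AtLeast t (λ r → E w r × New r))
           (done : ∀ ψ → Embeds Node New ψ → ⊥) where

    c : ℕ
    c = home u₀

    c<s : c < s
    c<s = home<s u₀-node

    q : ℕ → Fin n
    q i = φ (spine i)

    Compatible : Fin n → ℕ → Set
    Compatible w i = colour w ≡ colourᵀ (spine i)

    -- Vacuous at position 0, as `Rightᶜ` is at the last position: a path that begins or ends there
    -- needs no link to the old spine.
    Leftᶜ : Fin n → ℕ → Set
    Leftᶜ w i = ∀ {j} → suc j ≡ i → E w (q j)

    Rightᶜ : Fin n → ℕ → Set
    Rightᶜ w i = suc i < s → E w (q (suc i))

    -- The leaf `u₀` alone is moved to `r`.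
    swap-leaf : ∀ {r} → u₀ ≢ spine c → D r → E (q c) r → ⊥
    swap-leaf {r} leaf Dr e = done (update _≟_ φ u₀ r) (restrict split
      (extend without (λ (_ , u₀≢u₀) → u₀≢u₀ refl) (spine-node c<s , leaf ∘ sym) (leaf-adj u₀-node leaf)
        (λ _ → leaf-neighbour leaf) (D⊆New Dr) e (λ (node , _) eq → D-new Dr node (sym eq))))
      where
      without : Embeds (λ w → Node w × w ≢ u₀) New φ
      without = record
        { into = λ (node , w≢u₀) → inj₂ (_ , node , refl) , λ eq → w≢u₀ (injective φ-embeds node u₀-node eq)
        ; injective = λ (p , _) (p′ , _) → injective φ-embeds p p′
        ; hom = λ (p , _) (p′ , _) → hom φ-embeds p p′
        ; coloured = λ (p , _) → coloured φ-embeds p }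
      split : ∀ {w} → Node w → (Node w × w ≢ u₀) ⊎ w ≡ u₀
      split {w} node with w ≟ u₀
      ... | yes eq = inj₂ eq
      ... | no w≢  = inj₁ (node , w≢)

    In : ℕ → ℕ → ℕ → Set
    In a b i = a ≤ i × i ≤ b

    in? : ∀ a b i → Dec (In a b i)
    in? a b i = a ℕ.≤? i ×-dec i ℕ.≤? b

    -- Only the left end is tied to the old spine; the right end stays free so that the path can
    -- grow.
    record Path (a b : ℕ) : Set where
      field
        a≤b         : a ≤ b
        b<s         : b < s
        vertex      : ℕ → Fin n
        vertex∈D    : ∀ {i} → In a b i → D (vertex i)
        distinct    : ∀ {i j} → In a b i → In a b j → vertex i ≡ vertex j → i ≡ j
        consecutive : ∀ {i} → a ≤ i → suc i ≤ b → E (vertex i) (vertex (suc i))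
        compatible  : ∀ {i} → In a b i → Compatible (vertex i) i
        left        : Leftᶜ (vertex a) a

    module Replace {a b} (path : Path a b) (a≤c : a ≤ c) (c≤b : c ≤ b) (right : Rightᶜ (Path.vertex path b) b) where
      open Path path

      φ₀ : Fin m → Fin n
      φ₀ u with in? a b (home u)
      ... | yes _ = vertex (home u)
      ... | no _  = φ u

      -- Leaves of the replaced stretch are dropped and later attached afresh by `complete-leaves`.
      -- As the stretch contains the home of `u₀`, the vertex `φ u₀` is released whether `u₀` is a
      -- leaf or on the spine.
      Kept : Fin m → Set
      Kept u = Node u × (u ≡ spine (home u) ⊎ ¬ In a b (home u))

      data View (u : Fin m) : Set where
        replaced : u ≡ spine (home u) → In a b (home u) → φ₀ u ≡ vertex (home u) → View u
        old      : ¬ In a b (home u) → φ₀ u ≡ φ u → View u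

      view : ∀ {u} → Kept u → View u
      view {u} kept with in? a b (home u) in eq
      view {u} (_ , inj₁ spinal) | yes within  = replaced spinal within (helper eq)
        where helper : in? a b (home u) ≡ yes within → φ₀ u ≡ vertex (home u)
              helper eq′ rewrite eq′ = refl
      view {u} (_ , inj₂ out) | yes within = contradiction within out
      view {u} kept | no out = old out (helper eq)
        where helper : in? a b (home u) ≡ no out → φ₀ u ≡ φ u
              helper eq′ rewrite eq′ = refl

      same-spinal : ∀ {u v} → u ≡ spine (home u) → v ≡ spine (home v) → home u ≡ home v → u ≡ v
      same-spinal su sv eq = trans su (trans (cong spine eq) (sym sv))

      boundary : ∀ {u v} → Node u → Node v → u ≡ spine (home u) → In a b (home u) → ¬ In a b (home v) →
        Adjacent u v → E (vertex (home u)) (φ v)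
      boundary {u} {v} u-node v-node su (a≤ , ≤b) out adj with adj-cases adj
      ... | inj₁ (_ , sv , inj₁ eq) = subst (λ x → E (vertex (home u)) (φ x)) (sym (trans sv (cong spine eq)))
        (subst (λ i → E (vertex i) (q (suc i))) b≡ (right (subst (λ i → suc i < s) (sym b≡) (subst (_< s) eq (home<s v-node)))))
        where
        b≡ : b ≡ home u
        b≡ with ℕ.m≤n⇒m<n∨m≡n ≤b
        ... | inj₂ eq′ = sym eq′
        ... | inj₁ u<b = contradiction (subst (In a b) (sym eq) (ℕ.m≤n⇒m≤1+n a≤ , u<b)) out
      ... | inj₁ (_ , sv , inj₂ eq) = subst₂ E (cong vertex a≡) (cong φ (sym sv)) (left (trans (sym eq) (sym a≡)))
        where
        a≡ : a ≡ home u
        a≡ with ℕ.m≤n⇒m<n∨m≡n a≤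
        ... | inj₂ eq′ = eq′
        ... | inj₁ a<u = contradiction (ℕ.≤-pred (subst (a <_) eq a<u) ,
                           ℕ.≤-trans (ℕ.n≤1+n _) (subst (_≤ b) eq ≤b)) out
      ... | inj₂ (eq , _) = contradiction (subst (In a b) eq (a≤ , ≤b)) out

      interior-edge : ∀ {u v} → u ≡ spine (home u) → v ≡ spine (home v) → In a b (home u) → In a b (home v) →
        Adjacent u v → E (vertex (home u)) (vertex (home v))
      interior-edge {u} {v} su sv (a≤u , u≤b) (a≤v , v≤b) adj with adj-cases adj
      ... | inj₁ (_ , _ , inj₁ eq) = subst (λ i → E (vertex (home u)) (vertex i)) (sym eq)
                                       (consecutive a≤u (subst (_≤ b) eq v≤b))
      ... | inj₁ (_ , _ , inj₂ eq) = subst (λ i → E (vertex i) (vertex (home v))) (sym eq)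
                                       (E-sym (consecutive a≤v (subst (_≤ b) eq u≤b)))
      ... | inj₂ (eq , _) = contradiction (cong colourᵀ (same-spinal su sv eq)) (colourᵀ-≢ adj)

      φ₀-embeds : Embeds Kept New φ₀
      φ₀-embeds = record
        { into = λ k → case view k of λ
          { (replaced _ within eq) → subst New (sym eq) (D⊆New (vertex∈D within))
          ; (old out eq) → subst New (sym eq) (inj₂ (_ , proj₁ k , refl) ,
              λ eq′ → out (subst (In a b ∘ home) (sym (injective φ-embeds (proj₁ k) u₀-node eq′)) (a≤c , c≤b))) }
        ; injective = inj
        ; hom = homo
        ; coloured = λ k → case view k of λ
          { (replaced spinal within eq) → trans (cong colour eq) (trans (compatible within) (cong colourᵀ (sym spinal)))
          ; (old out eq) → trans (cong colour eq) (coloured φ-embeds (proj₁ k)) } }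
        where
        inj : ∀ {u v} → Kept u → Kept v → φ₀ u ≡ φ₀ v → u ≡ v
        inj k k′ eq with view k | view k′
        ... | replaced su i e | replaced sv j e′ = same-spinal su sv (distinct i j (trans (sym e) (trans eq e′)))
        ... | replaced _ i e  | old _ e′ = contradiction (trans (sym e) (trans eq e′)) (D-new (vertex∈D i) (proj₁ k′))
        ... | old _ e         | replaced _ j e′ =
          contradiction (trans (sym e′) (trans (sym eq) e)) (D-new (vertex∈D j) (proj₁ k))
        ... | old _ e         | old _ e′ = injective φ-embeds (proj₁ k) (proj₁ k′) (trans (sym e) (trans eq e′))
        homo : ∀ {u v} → Kept u → Kept v → Adjacent u v → E (φ₀ u) (φ₀ v)
        homo k k′ adj with view k | view k′
        ... | replaced su i e | replaced sv j e′ = subst₂ E (sym e) (sym e′) (interior-edge su sv i j adj)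
        ... | replaced su i e | old out e′ = subst₂ E (sym e) (sym e′) (boundary (proj₁ k) (proj₁ k′) su i out adj)
        ... | old out e | replaced sv j e′ =
          subst₂ E (sym e) (sym e′) (E-sym (boundary (proj₁ k′) (proj₁ k) sv j out (adj-sym adj)))
        ... | old _ e | old _ e′ = subst₂ E (sym e) (sym e′) (hom φ-embeds (proj₁ k) (proj₁ k′) adj)

      spine-kept : ∀ {i} → i < s → Kept (spine i)
      spine-kept i<s = spine-node i<s , inj₁ (cong spine (sym (home-spine i<s)))

      replace : ⊥
      replace = complete-leaves φ₀-embeds proj₁ spine-kept room done
        where
        room : ∀ {u} → Node u → ¬ Kept u → AtLeast t (λ r → E (φ₀ (spine (home u))) r × New r)
        room {u} node ¬kept with view (spine-kept (home<s node))
        ... | replaced _ i e = subst (λ x → AtLeast t (λ r → E x r × New r)) (sym e) (rich (vertex∈D i))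
        ... | old out _ = ⊥-elim (¬kept (node , inj₂ (out ∘ subst (In a b) (sym (home-spine (home<s node))))))

    replace-by-path : ∀ {a b} (path : Path a b) → a ≤ c → c ≤ b → Rightᶜ (Path.vertex path b) b → ⊥
    replace-by-path = Replace.replace

    single : ∀ {w i} → i < s → D w → Compatible w i → Leftᶜ w i → Path i i
    single {w} i<s Dw comp left = record
      { a≤b = ℕ.≤-refl ; b<s = i<s ; vertex = λ _ → w ; vertex∈D = λ _ → Dw
      ; distinct = λ (i≤j , j≤i) (i≤k , k≤i) _ → trans (ℕ.≤-antisym j≤i i≤j) (ℕ.≤-antisym i≤k k≤i)
      ; consecutive = λ i≤j j<i → contradiction (ℕ.<-≤-trans j<i i≤j) (ℕ.<-irrefl refl)
      ; compatible = λ (i≤j , j≤i) → subst (Compatible w) (ℕ.≤-antisym i≤j j≤i) comp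
      ; left = left }

    replace-by-vertex : ∀ {w} → D w → Compatible w c → Leftᶜ w c → Rightᶜ w c → ⊥
    replace-by-vertex Dw comp left right = replace-by-path (single c<s Dw comp left) ℕ.≤-refl ℕ.≤-refl right

    compatible-next : ∀ {v w i} → Compatible v i → suc i < s → E v w → Compatible w (suc i)
    compatible-next comp i<s e = opposite (colour-≢ e) λ eq → colourᵀ-≢ (spine-adj i<s) (trans (sym comp) eq)

    append : ∀ {a b w} (path : Path a b) → suc b < s → D w → E (Path.vertex path b) w →
      (∀ {i} → In a b i → Path.vertex path i ≢ w) → Σ (Path a (suc b)) λ path′ → Path.vertex path′ (suc b) ≡ w
    append {a} {b} {w} path b<s Dw e fresh = record
      { a≤b = ℕ.m≤n⇒m≤1+n a≤b ; b<s = b<s ; vertex = vertex′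
      ; vertex∈D = λ i → case split i of λ
          { (inj₁ i′) → subst D (sym (same i′)) (vertex∈D i′) ; (inj₂ refl) → subst D (sym last) Dw }
      ; distinct = λ i j eq → distinct′ (split i) (split j) eq
      ; consecutive = consecutive′
      ; compatible = λ i → case split i of λ
          { (inj₁ i′) → trans (cong colour (same i′)) (compatible i′)
          ; (inj₂ refl) → trans (cong colour last) (compatible-next (compatible (a≤b , ℕ.≤-refl)) b<s e) }
      ; left = λ eq → subst (λ x → E x _) (sym (same (ℕ.≤-refl , a≤b))) (left eq) } , last
      where
      open Path path using (a≤b; vertex; vertex∈D; distinct; consecutive; compatible; left)
      vertex′ : ℕ → Fin n
      vertex′ = update ℕ._≟_ vertex (suc b) w
      last : vertex′ (suc b) ≡ w
      last = update-≡ ℕ._≟_ vertex (suc b) w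
      same : ∀ {i} → In a b i → vertex′ i ≡ vertex i
      same (_ , i≤b) = update-≢ ℕ._≟_ vertex (suc b) w (ℕ.<⇒≢ (s≤s i≤b))
      split : ∀ {i} → In a (suc b) i → In a b i ⊎ i ≡ suc b
      split (a≤i , i≤) with ℕ.m≤n⇒m<n∨m≡n i≤
      ... | inj₁ i<   = inj₁ (a≤i , ℕ.≤-pred i<)
      ... | inj₂ refl = inj₂ refl
      distinct′ : ∀ {i j} → In a b i ⊎ i ≡ suc b → In a b j ⊎ j ≡ suc b → vertex′ i ≡ vertex′ j → i ≡ j
      distinct′ (inj₁ i) (inj₁ j) eq       = distinct i j (trans (sym (same i)) (trans eq (same j)))
      distinct′ (inj₁ i) (inj₂ refl) eq    = contradiction (trans (sym (same i)) (trans eq last)) (fresh i)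
      distinct′ (inj₂ refl) (inj₁ j) eq    = contradiction (trans (sym (same j)) (trans (sym eq) last)) (fresh j)
      distinct′ (inj₂ refl) (inj₂ refl) eq = refl
      consecutive′ : ∀ {i} → a ≤ i → suc i ≤ suc b → E (vertex′ i) (vertex′ (suc i))
      consecutive′ {i} a≤i (s≤s i≤b) with ℕ.m≤n⇒m<n∨m≡n i≤b
      ... | inj₂ refl = subst₂ E (sym (same (a≤i , i≤b))) (sym last) e
      ... | inj₁ i<b  = subst₂ E (sym (same (a≤i , i≤b))) (sym (same (ℕ.m≤n⇒m≤1+n a≤i , i<b))) (consecutive a≤i i<b)

    take : ∀ {a b j} → Path a b → a ≤ j → j ≤ b → Path a j
    take path a≤j j≤b = record
      { a≤b = a≤j ; b<s = ℕ.≤-<-trans j≤b b<s ; vertex = vertex ; vertex∈D = vertex∈D ∘ widen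
      ; distinct = λ i i′ → distinct (widen i) (widen i′)
      ; consecutive = λ a≤i i<j → consecutive a≤i (ℕ.≤-trans i<j j≤b)
      ; compatible = compatible ∘ widen ; left = left }
      where
      open Path path using (b<s; vertex; vertex∈D; distinct; consecutive; compatible; left)
      widen : ∀ {i} → In _ _ i → In _ _ i
      widen (a≤i , i≤j) = a≤i , ℕ.≤-trans i≤j j≤b

    -- The old vertices charged for the neighbours of w in D: a neighbour at position j of the path is charged to
    -- the spine vertex at position j to the left of c, and to the one at position j + 2 otherwise.
    Charged : Fin n → Fin m → Set
    Charged w v = ∃[ j ] ((suc j < c × v ≡ spine j) ⊎
      (c ≤ suc j × suc (suc j) < s × v ≡ spine (suc (suc j)) × (Compatible w c → Leftᶜ w c → c ≤ j)))

    record Charging (w : Fin n) : Set where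
      field
        charge         : ∀ r → D r → E w r → Fin m
        charge-node    : ∀ {r} (Dr : D r) (e : E w r) → Node (charge r Dr e)
        charge-colour  : ∀ {r} (Dr : D r) (e : E w r) → colourᵀ (charge r Dr e) ≢ colour w
        charge-missed  : ∀ {r} (Dr : D r) (e : E w r) → ¬ E w (φ (charge r Dr e))
        charge-charged : ∀ {r} (Dr : D r) (e : E w r) → Charged w (charge r Dr e)
        charge-inj     : ∀ {r r′} (Dr : D r) (e : E w r) (Dr′ : D r′) (e′ : E w r′) →
                         charge r Dr e ≡ charge r′ Dr′ e′ → r ≡ r′

    -- The `t` neighbours of `w` in `New` yield `t` nodes of one class: an old neighbour its
    -- preimage, a neighbour in `D` its charge. A charge is never such a preimage, because `w`
    -- misses it. The spare node `e`, missed by `w` or released, is one too many.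
    overfull : ∀ {w} → D w → Charging w → ∀ e → Node e → colourᵀ e ≢ colour w →
      ¬ E w (φ e) ⊎ e ≡ u₀ → (∀ {v} → Charged w v → v ≢ e) → ⊥
    overfull {w} Dw charging e e-node e-colour e-spare uncharged = class-≤ (colourᵀ e)
      (AtLeast-add t e (e-node , refl) (λ p → p) (AtLeast-map t old into′ inj (rich Dw)))
      where
      open Charging charging
      old : ∀ r → E w r × New r → Fin m
      old r (wr , inj₁ Dr , _)       = charge r Dr wr
      old r (wr , inj₂ (u , _) , _) = u
      opposite-w : ∀ {u r} → E w r → Node u → φ u ≡ r → colourᵀ u ≢ colour w
      opposite-w wr node refl eq = colour-≢ wr (trans (sym eq) (sym (coloured φ-embeds node)))
      into′ : ∀ r p → (Node (old r p) × colourᵀ (old r p) ≡ colourᵀ e) × old r p ≢ e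
      into′ r (wr , inj₁ Dr , _) = (charge-node Dr wr ,
        opposite (charge-colour Dr wr ∘ sym) (e-colour ∘ sym)) , uncharged (charge-charged Dr wr)
      into′ r (wr , inj₂ (u , node , eq) , r≢z) = (node ,
        opposite (opposite-w wr node eq ∘ sym) (e-colour ∘ sym)) , λ
          { refl → [ (λ ¬we → ¬we (subst (E w) (sym eq) wr)) , (λ { refl → r≢z (sym eq) }) ]′ e-spare }
      inj : ∀ r r′ p p′ → old r p ≡ old r′ p′ → r ≡ r′
      inj r r′ (wr , inj₁ Dr , _) (wr′ , inj₁ Dr′ , _) eq = charge-inj Dr wr Dr′ wr′ eq
      inj r r′ (wr , inj₁ Dr , _) (wr′ , inj₂ (u , _ , eq′) , _) eq =
        contradiction (subst (E w) (trans (sym eq′) (cong φ (sym eq))) wr′) (charge-missed Dr wr)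
      inj r r′ (wr , inj₂ (u , _ , eq′) , _) (wr′ , inj₁ Dr′ , _) eq =
        contradiction (subst (E w) (trans (sym eq′) (cong φ eq)) wr) (charge-missed Dr′ wr′)
      inj r r′ (_ , inj₂ (u , _ , eq) , _) (_ , inj₂ (u′ , _ , eq′) , _) refl = trans (sym eq) eq′

    charged-≢ : ∀ {w i} → i < s → (∀ {j} → suc j < c → i ≢ j) →
      (∀ {j} → c ≤ suc j → (Compatible w c → Leftᶜ w c → c ≤ j) → i ≢ suc (suc j)) →
      ∀ {v} → Charged w v → v ≢ spine i
    charged-≢ i<s left right (j , inj₁ (j<c , refl)) eq =
      left j<c (spine-injective i<s (ℕ.<-trans (ℕ.<-trans (ℕ.n<1+n j) j<c) c<s) (sym eq))
    charged-≢ i<s left right (j , inj₂ (c≤j , j<s , refl , late)) eq =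
      right c≤j late (spine-injective i<s j<s (sym eq))

    charged-≢-c : ∀ {w v} → Charged w v → v ≢ spine c
    charged-≢-c = charged-≢ c<s
      (λ j<c c≡j → ℕ.<⇒≱ j<c (ℕ.≤-trans (ℕ.≤-reflexive c≡j) (ℕ.n≤1+n _)))
      (λ c≤j _ c≡j → ℕ.<⇒≱ (s≤s c≤j) (ℕ.≤-reflexive (sym c≡j)))

    -- A spare node always exists. If `w` does not have the colour of `spine c`, it is `spine c`; if
    -- it does and `u₀` is a leaf, it is `u₀`. Otherwise `w` would fit into position `c` unless it
    -- misses a spine neighbour of that position, and this neighbour is the spare.
    stuck : ∀ {w} → D w → Charging w → (u₀ ≢ spine c → ∀ {r} → D r → ¬ E (q c) r) → ⊥
    stuck {w} Dw charging no-leaf = go (u₀ ≟ spine c) (colour w Bool.≟ colourᵀ (spine c))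
      where
      beside-right : Compatible w c → Leftᶜ w c → suc c < s → ¬ E w (q (suc c)) → ⊥
      beside-right comp left c+1<s ¬e = overfull Dw charging (spine (suc c)) (spine-node c+1<s)
        (λ eq → colourᵀ-≢ (spine-adj c+1<s) (trans (sym comp) (sym eq))) (inj₁ ¬e)
        (charged-≢ c+1<s (λ j<c eq → ℕ.<⇒≱ j<c (ℕ.≤-trans (ℕ.n≤1+n c) (ℕ.≤-trans (ℕ.≤-reflexive eq) (ℕ.n≤1+n _))))
          (λ {j} c≤j late eq → ℕ.<⇒≱ (ℕ.≤-reflexive (ℕ.suc-injective (sym eq))) (late comp left)))
      beside-left : Compatible w c → ∀ {i} → suc i ≡ c → ¬ E w (q i) → ⊥
      beside-left comp {i} i+1≡c ¬e = overfull Dw charging (spine i) (spine-node i<s)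
        (λ eq → colourᵀ-≢ (spine-adj i+1<s) (trans eq (trans comp (cong (colourᵀ ∘ spine) (sym i+1≡c))))) (inj₁ ¬e)
        (charged-≢ i<s (λ j<c eq → ℕ.<-irrefl (trans (cong suc (sym eq)) i+1≡c) j<c)
          (λ {j} c≤j _ eq → ℕ.<⇒≱ (s≤s c≤j) (ℕ.≤-trans (ℕ.≤-reflexive (sym eq))
            (ℕ.≤-trans (ℕ.n≤1+n i) (ℕ.≤-reflexive i+1≡c)))))
        where
        i+1<s : suc i < s
        i+1<s = subst (_< s) (sym i+1≡c) c<s
        i<s : i < s
        i<s = ℕ.<-trans (ℕ.n<1+n i) i+1<s
      go : Dec (u₀ ≡ spine c) → Dec (Compatible w c) → ⊥
      go (yes spinal) (no ¬comp) = overfull Dw charging (spine c) (spine-node c<s) (¬comp ∘ sym)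
        (inj₂ (sym spinal)) charged-≢-c
      go (no leaf) (no ¬comp) = overfull Dw charging (spine c) (spine-node c<s) (¬comp ∘ sym)
        (inj₁ (no-leaf leaf Dw ∘ E-sym)) charged-≢-c
      go (no leaf) (yes comp) = overfull Dw charging u₀ u₀-node
        (λ eq → colourᵀ-≢ (leaf-adj u₀-node leaf) (trans eq comp)) (inj₂ refl)
        λ ch eq → leaf (charged-spinal ch eq)
        where
        charged-spinal : ∀ {v} → Charged w v → v ≡ u₀ → u₀ ≡ spine c
        charged-spinal (j , inj₁ (j<c , refl)) refl =
          cong spine (sym (home-spine (ℕ.<-trans (ℕ.<-trans (ℕ.n<1+n j) j<c) c<s)))
        charged-spinal (j , inj₂ (_ , j<s , refl , _)) refl = cong spine (sym (home-spine j<s))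
      go (yes spinal) (yes comp) = ¬left λ {i} eq → decidable-stable (E? w (q i)) (beside-left comp eq)
        where
        ¬left : Leftᶜ w c → ⊥
        ¬left left = replace-by-vertex Dw comp left λ c+1<s →
          decidable-stable (E? w (q (suc c))) (beside-right comp left c+1<s)

    Start : ℕ → Set
    Start l = l ≤ c × ∃[ w ] D w × Compatible w l × Leftᶜ w l

    last-start : ∀ f {l} → c < f + l → Start l → (∀ {a} → Start a → (∀ {l} → a < l → ¬ Start l) → ⊥) → ⊥
    last-start zero    c<l start done′ = ℕ.<⇒≱ c<l (proj₁ start)
    last-start (suc f) {l} c<l start done′ = done′ start λ l<l′ start′ →
      last-start f (ℕ.<-≤-trans c<l (ℕ.≤-trans (ℕ.≤-reflexive (sym (ℕ.+-suc f l))) (ℕ.+-monoʳ-≤ f l<l′))) start′ done′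

    module _ (no-leaf : u₀ ≢ spine c → ∀ {r} → D r → ¬ E (q c) r)
             {a} (a≤c : a ≤ c) (last : ∀ {l} → a < l → ¬ Start l) where

      -- If the end `w` of the path has a neighbour in `D` off the path, the path is extended.
      -- Otherwise all its neighbours in `D` have positions on the path and can be charged.
      grow : ∀ f {b} → s ≤ f + b → Path a b → ⊥
      grow zero    s≤b path = ℕ.<⇒≱ (Path.b<s path) s≤b
      grow (suc f) {b} s≤b path = stuck Dw charging no-leaf
        where
        open Path path
        w = vertex b
        at-b : In a b b
        at-b = a≤b , ℕ.≤-refl
        Dw = vertex∈D at-b

        not-closed : c ≤ b → ¬ Rightᶜ w b
        not-closed c≤b = replace-by-path path a≤c c≤b

        -- At the last position `Rightᶜ` is vacuous, so a path that gets there could already be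
        -- inserted.
        room : suc b < s
        room with suc b ℕ.<? s
        ... | yes b+1<s = b+1<s
        ... | no b+1≮s  = ⊥-elim (not-closed (ℕ.≤-pred (ℕ.≤-trans c<s (ℕ.≮⇒≥ b+1≮s))) λ b+1<s → contradiction b+1<s b+1≮s)

        position : ∀ r → D r → E w r → ∃[ j ] In a b j × vertex j ≡ r
        position r Dr wr with ℕ.anyUpTo? (λ j → in? a b j ×-dec vertex j ≟ r) (suc b)
        ... | yes (j , _ , found) = j , found
        ... | no none = ⊥-elim (grow f (ℕ.≤-trans s≤b (ℕ.≤-reflexive (sym (ℕ.+-suc f b))))
          (proj₁ (append path room Dr wr λ {i} within eq → none (i , s≤s (proj₂ within) , within , eq))))

        module Neighbour {r} (Dr : D r) (wr : E w r) where
          j = proj₁ (position r Dr wr)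
          within : In a b j
          within = proj₁ (proj₂ (position r Dr wr))
          vj≡r : vertex j ≡ r
          vj≡r = proj₂ (proj₂ (position r Dr wr))
          jw : E (vertex j) w
          jw = subst (λ x → E x w) (sym vj≡r) (E-sym wr)
          j<b : j < b
          j<b with ℕ.m≤n⇒m<n∨m≡n (proj₂ within)
          ... | inj₁ lt = lt
          ... | inj₂ eq = contradiction (subst (λ i → E (vertex i) w) eq jw) E-irrefl
          j<s : suc j < s
          j<s = ℕ.≤-<-trans j<b b<s
          comp : Compatible w (suc j)
          comp = compatible-next (compatible within) j<s jw
          -- Otherwise `w` could start a path at position `suc j`, beyond the last start `a`.
          missed-left : suc j < c → ¬ E w (q j)
          missed-left j<c e = last (s≤s (proj₁ within)) (ℕ.<⇒≤ j<c , w , Dw , comp , λ { refl → e })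
          -- Otherwise the path up to `j`, followed by `w`, could replace a stretch that contains
          -- `c`.
          missed-right : c ≤ suc j → ¬ Rightᶜ w (suc j)
          missed-right c≤j right with append (take path (proj₁ within) (proj₂ within)) j<s Dw jw
            (λ {i} (a≤i , i≤j) eq → ℕ.<⇒≢ (ℕ.≤-<-trans i≤j j<b) (distinct (a≤i , ℕ.≤-trans i≤j (proj₂ within)) at-b eq))
          ... | path′ , eq = replace-by-path path′ a≤c c≤j (subst (λ x → Rightᶜ x (suc j)) (sym eq) right)
          next<s : c ≤ suc j → suc (suc j) < s
          next<s c≤j with suc (suc j) ℕ.<? s
          ... | yes lt = lt
          ... | no ≮s  = ⊥-elim (missed-right c≤j λ lt → contradiction lt ≮s)
          -- If `w` could start at `c`, then `a` is at least `c`, and so is `j`. This keeps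
          -- `spine (suc c)` uncharged, hence available as the spare in `beside-right`.
          late : Compatible w c → Leftᶜ w c → c ≤ j
          late comp′ left′ = ℕ.≤-trans (ℕ.≮⇒≥ λ a<c → last a<c (ℕ.≤-refl , w , Dw , comp′ , left′)) (proj₁ within)

        open Neighbour

        charge′ : ∀ j → Dec (suc j < c) → Fin m
        charge′ j (yes _) = spine j
        charge′ j (no _)  = spine (suc (suc j))

        charge-inj′ : ∀ {i j} → i < s → j < s → (¬ suc i < c → suc (suc i) < s) → (¬ suc j < c → suc (suc j) < s) →
          (p : Dec (suc i < c)) (p′ : Dec (suc j < c)) → charge′ i p ≡ charge′ j p′ → i ≡ j
        charge-inj′ i<s j<s _ _ (yes _)   (yes _)   eq = spine-injective i<s j<s eq
        charge-inj′ i<s j<s _ j+ (yes i<c) (no j≮c) eq with spine-injective i<s (j+ j≮c) eq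
        ... | refl = contradiction (ℕ.<-trans (ℕ.<-trans (ℕ.n<1+n _) (ℕ.n<1+n _)) i<c) j≮c
        charge-inj′ i<s j<s i+ _ (no i≮c) (yes j<c) eq with spine-injective (i+ i≮c) j<s eq
        ... | refl = contradiction (ℕ.<-trans (ℕ.<-trans (ℕ.n<1+n _) (ℕ.n<1+n _)) j<c) i≮c
        charge-inj′ i<s j<s i+ j+ (no i≮c) (no j≮c) eq =
          ℕ.suc-injective (ℕ.suc-injective (spine-injective (i+ i≮c) (j+ j≮c) eq))

        before : ∀ {r} (Dr : D r) (wr : E w r) → Dec (suc (j Dr wr) < c)
        before Dr wr = suc (j Dr wr) ℕ.<? c

        charging : Charging w
        charging = record
          { charge = λ r Dr wr → charge′ (j Dr wr) (before Dr wr)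
          ; charge-node = λ Dr wr → spine-node′ Dr wr (before Dr wr)
          ; charge-colour = λ Dr wr → colour′ Dr wr (before Dr wr)
          ; charge-missed = λ Dr wr → missed′ Dr wr (before Dr wr)
          ; charge-charged = λ Dr wr → charged′ Dr wr (before Dr wr)
          ; charge-inj = λ Dr wr Dr′ wr′ eq → trans (sym (vj≡r Dr wr))
              (trans (cong vertex (charge-inj′ (j<s′ Dr wr) (j<s′ Dr′ wr′)
                        (next<s Dr wr ∘ ℕ.≮⇒≥) (next<s Dr′ wr′ ∘ ℕ.≮⇒≥) (before Dr wr) (before Dr′ wr′) eq))
                     (vj≡r Dr′ wr′)) }
          where
          j<s′ : ∀ {r} (Dr : D r) (wr : E w r) → j Dr wr < s
          j<s′ Dr wr = ℕ.<-trans (ℕ.n<1+n _) (j<s Dr wr)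
          spine-node′ : ∀ {r} (Dr : D r) (wr : E w r) p → Node (charge′ (j Dr wr) p)
          spine-node′ Dr wr (yes _)  = spine-node (j<s′ Dr wr)
          spine-node′ Dr wr (no j≮c) = spine-node (next<s Dr wr (ℕ.≮⇒≥ j≮c))
          colour′ : ∀ {r} (Dr : D r) (wr : E w r) p → colourᵀ (charge′ (j Dr wr) p) ≢ colour w
          colour′ Dr wr (yes _) eq = colourᵀ-≢ (spine-adj (j<s Dr wr)) (trans eq (comp Dr wr))
          colour′ Dr wr (no j≮c) eq =
            colourᵀ-≢ (spine-adj (next<s Dr wr (ℕ.≮⇒≥ j≮c))) (trans (sym (comp Dr wr)) (sym eq))
          missed′ : ∀ {r} (Dr : D r) (wr : E w r) p → ¬ E w (φ (charge′ (j Dr wr) p))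
          missed′ Dr wr (yes j<c) e = missed-left Dr wr j<c e
          missed′ Dr wr (no j≮c) e  = missed-right Dr wr (ℕ.≮⇒≥ j≮c) λ _ → e
          charged′ : ∀ {r} (Dr : D r) (wr : E w r) p → Charged w (charge′ (j Dr wr) p)
          charged′ Dr wr (yes j<c) = j Dr wr , inj₁ (j<c , refl)
          charged′ Dr wr (no j≮c)  = j Dr wr ,
            inj₂ (ℕ.≮⇒≥ j≮c , next<s Dr wr (ℕ.≮⇒≥ j≮c) , refl , late Dr wr)

    reroute : ∀ {r} → D r → ⊥
    reroute {r} Dr = isolated start-at-0
      where
      no-leaf : u₀ ≢ spine c → ∀ {r} → D r → ¬ E (q c) r
      no-leaf leaf = swap-leaf leaf
      start-at-0 : ¬ (∃[ w ] D w × Compatible w 0)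
      start-at-0 (w , Dw , comp) = last-start (suc c) {0} (s≤s (ℕ.m≤m+n c 0)) (z≤n , w , Dw , comp , λ ())
        λ { {a} (a≤c , w , Dw , comp , left) last →
            grow no-leaf a≤c last s {a} (ℕ.m≤m+n s a) (single (ℕ.≤-<-trans a≤c c<s) Dw comp left) }
      -- Without a vertex of the colour of `spine 0`, the set `D` is monochromatic and has no edges,
      -- so nothing needs to be charged.
      isolated : ¬ (∃[ w ] D w × Compatible w 0) → ⊥
      isolated none = stuck Dr record
        { charge = λ r′ Dr′ e → ⊥-elim (alone Dr′ e)
        ; charge-node = λ Dr′ e → ⊥-elim (alone Dr′ e) ; charge-colour = λ Dr′ e → ⊥-elim (alone Dr′ e)
        ; charge-missed = λ Dr′ e → ⊥-elim (alone Dr′ e) ; charge-charged = λ Dr′ e → ⊥-elim (alone Dr′ e)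
        ; charge-inj = λ Dr′ e _ _ _ → ⊥-elim (alone Dr′ e) } no-leaf
        where
        alone : ∀ {r′} → D r′ → ¬ E r r′
        alone Dr′ e = colour-≢ e (opposite (λ eq → none (_ , Dr , sym eq)) (λ eq → none (_ , Dr′ , sym eq)))

-- Enlarging the inseparable set by exchanging copies.

∈-singleton : ∀ {A : Set} {b x : A} → b ∈ˡ x ∷ [] → b ≡ x
∈-singleton (here eq) = eq

∈-pair : ∀ {A : Set} {b x y : A} → b ∈ˡ x ∷ y ∷ [] → b ≡ x ⊎ b ≡ y
∈-pair (here eq)         = inj₁ eq
∈-pair (there (here eq)) = inj₂ eq

module Growth {m n t} (T : Comb m t) (G : ColouredGraph n)
  (degree : ColouredGraph.MinDegree G (t + 3)) (3-connected : ColouredGraph.TwoCutsConnect G) where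

  open Comb T
  open ColouredGraph G
  open Embeddings T G
  open Embeds

  Im : (Fin m → Fin n) → Fin n → Set
  Im φ r = ∃[ u ] Node u × φ u ≡ r

  im? : ∀ φ r → Dec (Im φ r)
  im? φ r = any? λ u → Node? u ×-dec φ u ≟ r

  Outside : (Fin m → Fin n) → Fin n → Set
  Outside φ r = Vert r × ¬ Im φ r

  outside? : ∀ φ r → Dec (Outside φ r)
  outside? φ r = Vert? r ×-dec ¬? (im? φ r)

  Copy : (Fin m → Fin n) → Set
  Copy = Embeds Node Vert

  outside-degree : ∀ {φ u} → Copy φ → Vert u → AtLeast 3 (λ v → E u v × Outside φ v)
  outside-degree {φ} {u} copy Vu = AtLeast-mono 3 (λ (e , out) → e , E⇒Vert (E-sym e) , out)
    (AtLeast-outside t 3 (im? φ) few (degree Vu))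
    where
    few : ¬ AtLeast (suc t) (λ v → E u v × Im φ v)
    few pts@(_ , (e₀ , w₀ , node₀ , eq₀) , _) = class-≤ (colourᵀ w₀)
      (AtLeast-map (suc t) (λ _ (_ , w , _) → w)
        (λ _ (e , w , node , eq) → node , opposite (away e node eq) (away e₀ node₀ eq₀))
        (λ { _ _ (_ , w , _ , eq) (_ , _ , _ , eq′) refl → trans (sym eq) eq′ }) pts)
      where
      away : ∀ {v w} → E u v → Node w → φ w ≡ v → colour u ≢ colourᵀ w
      away e node refl c = colour-≢ e (trans c (sym (coloured copy node)))

  record State (B : Subset n) (φ : Fin m → Fin n) : Set where
    field
      copy      : Copy φ
      B⊆Outside : ∀ {u} → u ∈ B → Outside φ u
      separated : Inseparable (Outside φ) B

  Free : Subset n → (Fin m → Fin n) → Fin n → Set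
  Free B φ u = Outside φ u × u ∉ B

  free? : ∀ B φ u → Dec (Free B φ u)
  free? B φ u = outside? φ u ×-dec ¬? (u ∈? B)

  Component : Subset n → (Fin m → Fin n) → Fin n → Fin n → Set
  Component B φ = Linked (Free B φ)

  Attached : Subset n → (Fin m → Fin n) → Fin n → Fin n → Set
  Attached B φ v x = ∃[ c ] Component B φ v c × E c x

  linked-within : ∀ {Q : Fin n → Set} {v w c} → Linked Q v w → Linked Q w c → Linked (Linked Q v) w c
  linked-within p ε                  = ε
  linked-within p (st@(e , q , r) ◅ l) = (e , p , p ◅◅ st ◅ ε) ◅ linked-within (p ◅◅ st ◅ ε) l

  module Around {B φ v} (state : State B φ) (v-free : Free B φ v) where
    open State state
    C : Fin n → Set
    C = Component B φ v
    open Walks G C public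
    open Tripods G C public
    open TripodFacts G C public

    C⊆Free : ∀ {u} → C u → Free B φ u
    C⊆Free = linked-target v-free

    C-step : ∀ {u w} → C u → E u w → Free B φ w → C w
    C-step Cu e w-free = Cu ◅◅ (e , C⊆Free Cu , w-free) ◅ ε

    B∉C : ∀ {x} → x ∈ B → ¬ C x
    B∉C x∈B Cx = proj₂ (C⊆Free Cx) x∈B

    attached-walk : ∀ {x} → Attached B φ v x → ∃[ k ] Walk x k v
    attached-walk (c , l , e) = linked-walk ε (linked-within ε l) e

  module _ {B φ v x y z} (state : State B φ) (v-free : Free B φ v)
    (x∈B : x ∈ B) (y∈B : y ∈ B) (z∈B : z ∈ B) (x≢y : x ≢ y) (y≢z : y ≢ z) (x≢z : x ≢ z)
    (attˣ : Attached B φ v x) (attʸ : Attached B φ v y) (attᶻ : Attached B φ v z)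
    (larger : ∀ {B′} → B ⊂ B′ → State B′ φ → ⊥) where
    open State state
    open Around state v-free

    -- Two deleted vertices other than the centre leave one leg intact, which links the centre to a
    -- member of `B`.
    add-centre : MinTripod x y z → ⊥
    add-centre M = larger (p⊆p∪q ⁅ u ⁆ , u , q⊆p∪q B ⁅ u ⁆ (x∈⁅x⁆ u) , proj₂ u-free) record
      { copy = copy
      ; B⊆Outside = λ w∈B′ → case split w∈B′ of λ { (inj₁ w∈B) → B⊆Outside w∈B ; (inj₂ refl) → proj₁ u-free }
      ; separated = λ σ τ b∈ b′∈ p q p′ q′ → join σ τ (split b∈) (split b′∈) p q p′ q′ }
      where
      open MinTripod M renaming (centre to u)
      B′ : Subset n
      B′ = B ∪ ⁅ u ⁆
      u-free : Free B φ u
      u-free = C⊆Free centre∈C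
      split : ∀ {w} → w ∈ B′ → w ∈ B ⊎ w ≡ u
      split w∈ = case x∈p∪q⁻ B ⁅ u ⁆ w∈ of λ { (inj₁ w∈B) → inj₁ w∈B ; (inj₂ w∈u) → inj₂ (x∈⁅y⁆⇒x≡y u w∈u) }
      along : ∀ {σ τ e k} (ω : Walk e k u) → e ∈ B → Avoids ω σ τ →
        ∃[ e ] e ∈ B × e ≢ σ × e ≢ τ × Linked (Cut (Outside φ) σ τ) u e
      along {e = e} ω e∈B avoids = e , e∈B , proj₁ (avoids (_ , walk-end ω)) , proj₂ (avoids (_ , walk-end ω)) ,
        linked-end ω λ (i , at) → (case end-or-inside at of λ
          { (inj₁ refl) → B⊆Outside e∈B ; (inj₂ Cp) → proj₁ (C⊆Free Cp) }) , avoids (i , at)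
      hop : ∀ σ τ → u ≢ σ → u ≢ τ → ∃[ e ] e ∈ B × e ≢ σ × e ≢ τ × Linked (Cut (Outside φ) σ τ) u e
      hop σ τ u≢σ u≢τ = case free-leg M (B∉C x∈B) (B∉C y∈B) (B∉C z∈B) x≢y y≢z x≢z (u≢σ ∘ sym) (u≢τ ∘ sym) of λ
        { (inj₁ av) → along walkˣ x∈B av ; (inj₂ (inj₁ av)) → along walkʸ y∈B av
        ; (inj₂ (inj₂ av)) → along walkᶻ z∈B av }
      join : ∀ σ τ {b b′} → b ∈ B ⊎ b ≡ u → b′ ∈ B ⊎ b′ ≡ u → b ≢ σ → b ≢ τ → b′ ≢ σ → b′ ≢ τ →
        Linked (Cut (Outside φ) σ τ) b b′
      join σ τ (inj₁ b∈) (inj₁ b′∈) p q p′ q′ = separated σ τ b∈ b′∈ p q p′ q′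
      join σ τ (inj₂ refl) (inj₂ refl) _ _ _ _ = ε
      join σ τ (inj₂ refl) (inj₁ b′∈) p q p′ q′ with hop σ τ p q
      ... | e , e∈B , e≢σ , e≢τ , l = l ◅◅ separated σ τ e∈B b′∈ e≢σ e≢τ p′ q′
      join σ τ (inj₁ b∈) (inj₂ refl) p q p′ q′ with hop σ τ p′ q′
      ... | e , e∈B , e≢σ , e≢τ , l = separated σ τ b∈ e∈B p q e≢σ e≢τ ◅◅ linked-sym l

    enlarge : ⊥
    enlarge = minTripod ε (proj₂ (attached-walk attˣ)) (proj₂ (attached-walk attʸ)) (proj₂ (attached-walk attᶻ)) add-centre

  -- The component C of v meets B only in x and y; the copy is moved off z, which is adjacent to v.
  module Exchange {B φ v x y u₀} (big : Big B) (state : State B φ) (v-free : Free B φ v)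
    (u₀-node : Node u₀) (vz : E v (φ u₀))
    (xs : List (Fin n)) (xs⊆B : ∀ {b} → b ∈ˡ xs → b ∈ B)
    (ends : ∀ {b} → b ∈ˡ xs → b ≡ x ⊎ b ≡ y)
    (closed : ∀ {c b} → Component B φ v c → E c b → b ∈ B → b ∈ˡ xs)
    (next : ∀ {ψ} → State B ψ → Free B ψ (φ u₀) → (∀ {b} → b ∈ˡ xs → Attached B ψ (φ u₀) b) → ⊥)
    where
    open State state
    open Around state v-free

    z : Fin n
    z = φ u₀

    z∈Im : Im φ z
    z∈Im = u₀ , u₀-node , refl

    z∉B : z ∉ B
    z∉B z∈B = proj₂ (B⊆Outside z∈B) z∈Im

    z∉C : ¬ C z
    z∉C Cz = proj₂ (proj₁ (C⊆Free Cz)) z∈Im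

    C? : ∀ u → Dec (C u)
    C? = linked? (free? B φ) v

    outside-nbr : ∀ {c p} → C c → E c p → Outside φ p → C p ⊎ p ≡ x ⊎ p ≡ y
    outside-nbr {p = p} Cc e out with p ∈? B
    ... | yes p∈B = inj₂ (ends (closed Cc e p∈B))
    ... | no p∉B  = inj₁ (C-step Cc e (out , p∉B))

    module _ (M : MinTripod x y z) where
      open MinTripod M

      D : Fin n → Set
      D p = C p × ¬ OnLegs M p

      D-new : ∀ {r u} → D r → Node u → r ≢ φ u
      D-new (Cr , _) node eq = proj₂ (proj₁ (C⊆Free Cr)) (_ , node , sym eq)

      open Reroute T G copy u₀-node D D-new using (New; reroute)

      -- At most three of the `t + 3` neighbours are on the legs, whose ends are `x`, `y` and `z`.
      -- The others are different from `z` and lie in the copy or in `C`, since outside both only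
      -- `x` and `y` are possible.
      rich : ∀ {w} → D w → AtLeast t (λ r → E w r × New r)
      rich {w} (Cw , _) with legs-≤3 M Cw
      ... | ps , ps≤3 , cover = AtLeast-discard t ps sort
        (AtLeast-≤ (ℕ.≤-trans (ℕ.+-monoˡ-≤ t ps≤3) (ℕ.≤-reflexive (ℕ.+-comm 3 t))) (degree (proj₁ (proj₁ (C⊆Free Cw)))))
        where
        sort : ∀ {r} → E w r → r ∈ˡ ps ⊎ (E w r × New r)
        sort {r} e with onLegs? M r
        ... | yes on = inj₁ (cover on e)
        ... | no off with im? φ r
        ... | yes im = inj₂ (e , inj₂ im , λ { refl → off (inj₂ (inj₂ (_ , walk-end walkᶻ))) })
        ... | no ¬im with outside-nbr Cw e (E⇒Vert (E-sym e) , ¬im)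
        ... | inj₁ Cr = inj₂ (e , inj₁ (Cr , off) , D-new (Cr , off) u₀-node)
        ... | inj₂ (inj₁ refl) = contradiction (inj₁ (_ , walk-end walkˣ)) off
        ... | inj₂ (inj₂ refl) = contradiction (inj₂ (inj₁ (_ , walk-end walkʸ))) off

      module Moved {ψ} (ψ-embeds : Embeds Node New ψ) where

        ψ-copy : Copy ψ
        ψ-copy = record
          { into = λ node → case into ψ-embeds node of λ
            { (inj₁ (Cr , _) , _) → proj₁ (proj₁ (C⊆Free Cr))
            ; (inj₂ (w , node′ , eq) , _) → subst Vert eq (into copy node′) }
          ; injective = injective ψ-embeds ; hom = hom ψ-embeds ; coloured = coloured ψ-embeds }

        still-outside : ∀ {p} → Outside φ p → ¬ D p → Outside ψ p
        still-outside (Vp , ¬im) ¬Dp = Vp , λ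
          { (w , node , refl) → [ ¬Dp , ¬im ]′ (proj₁ (into ψ-embeds node)) }

        z-outside : Outside ψ z
        z-outside = into copy u₀-node , λ (w , node , eq) → proj₂ (into ψ-embeds node) eq

        B⊆Outsideψ : ∀ {b} → b ∈ B → Outside ψ b
        B⊆Outsideψ b∈B = still-outside (B⊆Outside b∈B) (B∉C b∈B ∘ proj₁)

        leg-free : ∀ {p} → OnLegs M p → C p → Free B ψ p
        leg-free on Cp = still-outside (proj₁ (C⊆Free Cp)) (λ (_ , off) → off on) , proj₂ (C⊆Free Cp)

        approach : ∀ {τ k u} (ω : Walk τ k u) → ¬ C τ → C u → (∀ {p} → On ω p → OnLegs M p) →
          ∃[ c ] Linked (Free B ψ) u c × E c τ
        approach [] τ∉C Cu legs = contradiction Cu τ∉C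
        approach (step Cu e []) τ∉C _ legs = _ , ε , e
        approach (step Cu e ω@(step Cw _ _)) τ∉C _ legs
          with approach ω τ∉C Cw (λ (i , at) → legs (suc i , there at))
        ... | c , l , e′ = c , (e , leg-free (legs (0 , here)) Cu , leg-free (legs (1 , there here)) Cw) ◅ l , e′

        z-to-centre : Linked (Free B ψ) z centre
        z-to-centre = linked-sym (linked-end walkᶻ λ (i , at) → case end-or-inside at of λ
          { (inj₁ refl) → z-outside , z∉B ; (inj₂ Cp) → leg-free (inj₂ (inj₂ (i , at))) Cp })

        reattach : ∀ {b} → b ∈ˡ xs → Attached B ψ z b
        reattach b∈ with ends b∈
        ... | inj₁ refl with approach walkˣ (B∉C (xs⊆B b∈)) centre∈C inj₁
        ... | c , l , e = c , z-to-centre ◅◅ l , e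
        reattach b∈ | inj₂ refl with approach walkʸ (B∉C (xs⊆B b∈)) centre∈C (inj₂ ∘ inj₁)
        ... | c , l , e = c , z-to-centre ◅◅ l , e

        -- Membership in `B` must be asked for: without attachments in `B`, the ends `x` and `y` are
        -- both taken to be `z`.
        Gate : Fin n → Set
        Gate p = p ∈ B × (p ≡ x ⊎ p ≡ y)

        -- A walk can only enter and leave C through x and y, so a link between these makes C superfluous.
        bypass : ∀ {Q Q′ : Fin n → Set} → (∀ {p} → Q p → Outside φ p) → (∀ {p} → Q p → ¬ C p → Q′ p) →
          (∀ {p p′} → Gate p → Gate p′ → Q p → Q p′ → Linked Q′ p p′) →
          ∀ {a b} → ¬ C b → Linked Q a b →
          (¬ C a → Linked Q′ a b) × (C a → ∀ {p} → Gate p → Q p → Linked Q′ p b)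
        bypass Q⊆ Q⇒Q′ link b∉C ε = (λ _ → ε) , λ Cb → contradiction Cb b∉C
        bypass Q⊆ Q⇒Q′ link b∉C (_◅_ {i = a} {j = a′} (e , Qa , Qa′) l) with bypass Q⊆ Q⇒Q′ link b∉C l | C? a′
        ... | from-out , from-in | yes Ca′ = (λ a∉C → from-in Ca′ (gate a∉C) Qa) , λ _ → from-in Ca′
          where
          gate : ¬ C a → Gate a
          gate a∉C with a ∈? B
          ... | yes a∈B = a∈B , ends (closed Ca′ (E-sym e) a∈B)
          ... | no a∉B  = contradiction (C-step Ca′ (E-sym e) (Q⊆ Qa , a∉B)) a∉C
        ... | from-out , from-in | no a′∉C =
          (λ a∉C → (e , Q⇒Q′ Qa a∉C , Q⇒Q′ Qa′ a′∉C) ◅ from-out a′∉C) ,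
          λ Ca g Qp → link g (gate Ca) Qp Qa′ ◅◅ from-out a′∉C
          where
          gate : C a → Gate a′
          gate Ca with a′ ∈? B
          ... | yes a′∈B = a′∈B , ends (closed Ca e a′∈B)
          ... | no a′∉B  = contradiction (C-step Ca e (Q⊆ Qa′ , a′∉B)) a′∉C

        Used : Fin n → Set
        Used p = C p × OnLegs M p

        used? : ∀ p → Dec (Used p)
        used? p = C? p ×-dec onLegs? M p

        to-centre : ∀ {σ τ p} → ¬ Used σ → ¬ Used τ → Gate p → Cut (Outside φ) σ τ p →
          Linked (Cut (Outside ψ) σ τ) centre p
        to-centre {σ} {τ} {p} ¬σ ¬τ (p∈B , end) (_ , p≢) = case end of λ
          { (inj₁ refl) → linked-end walkˣ λ (i , at) → onto (inj₁ (i , at)) (end-or-inside at)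
          ; (inj₂ refl) → linked-end walkʸ λ (i , at) → onto (inj₂ (inj₁ (i , at))) (end-or-inside at) }
          where
          onto : ∀ {r} → OnLegs M r → r ≡ p ⊎ C r → Cut (Outside ψ) σ τ r
          onto on (inj₁ refl) = B⊆Outsideψ p∈B , p≢
          onto on (inj₂ Cr)   = proj₁ (leg-free on Cr) , (λ { refl → ¬σ (Cr , on) }) , (λ { refl → ¬τ (Cr , on) })

        -- The legs to `x` and `y` are untouched by the cut, so every passage through `C` is
        -- replaced by the way over the centre.
        avoid-legs : ∀ {σ τ b b′} → ¬ Used σ → ¬ Used τ → b ∈ B → b′ ∈ B → b ≢ σ → b ≢ τ → b′ ≢ σ → b′ ≢ τ →
          Linked (Cut (Outside ψ) σ τ) b b′
        avoid-legs {σ} {τ} ¬σ ¬τ b∈ b′∈ p q p′ q′ = proj₁ (bypass proj₁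
          (λ (out , ≢) r∉C → still-outside out (r∉C ∘ proj₁) , ≢)
          (λ g g′ Qp Qp′ → linked-sym (to-centre ¬σ ¬τ g Qp) ◅◅ to-centre ¬σ ¬τ g′ Qp′)
          (B∉C b′∈) (separated σ τ b∈ b′∈ p q p′ q′)) (B∉C b∈)

        -- A cut vertex σ on a leg may be traded for x or y: without one of these, C cannot be passed through.
        trade : ∀ {σ τ ρ b b′} → C σ → (∀ {g g′} → Gate g → Gate g′ → g ≢ ρ → g′ ≢ ρ → g ≡ g′) →
          b ∈ B → b′ ∈ B → b ≢ ρ → b ≢ τ → b′ ≢ ρ → b′ ≢ τ → Linked (Cut (Outside ψ) σ τ) b b′
        trade {σ} {τ} {ρ} Cσ alone b∈ b′∈ p q p′ q′ = proj₁ (bypass {Cut (Outside φ) ρ τ} proj₁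
          (λ (out , _ , ≢τ) r∉C → still-outside out (r∉C ∘ proj₁) , (λ { refl → r∉C Cσ }) , ≢τ)
          (λ g g′ (_ , ≢ρ , _) (_ , ≢ρ′ , _) → subst (Linked _ _) (alone g g′ ≢ρ ≢ρ′) ε)
          (B∉C b′∈) (separated ρ τ b∈ b′∈ p q p′ q′)) (B∉C b∈)

        -- `b` and `b′` may require different trades, for instance if they are `x` and `y`. Both are
        -- therefore linked to a member `h` of `B` that survives either trade.
        on-leg : ∀ {σ τ b b′} → C σ → b ∈ B → b′ ∈ B → b ≢ τ → b′ ≢ τ → Linked (Cut (Outside ψ) σ τ) b b′
        on-leg {σ} {τ} Cσ b∈ b′∈ b≢τ b′≢τ with big x y τ
        ... | h , h∈ , h≢x , h≢y , h≢τ = half b∈ b≢τ ◅◅ linked-sym (half b′∈ b′≢τ)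
          where
          half : ∀ {b} → b ∈ B → b ≢ τ → Linked (Cut (Outside ψ) σ τ) b h
          half {b} b∈ b≢τ with b ≟ x
          ... | no b≢x = trade {ρ = x} Cσ
            (λ { (_ , inj₁ refl) _ g≢ _ → contradiction refl g≢ ; (_ , inj₂ _) (_ , inj₁ refl) _ g′≢ → contradiction refl g′≢
               ; (_ , inj₂ refl) (_ , inj₂ refl) _ _ → refl }) b∈ h∈ b≢x b≢τ h≢x h≢τ
          ... | yes b≡x with b ≟ y
          ... | no b≢y = trade {ρ = y} Cσ
            (λ { (_ , inj₂ refl) _ g≢ _ → contradiction refl g≢ ; (_ , inj₁ _) (_ , inj₂ refl) _ g′≢ → contradiction refl g′≢
               ; (_ , inj₁ refl) (_ , inj₁ refl) _ _ → refl }) b∈ h∈ b≢y b≢τ h≢y h≢τ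
          ... | yes b≡y = trade {ρ = τ} Cσ (λ g g′ _ _ → trans (only g) (sym (only g′))) b∈ h∈ b≢τ b≢τ h≢τ h≢τ
            where
            only : ∀ {g} → Gate g → g ≡ b
            only (_ , inj₁ g≡x) = trans g≡x (sym b≡x)
            only (_ , inj₂ g≡y) = trans g≡y (sym b≡y)

        separated-ψ : Inseparable (Outside ψ) B
        separated-ψ σ τ b∈ b′∈ p q p′ q′ with used? σ | used? τ
        ... | yes (Cσ , _) | _ = on-leg Cσ b∈ b′∈ q q′
        ... | no _ | yes (Cτ , _) = linked-mono (λ (out , ≢τ , ≢σ) → out , ≢σ , ≢τ) (on-leg Cτ b∈ b′∈ p p′)
        ... | no ¬σ | no ¬τ = avoid-legs ¬σ ¬τ b∈ b′∈ p q p′ q′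

        moved : ⊥
        moved = next record { copy = ψ-copy ; B⊆Outside = B⊆Outsideψ ; separated = separated-ψ }
          (z-outside , z∉B) reattach

      exchange-along : ⊥
      exchange-along = off-leg M z∉C
        (λ Cw → AtLeast-mono 3 (λ (e , out) → e , (λ { refl → proj₂ out z∈Im }) , outside-nbr Cw e out)
          (outside-degree copy (proj₁ (proj₁ (C⊆Free Cw)))))
        λ Cw off → reroute rich (λ ψ ψ-embeds → Moved.moved ψ-embeds) (Cw , off)

    exchange : ∀ {j k} → Walk x j v → Walk y k v → ⊥
    exchange ωˣ ωʸ = minTripod ε ωˣ ωʸ (step ε vz []) exchange-along

  module _ {B : Subset n} (big : Big B) where

    -- The number of attachments is treated downwards: for two, maximality of `B` gives the
    -- contradiction through `enlarge`; for fewer, `chase` finds one more attachment and falls back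
    -- on the longer list.
    Extra : List (Fin n) → Set
    Extra xs = ∀ {φ v b} → State B φ → Free B φ v → (∀ {x} → x ∈ˡ xs → Attached B φ v x) →
      b ∈ B → b ∉ˡ xs → Attached B φ v b → ⊥

    -- A tripod has two ends besides `z`; those that `xs` does not supply are repetitions or `z`
    -- itself.
    record Ends (xs : List (Fin n)) (z : Fin n) : Set where
      field
        end₁ end₂ : Fin n
        covers    : ∀ {b} → b ∈ˡ xs → b ≡ end₁ ⊎ b ≡ end₂
        end₁∈     : end₁ ∈ˡ xs ⊎ end₁ ≡ z
        end₂∈     : end₂ ∈ˡ xs ⊎ end₂ ≡ z

    module _ {xs} (xs⊆B : ∀ {b} → b ∈ˡ xs → b ∈ B) (ends : ∀ z → Ends xs z) (extra : Extra xs) where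

      -- Each copy vertex on the path to b is exchanged away, which pulls it into the component of v.
      chase : ∀ {σ τ b} → b ∈ B → (∀ {p} → p ≢ σ → p ≢ τ → p ∉ˡ xs) →
        ∀ {φ v} → State B φ → Free B φ v → (∀ {x} → x ∈ˡ xs → Attached B φ v x) → Linked (Cut Vert σ τ) v b → ⊥
      chase b∈B avoid state v-free attached ε = proj₂ v-free b∈B
      chase {σ} {τ} b∈B avoid {φ} {v} state v-free attached (_◅_ {j = v′} (e , _ , cut@(Vv′ , ≢σ , ≢τ)) l)
        with v′ ∈? B | im? φ v′
      ... | yes v′∈B | _ = extra state v-free attached v′∈B (avoid ≢σ ≢τ) (v , ε , e)
      ... | no v′∉B | no ¬im = chase b∈B avoid state v′-free
        (λ x∈ → let (c , l′ , e′) = attached x∈ in c , (E-sym e , v′-free , v-free) ◅ l′ , e′) l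
        where
        v′-free : Free B φ v′
        v′-free = (Vv′ , ¬im) , v′∉B
      ... | no _ | yes (u₀ , node , refl) = exchange (proj₂ (end-walk end₁∈)) (proj₂ (end-walk end₂∈))
        where
        open Ends (ends (φ u₀))
        open Walks G (Component B φ v) using (Walk; step; [])
        end-walk : ∀ {x} → x ∈ˡ xs ⊎ x ≡ φ u₀ → ∃[ k ] Walk x k v
        end-walk (inj₁ x∈)  = Around.attached-walk state v-free (attached x∈)
        end-walk (inj₂ refl) = 1 , step ε e []
        closed : ∀ {c b} → Component B φ v c → E c b → b ∈ B → b ∈ˡ xs
        closed {c} {b} l′ e′ b∈ = decidable-stable (DecMembership._∈?_ _≟_ b xs) λ b∉ → extra state v-free attached b∈ b∉ (c , l′ , e′)
        -- The remainder `l` is a walk in the whole graph, so the new copy does not affect it, and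
        -- the recursion goes on from the released vertex.
        open Exchange big state v-free node e xs xs⊆B covers closed
          (λ state′ free′ attached′ → chase b∈B avoid state′ free′ attached′ l) using (exchange)

    module _ (larger : ∀ {B′ φ} → B ⊂ B′ → State B′ φ → ⊥) where

      v∉B⇒≢ : ∀ {φ v x} → Free B φ v → x ∈ B → v ≢ x
      v∉B⇒≢ (_ , v∉B) x∈B refl = v∉B x∈B

      in-Vert : ∀ {φ x} → State B φ → x ∈ B → Vert x
      in-Vert state x∈B = proj₁ (State.B⊆Outside state x∈B)

      extra₂ : ∀ {x y} → x ∈ B → y ∈ B → x ≢ y → Extra (x ∷ y ∷ [])
      extra₂ x∈ y∈ x≢y state v-free attached z∈ z∉ att-z =
        enlarge state v-free x∈ y∈ z∈ x≢y (λ { refl → z∉ (there (here refl)) }) (λ { refl → z∉ (here refl) })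
          (attached (here refl)) (attached (there (here refl))) att-z larger

      extra₁ : ∀ {x} → x ∈ B → Extra (x ∷ [])
      extra₁ {x} x∈ {b = y} state v-free attached y∈ y∉ att-y with big x y y
      ... | b , b∈ , b≢x , b≢y , _ = chase
        (λ b∈ → [ (λ { refl → x∈ }) , (λ { refl → y∈ }) ]′ (∈-pair b∈))
        (λ z → record { end₁ = x ; end₂ = y ; covers = ∈-pair
                      ; end₁∈ = inj₁ (here refl) ; end₂∈ = inj₁ (there (here refl)) })
        (extra₂ x∈ y∈ λ { refl → y∉ (here refl) })
        b∈ (λ ≢x ≢y p∈ → [ ≢x , ≢y ]′ (∈-pair p∈))
        state v-free (λ p∈ → [ (λ { refl → attached (here refl) }) , (λ { refl → att-y }) ]′ (∈-pair p∈))
        (3-connected x y (proj₁ (proj₁ v-free)) (in-Vert state b∈) (v∉B⇒≢ v-free x∈) (v∉B⇒≢ v-free y∈) b≢x b≢y)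

      extra₀ : Extra []
      extra₀ {b = x} state v-free _ x∈ _ att-x with big x x x
      ... | b , b∈ , b≢x , _ = chase (λ b∈ → subst (_∈ B) (sym (∈-singleton b∈)) x∈)
        (λ z → record { end₁ = x ; end₂ = x ; covers = inj₁ ∘ ∈-singleton
                      ; end₁∈ = inj₁ (here refl) ; end₂∈ = inj₁ (here refl) })
        (extra₁ x∈) b∈ (λ ≢x _ p∈ → ≢x (∈-singleton p∈))
        state v-free (λ p∈ → subst (Attached B _ _) (sym (∈-singleton p∈)) att-x)
        (3-connected x x (proj₁ (proj₁ v-free)) (in-Vert state b∈) (v∉B⇒≢ v-free x∈) (v∉B⇒≢ v-free x∈) b≢x b≢x)

      absorb : ∀ {φ v} → State B φ → Free B φ v → ⊥
      absorb {v = v} state v-free with big v v v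
      -- Nothing has to be avoided yet; `w` merely fills both places of the cut and must differ from
      -- `v` and `b`.
      ... | w , w∈ , _ with big w w w
      ... | b , b∈ , b≢w , _ = chase (λ ())
        (λ z → record { end₁ = z ; end₂ = z ; covers = λ () ; end₁∈ = inj₂ refl ; end₂∈ = inj₂ refl })
        extra₀ b∈ (λ _ _ ()) state v-free (λ ())
        (3-connected w w (proj₁ (proj₁ v-free)) (in-Vert state b∈) (v∉B⇒≢ v-free w∈) (v∉B⇒≢ v-free w∈) b≢w b≢w)

  -- `plenty` rules out the other kind of separation, in which deleting two vertices leaves a single
  -- one.
  record Good (φ : Fin m → Fin n) : Set where
    field
      copy      : Copy φ
      separated : ∀ σ τ {u v} → Outside φ u → Outside φ v → u ≢ σ → u ≢ τ → v ≢ σ → v ≢ τ →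
                  Linked (Cut (Outside φ) σ τ) u v
      plenty    : ∀ p q r → ∃[ b ] Outside φ b × b ≢ p × b ≢ q × b ≢ r

  module _ (none : ∀ φ → Good φ → ⊥) where

    maximise : ∀ f {B φ} → n < f + ∣ B ∣ → Big B → State B φ → ⊥
    maximise zero    {B} n< big state = ℕ.<⇒≱ n< (∣p∣≤n B)
    maximise (suc f) {B} {φ} n< big state = none φ record
      { copy = copy
      ; separated = λ σ τ u-out v-out → separated σ τ (in-B u-out) (in-B v-out)
      ; plenty = λ p q r → let (b , b∈B , ≢) = big p q r in b , B⊆Outside b∈B , ≢ }
      where
      open State state
      larger : ∀ {B′ φ} → B ⊂ B′ → State B′ φ → ⊥
      larger {B′} B⊂B′ = maximise f
        (ℕ.<-≤-trans n< (ℕ.≤-trans (ℕ.≤-reflexive (sym (ℕ.+-suc f ∣ B ∣))) (ℕ.+-monoʳ-≤ f (p⊂q⇒∣p∣<∣q∣ B⊂B′))))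
        λ p q r → let (b , b∈B , ≢) = big p q r in b , proj₁ B⊂B′ b∈B , ≢
      in-B : ∀ {u} → Outside φ u → u ∈ B
      in-B {u} out = decidable-stable (u ∈? B) λ u∉B → absorb big larger state (out , u∉B)

    from-copy : ∀ {k} → s ≡ suc k → ∀ φ → Copy φ → ⊥
    from-copy refl φ copy with outside-degree copy (into copy (spine-node (s≤s z≤n)))
    ... | v , (_ , v-out) , _ = Block.block G (Outside φ) (outside? φ)
      (λ out → outside-degree copy (proj₁ out))
      (λ B B⊆ sep big → maximise (suc n) (s≤s (ℕ.m≤m+n n ∣ B ∣)) big
        record { copy = copy ; B⊆Outside = B⊆ ; separated = sep })
      v-out (λ (_ , ¬im) → ¬im (spine 0 , spine-node (s≤s z≤n) , refl))

    greedy : ∀ {k} → s ≡ suc k → ∀ {r} → colour r ≡ colourᵀ (spine 0) → Vert r → ⊥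
    greedy s≡ eq Vr = Greedy.embed
      (λ V → AtLeast-mono t (λ e → e , E⇒Vert (E-sym e)) (AtLeast-≤ (ℕ.m≤m+n t 3) (degree V))) s≡ Vr eq (from-copy s≡)

    no-good-copy : ∀ {k} → s ≡ suc k → ∀ {r} → Vert r → ⊥
    no-good-copy s≡ {r} Vr with colour r Bool.≟ colourᵀ (spine 0)
    ... | yes eq = greedy s≡ eq Vr
    ... | no ≢ with AtLeast-≤ {j = 1} (ℕ.m≤n⇒m≤o+n t (s≤s z≤n)) (degree Vr)
    ... | r′ , e , _ = greedy s≡ (opposite (colour-≢ e) ≢) (E⇒Vert (E-sym e))

-- Caterpillars as combs.

nth : ∀ {A : Set} → A → List A → ℕ → A
nth d []       _       = d
nth d (x ∷ xs) zero    = x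
nth d (x ∷ xs) (suc i) = nth d xs i

nth-∈ : ∀ {A : Set} {d : A} xs {i} → i < length xs → nth d xs i ∈ˡ xs
nth-∈ (x ∷ xs) {zero}  _         = here refl
nth-∈ (x ∷ xs) {suc i} (s≤s i<) = there (nth-∈ xs i<)

nth-linked : ∀ {A : Set} {R : A → A → Set} {d xs} → Listᴸ.Linked R xs → ∀ {i} → suc i < length xs →
  R (nth d xs i) (nth d xs (suc i))
nth-linked Listᴸ.[-]        {_}     (s≤s ())
nth-linked (r Listᴸ.∷ l) {zero}  _        = r
nth-linked (r Listᴸ.∷ l) {suc i} (s≤s lt) = nth-linked l lt

position : ∀ {m} → Fin m → List (Fin m) → ℕ
position x [] = 0
position x (y ∷ ys) with x ≟ y
... | yes _ = 0
... | no _  = suc (position x ys)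

position-< : ∀ {m} {x : Fin m} {xs} → x ∈ˡ xs → position x xs < length xs
position-< {x = x} {y ∷ ys} x∈ with x ≟ y
... | yes _ = s≤s z≤n
position-< (here eq)  | no x≢y = contradiction eq x≢y
position-< (there x∈) | no _   = s≤s (position-< x∈)

nth-position : ∀ {m} {d x : Fin m} {xs} → x ∈ˡ xs → nth d xs (position x xs) ≡ x
nth-position {x = x} {y ∷ ys} x∈ with x ≟ y
... | yes x≡y = sym x≡y
nth-position (here eq)  | no x≢y = contradiction eq x≢y
nth-position (there x∈) | no _   = nth-position x∈

position-nth : ∀ {m} {d : Fin m} {xs} → Unique xs → ∀ {i} → i < length xs → position (nth d xs i) xs ≡ i
position-nth {xs = x ∷ xs} _ {zero} _ with x ≟ x
... | yes _  = refl
... | no x≢x = contradiction refl x≢x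
position-nth {d = d} {x ∷ xs} (x∉ AllPairs.∷ uniq) {suc i} (s≤s i<) with nth d xs i ≟ x
... | yes eq = contradiction (sym eq) (All.lookup x∉ (nth-∈ xs i<))
... | no _   = cong suc (position-nth uniq i<)

module Sides {n} (G : Graph n) (X Y : Subset n) (bip : IsBipartition G X Y) where
  open IsBipartition bip

  side : Fin n → Bool
  side u = does (u ∈? X)

  side-true : ∀ {u} → side u ≡ true → u ∈ X
  side-true {u} eq with u ∈? X
  ... | yes u∈X = u∈X

  side-false : ∀ {u} → u ∈ V G → side u ≡ false → u ∈ Y
  side-false {u} u∈ eq with u ∈? X
  ... | no u∉X with x∈p∪q⁻ X Y (subst (u ∈_) (sym cover) u∈)
  ... | inj₁ u∈X = contradiction u∈X u∉X
  ... | inj₂ u∈Y = u∈Y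

  side-≢ : ∀ {u v} → Adj G u v → side u ≢ side v
  side-≢ {u} {v} e eq with side u in equ
  ... | true  = independentˡ (side-true equ) (side-true (sym eq)) e
  ... | false = independentʳ (side-false (Graph.Adj⇒∈V G e) equ)
                             (side-false (Graph.Adj⇒∈V G (Graph.sym G e)) (sym eq)) e

module CaterpillarComb {m} (T : Graph m) (X Y : Subset m) (cat : IsCaterpillar T) (bip : IsBipartition T X Y) where
  open IsCaterpillar cat renaming (spine to spines)
  open IsTree isTree using (acyclic; connected) renaming (nonempty to node)
  open IsPath spineIsPath renaming (inside to spine⊆V; nonempty to spines≢[])
  open Sides T X Y bip

  len : ℕ
  len = length spines

  at : ℕ → Fin m
  at = nth (proj₁ node) spines

  at-injective : ∀ {i j} → i < len → j < len → at i ≡ at j → i ≡ j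
  at-injective i< j< eq = trans (sym (position-nth unique i<)) (trans (cong (λ x → position x spines) eq) (position-nth unique j<))

  arc : ℕ → ℕ → List (Fin m)
  arc i zero    = at i ∷ []
  arc i (suc k) = at i ∷ arc (suc i) k

  arc-all : ∀ {P : Fin m → Set} i k → (∀ j → i ≤ j → j ≤ k + i → P (at j)) → All P (arc i k)
  arc-all i zero    p = p i ℕ.≤-refl ℕ.≤-refl All.∷ All.[]
  arc-all i (suc k) p = p i ℕ.≤-refl (ℕ.m≤n+m i (suc k)) All.∷
    arc-all (suc i) k λ j i<j j≤ → p j (ℕ.<⇒≤ i<j) (ℕ.≤-trans j≤ (ℕ.≤-reflexive (ℕ.+-suc k i)))

  arc-unique : ∀ i k → k + i < len → Unique (arc i k)
  arc-unique i zero    _   = All.[] AllPairs.∷ AllPairs.[]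
  arc-unique i (suc k) k+i = arc-all (suc i) k (λ j i<j j≤ eq → ℕ.<⇒≢ i<j
      (at-injective (ℕ.≤-<-trans (ℕ.m≤n+m i (suc k)) k+i)
        (ℕ.≤-<-trans (ℕ.≤-trans j≤ (ℕ.≤-reflexive (ℕ.+-suc k i))) k+i) eq))
    AllPairs.∷ arc-unique (suc i) k (subst (_< len) (sym (ℕ.+-suc k i)) k+i)

  arc-linked : ∀ {v w} i k → k + i < len → Adj T v (at i) → Adj T (at (k + i)) w → Listᴸ.Linked (Adj T) (v ∷ (arc i k ∷ʳ w))
  arc-linked i zero    _   a b = a Listᴸ.∷ b Listᴸ.∷ Listᴸ.[-]
  arc-linked {w = w} i (suc k) k+i a b = a Listᴸ.∷ arc-linked (suc i) k (subst (_< len) (sym (ℕ.+-suc k i)) k+i)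
    (nth-linked linked (ℕ.≤-<-trans (s≤s (ℕ.m≤n+m i k)) k+i))
    (subst (λ j → Adj T (at j) w) (sym (ℕ.+-suc k i)) b)

  no-ear : ∀ {v} i k → suc k + i < len → Adj T v (at i) → Adj T (at (suc k + i)) v →
    (∀ j → i ≤ j → j ≤ suc k + i → v ≢ at j) → ⊥
  no-ear {v} i k k+i a b off = acyclic v (arc i (suc k)) record
    { long = long k ; linked = arc-linked i (suc k) k+i a b
    ; unique = arc-all i (suc k) off AllPairs.∷ arc-unique i (suc k) k+i }
    where
    long : ∀ k → 2 ≤ length (arc i (suc k))
    long zero    = ℕ.≤-refl
    long (suc k) = s≤s (s≤s z≤n)

  On-spine : Fin m → Set
  On-spine u = u ∈ˡ spines

  on-spine? : ∀ u → Dec (On-spine u)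
  on-spine? u = DecMembership._∈?_ _≟_ u spines

  foot? : ∀ u → Dec (∃[ v ] On-spine v × Adj T u v)
  foot? u = any? λ v → on-spine? v ×-dec Graph.Adj? T u v

  -- The last value is a default: by `foot-exists`, a vertex of the tree off the spine has a
  -- neighbour on it.
  anchor : Fin m → Fin m
  anchor u with on-spine? u | foot? u
  ... | yes _ | _           = u
  ... | no _  | yes (v , _) = v
  ... | no _  | no _        = u

  home : Fin m → ℕ
  home u = position (anchor u) spines

  anchor-spine : ∀ {u} → On-spine u → anchor u ≡ u
  anchor-spine {u} on with on-spine? u
  ... | yes _  = refl
  ... | no off = contradiction on off

  anchor-foot : ∀ {u v} → ¬ On-spine u → On-spine v → Adj T u v → On-spine (anchor u) × Adj T u (anchor u)
  anchor-foot {u} {v} off on a with on-spine? u | foot? u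
  ... | yes on′ | _               = contradiction on′ off
  ... | no _    | yes (w , found) = found
  ... | no _    | no none         = contradiction (v , on , a) none

  0<len : 0 < len
  0<len with spines | spines≢[]
  ... | []    | ne = contradiction refl ne
  ... | _ ∷ _ | _  = s≤s z≤n

  at-spine : ∀ {i} → i < len → On-spine (at i)
  at-spine = nth-∈ spines

  at-position : ∀ {u} → On-spine u → at (position u spines) ≡ u
  at-position = nth-position

  -- The first edge of a walk from `u` to the spine has an end on the spine, and that end is not
  -- `u`.
  foot-exists : ∀ {u} → u ∈ V T → ¬ On-spine u → ∃[ v ] On-spine v × Adj T u v
  foot-exists u∈ off with connected u∈ (All.lookup spine⊆V (at-spine 0<len))
  ... | ε = contradiction (at-spine 0<len) off
  ... | e ◅ _ with incident e
  ... | inj₁ on = contradiction on off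
  ... | inj₂ on = _ , on , e

  -- This one cycle gives both facts about the spine: it has no chords, and a vertex off it has only
  -- one neighbour on it.
  ear : ∀ {v i j} → i < j → j < len → Adj T v (at i) → Adj T (at j) v →
    (∀ l → i ≤ l → l ≤ j → v ≢ at l) → ⊥
  ear {v} {i} {j} i<j j<len a b off with ℕ.m≤n⇒∃[o]m+o≡n i<j
  ... | k , refl = no-ear i k (subst (_< len) j≡ j<len) a (subst (λ l → Adj T (at l) v) j≡ b)
    λ l i≤l l≤ → off l i≤l (ℕ.≤-trans l≤ (ℕ.≤-reflexive (sym j≡)))
    where
    j≡ : suc i + k ≡ suc k + i
    j≡ = cong suc (ℕ.+-comm i k)

  no-chord : ∀ {i j} → suc i < j → j < len → ¬ Adj T (at i) (at j)
  -- The left end of the chord is the ear on the stretch from `suc i` to `j`.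
  no-chord {i} {j} i+1<j j<len e = ear i+1<j j<len
    (nth-linked linked (ℕ.<-trans i+1<j j<len)) (Graph.sym T e)
    λ l i<l l≤j eq → ℕ.<⇒≢ i<l (at-injective (ℕ.<-trans (ℕ.<-trans (ℕ.n<1+n i) i+1<j) j<len) (ℕ.≤-<-trans l≤j j<len) eq)

  consecutive : ∀ {u v} → On-spine u → On-spine v → Adj T u v →
    position u spines < position v spines → position v spines ≡ suc (position u spines)
  consecutive {u} {v} onᵘ onᵛ e u<v with ℕ.m≤n⇒m<n∨m≡n u<v
  ... | inj₂ eq = sym eq
  ... | inj₁ lt = contradiction (subst₂ (Adj T) (sym (at-position onᵘ)) (sym (at-position onᵛ)) e)
                    (no-chord lt (position-< onᵛ))

  one-foot : ∀ {u v w} → ¬ On-spine u → On-spine v → On-spine w → Adj T u v → Adj T u w → v ≡ w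
  one-foot {u} {v} {w} off onᵛ onʷ e f with ℕ.<-cmp (position v spines) (position w spines)
  ... | tri≈ _ eq _ = trans (sym (at-position onᵛ)) (trans (cong at eq) (at-position onʷ))
  ... | tri< lt _ _ = ⊥-elim (ear lt (position-< onʷ) (subst (Adj T u) (sym (at-position onᵛ)) e)
    (subst (λ x → Adj T x u) (sym (at-position onʷ)) (Graph.sym T f))
    λ l _ l≤ eq → off (subst On-spine (sym eq) (at-spine (ℕ.≤-<-trans l≤ (position-< onʷ)))))
  ... | tri> _ _ lt = ⊥-elim (ear lt (position-< onᵛ) (subst (Adj T u) (sym (at-position onʷ)) f)
    (subst (λ x → Adj T x u) (sym (at-position onᵛ)) (Graph.sym T e))
    λ l _ l≤ eq → off (subst On-spine (sym eq) (at-spine (ℕ.≤-<-trans l≤ (position-< onᵛ)))))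

  home-spine : ∀ {u} → On-spine u → home u ≡ position u spines
  home-spine on = cong (λ x → position x spines) (anchor-spine on)

  at-home : ∀ {u} → On-spine u → u ≡ at (home u)
  at-home on = trans (sym (at-position on)) (cong at (sym (home-spine on)))

  home-foot : ∀ {u v} → ¬ On-spine u → On-spine v → Adj T u v → home u ≡ home v
  home-foot off on e with anchor-foot off on e
  ... | on′ , e′ = trans (cong (λ x → position x spines) (one-foot off on′ on e′ e)) (sym (home-spine on))

  home-< : ∀ {u} → u ∈ V T → home u < len
  home-< {u} u∈ = go (on-spine? u)
    where
    go : Dec (On-spine u) → home u < len
    go (yes on) = subst (_< len) (sym (home-spine on)) (position-< on)
    go (no off) =
      let (v , on , e) = foot-exists u∈ off
      in subst (_< len) (trans (sym (home-spine on)) (sym (home-foot off on e))) (position-< on)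

  cases : ∀ {u v} → Adj T u v →
    (u ≡ at (home u) × v ≡ at (home v) × (home v ≡ suc (home u) ⊎ home u ≡ suc (home v))) ⊎
    (home u ≡ home v × (u ≡ at (home u) ⊎ v ≡ at (home v)))
  cases {u} {v} e = go (on-spine? u) (on-spine? v)
    where
    next : On-spine u → On-spine v → home v ≡ suc (home u) ⊎ home u ≡ suc (home v)
    next onᵘ onᵛ with ℕ.<-cmp (position u spines) (position v spines)
    ... | tri< lt _ _ = inj₁ (trans (home-spine onᵛ) (trans (consecutive onᵘ onᵛ e lt) (cong suc (sym (home-spine onᵘ)))))
    ... | tri> _ _ gt = inj₂ (trans (home-spine onᵘ)
      (trans (consecutive onᵛ onᵘ (Graph.sym T e) gt) (cong suc (sym (home-spine onᵛ)))))
    ... | tri≈ _ eq _ = contradiction (subst (Adj T u) (sym u≡v) e) (Graph.irrefl T)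
      where
      u≡v : u ≡ v
      u≡v = trans (sym (at-position onᵘ)) (trans (cong at eq) (at-position onᵛ))
    go : Dec (On-spine u) → Dec (On-spine v) →
      (u ≡ at (home u) × v ≡ at (home v) × (home v ≡ suc (home u) ⊎ home u ≡ suc (home v))) ⊎
      (home u ≡ home v × (u ≡ at (home u) ⊎ v ≡ at (home v)))
    go (no off)  (no off′) = [ (λ on → contradiction on off) , (λ on → contradiction on off′) ]′ (incident e)
    go (yes on)  (no off)  = inj₂ (sym (home-foot off on (Graph.sym T e)) , inj₁ (at-home on))
    go (no off)  (yes on)  = inj₂ (home-foot off on e , inj₂ (at-home on))
    go (yes onᵘ) (yes onᵛ) = inj₁ (at-home onᵘ , at-home onᵛ , next onᵘ onᵛ)

  leaf : ∀ {u} → u ∈ V T → u ≢ at (home u) → Adj T u (at (home u))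
  leaf {u} u∈ u≢ = go (on-spine? u)
    where
    go : Dec (On-spine u) → Adj T u (at (home u))
    go (yes on) = contradiction (at-home on) u≢
    go (no off) =
      let (v , on , e) = foot-exists u∈ off
      in subst (Adj T u) (trans (at-home on) (cong at (sym (home-foot off on e)))) e

  class-bound : ∀ β → ¬ AtLeast (suc (∣ X ∣ ⊔ ∣ Y ∣)) (λ u → u ∈ V T × side u ≡ β)
  class-bound true pts = ℕ.<⇒≱ (s≤s (ℕ.m≤m⊔n ∣ X ∣ ∣ Y ∣))
    (AtLeast-subset-≤ _ (AtLeast-mono _ (side-true ∘ proj₂) pts))
  class-bound false pts = ℕ.<⇒≱ (s≤s (ℕ.m≤n⊔m ∣ X ∣ ∣ Y ∣))
    (AtLeast-subset-≤ _ (AtLeast-mono _ (λ (u∈ , eq) → side-false u∈ eq) pts))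

  comb : Comb m (∣ X ∣ ⊔ ∣ Y ∣)
  comb = record
    { Node = _∈ V T ; Node? = _∈? V T ; Adjacent = Adj T ; adj-sym = Graph.sym T
    ; colourᵀ = side ; colourᵀ-≢ = side-≢ ; class-≤ = class-bound
    ; s = len ; spine = at ; home = home ; home<s = home-<
    ; spine-node = λ i< → All.lookup spine⊆V (at-spine i<)
    ; home-spine = λ i< → trans (home-spine (at-spine i<)) (position-nth unique i<)
    ; spine-adj = nth-linked linked ; leaf-adj = leaf ; adj-cases = cases }

-- The finite search for a good copy.

module Decide {m n t} (T : Comb m t) (G : ColouredGraph n)
  (adjacent? : ∀ u v → Dec (Comb.Adjacent T u v))
  (degree : ColouredGraph.MinDegree G (t + 3)) (3-connected : ColouredGraph.TwoCutsConnect G) where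

  open Comb T
  open ColouredGraph G
  open Embeddings T G
  open Growth T G degree 3-connected

  copy? : ∀ φ → Dec (Copy φ)
  copy? φ = map′
    (λ (i , j , h , c) → record { into = λ {u} → i u ; injective = λ {u} {v} → j u v
                                ; hom = λ {u} {v} → h u v ; coloured = λ {u} → c u })
    (λ e → (λ _ → Embeds.into e) , (λ _ _ → Embeds.injective e) , (λ _ _ → Embeds.hom e) , λ _ → Embeds.coloured e)
    (all? (λ u → Node? u →-dec Vert? (φ u)) ×-dec
     (all? (λ u → all? λ v → Node? u →-dec (Node? v →-dec (φ u ≟ φ v →-dec u ≟ v))) ×-dec
     (all? (λ u → all? λ v → Node? u →-dec (Node? v →-dec (adjacent? u v →-dec E? (φ u) (φ v)))) ×-dec
      all? (λ u → Node? u →-dec colour (φ u) Bool.≟ colourᵀ u))))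

  good? : ∀ φ → Dec (Good φ)
  good? φ = map′
    (λ (c , s , p) → record { copy = c ; separated = λ σ τ {u} {v} → s σ τ u v ; plenty = p })
    (λ g → Good.copy g , (λ σ τ _ _ → Good.separated g σ τ) , Good.plenty g)
    (copy? φ ×-dec
     (all? (λ σ → all? λ τ → all? λ u → all? λ v →
        outside? φ u →-dec (outside? φ v →-dec (¬? (u ≟ σ) →-dec (¬? (u ≟ τ) →-dec
        (¬? (v ≟ σ) →-dec (¬? (v ≟ τ) →-dec linked-cut? (outside? φ) σ τ u v)))))) ×-dec
      all? (λ p → all? λ q → all? λ r → any? λ b →
        outside? φ b ×-dec (¬? (b ≟ p) ×-dec (¬? (b ≟ q) ×-dec ¬? (b ≟ r))))))

  -- The search runs over vectors, which recover a map only pointwise.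
  good-cong : ∀ {φ ψ} → (∀ u → φ u ≡ ψ u) → Good φ → Good ψ
  good-cong {φ} {ψ} φ≗ψ good = record
    { copy = record
      { into = λ {u} node → subst Vert (φ≗ψ u) (into copy node)
      ; injective = λ {u} {v} p q eq → injective copy p q (trans (φ≗ψ u) (trans eq (sym (φ≗ψ v))))
      ; hom = λ {u} {v} p q a → subst₂ E (φ≗ψ u) (φ≗ψ v) (hom copy p q a)
      ; coloured = λ {u} p → trans (cong colour (sym (φ≗ψ u))) (coloured copy p) }
    ; separated = λ σ τ p q a b c d → linked-mono (λ (out , ≢) → to out , ≢) (separated σ τ (from p) (from q) a b c d)
    ; plenty = λ p q r → let (b , out , ≢) = plenty p q r in b , to out , ≢ }
    where
    open Good good
    open Embeds
    to : ∀ {u} → Outside φ u → Outside ψ u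
    to (V , ¬im) = V , λ (w , node , eq) → ¬im (w , node , trans (φ≗ψ w) eq)
    from : ∀ {u} → Outside ψ u → Outside φ u
    from (V , ¬im) = V , λ (w , node , eq) → ¬im (w , node , trans (sym (φ≗ψ w)) eq)

  anyVec? : ∀ {k} {P : Vec (Fin n) k → Set} → (∀ v → Dec (P v)) → Dec (∃[ v ] P v)
  anyVec? {zero}  P? = map′ ([] ,_) (λ { ([] , p) → p }) (P? [])
  anyVec? {suc k} P? = map′ (λ (x , v , p) → x ∷ v , p) (λ { (x ∷ v , p) → x , v , p })
    (any? λ x → anyVec? λ v → P? (x ∷ v))

  good-copy : ∀ {k} → s ≡ suc k → ∀ {r} → Vert r → ∃[ φ ] Good φ
  good-copy s≡ Vr with anyVec? (λ v → good? (lookup v))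
  ... | yes (v , good) = lookup v , good
  ... | no none = ⊥-elim (no-good-copy
    (λ φ good → none (tabulate φ , good-cong (λ u → sym (Vec.lookup∘tabulate φ u)) good)) s≡ Vr)

-- Degrees, separators and connectivity.

module GraphFacts {n} (G : Graph n) where

  connected? : Dec (Connected G)
  connected? = map′ (λ c {u} {v} → c u v) (λ c u v → c)
    (all? λ u → all? λ v → u ∈? V G →-dec (v ∈? V G →-dec Reachability.reachable? (Graph.Adj? G) u v))

  degree-bound : ∀ {k u} → δ G ≥ k → u ∈ V G → AtLeast k (Adj G u)
  degree-bound {k} {u} δ≥k u∈ = AtLeast-mono k adjacent
    (AtLeast-≤ (ℕ.≤-trans δ≥k δ≤degree) (AtLeast-subset (neighbours G u)))
    where
    δ≤degree : δ G ≤ degree G u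
    δ≤degree = All.lookup (min≤xs ∣ V G ∣ (map (degree G) (filter (_∈? V G) (allFin n))))
      (∈-map⁺ (degree G) (∈-filter⁺ (_∈? V G) (∈-allFin u) u∈))
    adjacent : ∀ {v} → v ∈ neighbours G u → Adj G u v
    adjacent {v} v∈ with Graph.Adj? G u v | trans (sym (Vec.lookup∘tabulate (λ w → does (Graph.Adj? G u w)) v)) (Vec.[]=⇒lookup v∈)
    ... | yes e | _ = e

∈─⇒∉ : ∀ {n} {x} (p q : Subset n) → x ∈ p ─ q → x ∉ q
∈─⇒∉ (inside ∷ p) (outside ∷ q) here       = λ ()
∈─⇒∉ (_ ∷ p)      (inside  ∷ q) (there x∈) = λ { (there x∈q) → ∈─⇒∉ p q x∈ x∈q }
∈─⇒∉ (_ ∷ p)      (outside ∷ q) (there x∈) = λ { (there x∈q) → ∈─⇒∉ p q x∈ x∈q }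

-- Missing members are replaced by `d`, so `σ` and `τ` differ from every vertex that is outside `S`
-- and different from `d`.
small-subset : ∀ {n} (S : Subset n) → ∣ S ∣ < 3 → ∀ d → ∃[ σ ] ∃[ τ ]
  (∀ {x} → x ∈ S → x ≡ σ ⊎ x ≡ τ) × (σ ∈ S ⊎ σ ≡ d) × (τ ∈ S ⊎ τ ≡ d)
small-subset S small d with any? (_∈? S)
... | no empty = d , d , (λ x∈ → contradiction (_ , x∈) empty) , inj₂ refl , inj₂ refl
... | yes (σ , σ∈) with any? (λ x → x ∈? S ×-dec ¬? (x ≟ σ))
... | no single = σ , σ , (λ {x} x∈ → inj₁ (decidable-stable (x ≟ σ) λ x≢σ → single (x , x∈ , x≢σ))) , inj₁ σ∈ , inj₁ σ∈
... | yes (τ , τ∈ , τ≢σ) = σ , τ , cover , inj₁ σ∈ , inj₁ τ∈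
  where
  cover : ∀ {x} → x ∈ S → x ≡ σ ⊎ x ≡ τ
  cover {x} x∈ with x ≟ σ | x ≟ τ
  ... | yes x≡σ | _       = inj₁ x≡σ
  ... | no _    | yes x≡τ = inj₂ x≡τ
  ... | no x≢σ  | no x≢τ  = contradiction
    (AtLeast-subset-≤ 3 (σ , σ∈ , τ , (τ∈ , τ≢σ) , x , ((x∈ , x≢σ) , x≢τ) , tt)) (ℕ.<⇒≱ small)

least : ∀ {P : ℕ → Set} → (∀ k → Dec (P k)) → ∀ k → P k → ∃[ k ] P k × (∀ {j} → P j → k ≤ j)
least {P} P? = <-rec (λ k → P k → ∃[ k ] P k × (∀ {j} → P j → k ≤ j)) search
  where
  search : ∀ k → (∀ {j} → j < k → P j → ∃[ k ] P k × (∀ {j} → P j → k ≤ j)) →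
           P k → ∃[ k ] P k × (∀ {j} → P j → k ≤ j)
  search k smaller Pk with ℕ.anyUpTo? P? k
  ... | yes (j , j<k , Pj) = smaller j<k Pj
  ... | no none = k , Pk , λ {j} Pj → ℕ.≮⇒≥ λ j<k → none (j , j<k , Pj)

module _ {n} (G : Graph n) (r : Fin n)
  (linked : ∀ σ τ {u v} → u ∈ V G → v ∈ V G → u ≢ σ → u ≢ τ → v ≢ σ → v ≢ τ →
    Star (λ u v → Adj G u v × (u ≢ σ × u ≢ τ) × (v ≢ σ × v ≢ τ)) u v)
  (plenty : ∀ p q r → ∃[ b ] b ∈ V G × b ≢ p × b ≢ q × b ≢ r) where

  no-small-separator : ∀ S → ∣ S ∣ < 3 → ¬ Separates G S
  no-small-separator S small (inj₁ disconnected) = disconnected λ {u} {v} u∈ v∈ →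
    let (d , _ , d≢u , d≢v , _) = plenty u v v
        (σ , τ , cover , σ∈ , τ∈) = small-subset S small d
        ≢σ : ∀ {w x} → w ∉ S → d ≢ w → x ∈ S ⊎ x ≡ d → w ≢ x
        ≢σ = λ { w∉ _ (inj₁ x∈) refl → w∉ x∈ ; _ d≢w (inj₂ refl) refl → d≢w refl }
        off : ∀ {w} → w ≢ σ × w ≢ τ → w ∉ S
        off = λ (w≢σ , w≢τ) w∈ → [ w≢σ , w≢τ ]′ (cover w∈)
        u∉ = ∈─⇒∉ (V G) S u∈
        v∉ = ∈─⇒∉ (V G) S v∈
    in Star.map (λ (e , p , q) → e , off p , off q)
         (linked σ τ (p─q⊆p (V G) S u∈) (p─q⊆p (V G) S v∈)
           (≢σ u∉ d≢u σ∈) (≢σ u∉ d≢u τ∈) (≢σ v∉ d≢v σ∈) (≢σ v∉ d≢v τ∈))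
  no-small-separator S small (inj₂ single) =
    let (σ , τ , cover , _) = small-subset S small r
        (b , b∈ , b≢σ , b≢τ , _) = plenty σ τ τ
        (b′ , b′∈ , b′≢σ , b′≢τ , b′≢b) = plenty σ τ b
        keep : ∀ {w} → w ∈ V G → w ≢ σ → w ≢ τ → w ∈ V G ─ S
        keep = λ w∈ w≢σ w≢τ → x∈p∧x∉q⇒x∈p─q w∈ λ w∈S → [ w≢σ , w≢τ ]′ (cover w∈S)
    in ℕ.<⇒≢ (AtLeast-subset-≤ 2 (b , keep b∈ b≢σ b≢τ , b′ , (keep b′∈ b′≢σ b′≢τ , b′≢b) , tt)) (sym single)

  separates? : ∀ S → Dec (Separates G S)
  separates? S = ¬? (GraphFacts.connected? (G - S)) ⊎-dec ∣ V (G - S) ∣ ℕ.≟ 1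

  -- Connectivity is a minimum, so some separator must be exhibited before the least size can be
  -- taken.
  all-but-one : ∃[ S ] S ⊆ V G × Separates G S
  all-but-one with plenty r r r
  ... | b , b∈ , _ = S , p─q⊆p (V G) ⁅ b ⁆ , inj₂ (ℕ.≤-antisym
    (AtLeast-covered _ (b ∷ []) only-b (AtLeast-subset (V G ─ S)))
    (AtLeast-subset-≤ 1 (b , x∈p∧x∉q⇒x∈p─q b∈ (λ b∈S → ∈─⇒∉ (V G) ⁅ b ⁆ b∈S (x∈⁅x⁆ b)) , tt)))
    where
    S = V G ─ ⁅ b ⁆
    only-b : ∀ {x} → x ∈ V G ─ S → x ∈ˡ b ∷ []
    only-b {x} x∈ = here (decidable-stable (x ≟ b) λ x≢b → ∈─⇒∉ (V G) S x∈
      (x∈p∧x∉q⇒x∈p─q (p─q⊆p (V G) S x∈) (x≢b ∘ x∈⁅y⁆⇒x≡y b)))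

  isConnected₃ : IsConnected[ 3 ] G
  isConnected₃ with least (λ k → anySubset? λ S → S ⊆? V G ×-dec (separates? S ×-dec ∣ S ∣ ℕ.≟ k)) _
    (let (S , S⊆ , sep) = all-but-one in S , S⊆ , sep , refl)
  ... | κ , attained@(S , _ , sep , size) , minimal =
    κ , record { attained = attained ; minimal = λ S S⊆ sep → minimal (S , S⊆ , sep , refl) } ,
    subst (3 ≤_) size (ℕ.≮⇒≥ λ small → no-small-separator S small sep)

module _ {n} (G : Graph n) (conn : IsConnected[ 3 ] G) where
  private
    isConnectivity = proj₁ (proj₂ conn)
  open IsConnectivity isConnectivity

  3-connected-has-vertex : ∃[ r ] r ∈ V G
  3-connected-has-vertex with any? (_∈? V G)
  ... | yes found = found
  ... | no empty with attained
  ... | S , _ , inj₁ disconnected , _ =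
    ⊥-elim (disconnected λ u∈ _ → contradiction (_ , p─q⊆p (V G) S u∈) empty)
  ... | S , _ , inj₂ single , _ with subst (λ k → AtLeast k (_∈ V G ─ S)) single (AtLeast-subset (V G ─ S))
  ... | x , x∈ , _ = contradiction (x , p─q⊆p (V G) S x∈) empty

  avoid-two : ∀ σ τ {u v} → u ∈ V G → v ∈ V G → u ≢ σ → u ≢ τ → v ≢ σ → v ≢ τ →
    Star (λ u v → Adj G u v × (u ∈ V G × u ≢ σ × u ≢ τ) × (v ∈ V G × v ≢ σ × v ≢ τ)) u v
  avoid-two σ τ {u} {v} u∈ v∈ u≢σ u≢τ v≢σ v≢τ = Star.map (λ (e , u∉ , v∉) →
      e , inside-V (Graph.Adj⇒∈V G e) u∉ , inside-V (Graph.Adj⇒∈V G (Graph.sym G e)) v∉)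
    (decidable-stable (GraphFacts.connected? (G - S)) connected (keep u∈ u≢σ u≢τ) (keep v∈ v≢σ v≢τ))
    where
    -- `σ` and `τ` may lie outside the graph, whereas `minimal` speaks of subsets of its vertex set.
    S = V G ∩ (⁅ σ ⁆ ∪ ⁅ τ ⁆)
    in-pair : ∀ {x} → x ∈ S → x ∈ˡ σ ∷ τ ∷ []
    in-pair x∈ with x∈p∪q⁻ ⁅ σ ⁆ ⁅ τ ⁆ (proj₂ (x∈p∩q⁻ (V G) _ x∈))
    ... | inj₁ x∈σ = here (x∈⁅y⁆⇒x≡y σ x∈σ)
    ... | inj₂ x∈τ = there (here (x∈⁅y⁆⇒x≡y τ x∈τ))
    keep : ∀ {w} → w ∈ V G → w ≢ σ → w ≢ τ → w ∈ V G ─ S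
    keep w∈ w≢σ w≢τ = x∈p∧x∉q⇒x∈p─q w∈ λ w∈S → case ∈-pair (in-pair w∈S) of λ
      { (inj₁ eq) → w≢σ eq ; (inj₂ eq) → w≢τ eq }
    inside-V : ∀ {w} → w ∈ V G → w ∉ S → w ∈ V G × w ≢ σ × w ≢ τ
    inside-V w∈ w∉ = w∈ , (λ { refl → w∉ (x∈p∩q⁺ (w∈ , x∈p∪q⁺ (inj₁ (x∈⁅x⁆ _)))) })
                        , (λ { refl → w∉ (x∈p∩q⁺ (w∈ , x∈p∪q⁺ (inj₂ (x∈⁅x⁆ _)))) })
    connected : ¬ ¬ Connected (G - S)
    connected disconnected = ℕ.<⇒≱ (proj₂ (proj₂ conn)) (ℕ.≤-trans
      (minimal S (λ x∈ → proj₁ (x∈p∩q⁻ (V G) _ x∈)) (inj₁ disconnected))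
      (AtLeast-covered _ (σ ∷ τ ∷ []) in-pair (AtLeast-subset S)))

-- The image of the tree as a subgraph.

linked-sources : ∀ {A : Set} {R : A → A → Set} {P : A → Set} → (∀ {x y} → R x y → P x) →
  ∀ xs {y} → Listᴸ.Linked R (xs ∷ʳ y) → All P xs
linked-sources R⇒P []           _                  = All.[]
linked-sources R⇒P (x ∷ [])     (r Listᴸ.∷ _)      = R⇒P r All.∷ All.[]
linked-sources R⇒P (x ∷ z ∷ xs) (r Listᴸ.∷ linked) = R⇒P r All.∷ linked-sources R⇒P (z ∷ xs) linked

unique-map : ∀ {A B : Set} {P : A → Set} (f : A → B) → (∀ {x y} → P x → P y → f x ≡ f y → x ≡ y) →
  ∀ {xs} → All P xs → Unique xs → Unique (map f xs)
unique-map f inj All.[]         AllPairs.[]             = AllPairs.[]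
unique-map f inj (px All.∷ pxs) (x∉ AllPairs.∷ uniq) =
  All.map⁺ (All.zipWith (λ (py , x≢y) eq → x≢y (inj px py eq)) (pxs , x∉)) AllPairs.∷ unique-map f inj pxs uniq

module Image {m n} (T : Graph m) (cat : IsCaterpillar T) (G : Graph n) (φ : Fin m → Fin n)
  (φ-in : ∀ {u} → u ∈ V T → φ u ∈ V G)
  (φ-inj : ∀ {u v} → u ∈ V T → v ∈ V T → φ u ≡ φ v → u ≡ v)
  (φ-hom : ∀ {u v} → Adj T u v → Adj G (φ u) (φ v)) where

  open IsCaterpillar cat
  open IsTree isTree
  open IsPath spineIsPath renaming (nonempty to spine≢[]; inside to spine⊆V; linked to spine-linked; unique to spine-unique)

  target : ∀ {u v} → Adj T u v → v ∈ V T
  target = Graph.Adj⇒∈V T ∘ Graph.sym T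

  preimage? : ∀ x → Dec (∃[ u ] u ∈ V T × φ u ≡ x)
  preimage? x = any? λ u → u ∈? V T ×-dec φ u ≟ x

  vertices′ : Subset n
  vertices′ = tabulate (λ x → does (preimage? x))

  ∈-image⁻ : ∀ {x} → x ∈ vertices′ → ∃[ u ] u ∈ V T × φ u ≡ x
  ∈-image⁻ {x} x∈ with preimage? x | trans (sym (Vec.lookup∘tabulate (λ y → does (preimage? y)) x)) (Vec.[]=⇒lookup x∈)
  ... | yes found | _ = found

  ∈-image⁺ : ∀ {u} → u ∈ V T → φ u ∈ vertices′
  ∈-image⁺ {u} u∈ = Vec.lookup⇒[]= (φ u) vertices′
    (trans (Vec.lookup∘tabulate (λ y → does (preimage? y)) (φ u)) (dec-true (preimage? (φ u)) (u , u∈ , refl)))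

  -- Only images of tree edges are taken: the subgraph induced on the image could have further edges
  -- and fail to be a tree.
  EdgeImage : Fin n → Fin n → Set
  EdgeImage x y = ∃[ u ] ∃[ v ] Adj T u v × φ u ≡ x × φ v ≡ y

  T′ : Graph n
  T′ = record
    { V       = vertices′
    ; Adj     = EdgeImage
    ; Adj?    = λ x y → any? λ u → any? λ v → Graph.Adj? T u v ×-dec (φ u ≟ x ×-dec φ v ≟ y)
    ; sym     = λ (u , v , e , p , q) → v , u , Graph.sym T e , q , p
    ; irrefl  = λ (u , v , e , p , q) → Graph.irrefl T
                  (subst (Adj T u) (sym (φ-inj (Graph.Adj⇒∈V T e) (target e) (trans p (sym q)))) e)
    ; Adj⇒∈V = λ { (u , v , e , refl , q) → ∈-image⁺ (Graph.Adj⇒∈V T e) } }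

  isSubgraph : IsSubgraph T′ G
  isSubgraph = record
    { V⊆V     = λ x∈ → let (u , u∈ , eq) = ∈-image⁻ x∈ in subst (_∈ V G) eq (φ-in u∈)
    ; Adj⇒Adj = λ { (u , v , e , refl , refl) → φ-hom e } }

  back : Fin n → Fin m
  back x with preimage? x
  ... | yes (u , _) = u
  ... | no _        = proj₁ nonempty

  back-∈ : ∀ {x} → x ∈ vertices′ → back x ∈ V T × φ (back x) ≡ x
  back-∈ {x} x∈ with preimage? x
  ... | yes (u , u∈ , eq) = u∈ , eq
  ... | no none           = contradiction (∈-image⁻ x∈) none

  back-φ : ∀ {u} → u ∈ V T → back (φ u) ≡ u
  back-φ u∈ = let (b∈ , eq) = back-∈ (∈-image⁺ u∈) in φ-inj b∈ u∈ eq

  back-inj : ∀ {x y} → x ∈ vertices′ → y ∈ vertices′ → back x ≡ back y → x ≡ y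
  back-inj x∈ y∈ eq = trans (sym (proj₂ (back-∈ x∈))) (trans (cong φ eq) (proj₂ (back-∈ y∈)))

  back-hom : ∀ {x y} → EdgeImage x y → Adj T (back x) (back y)
  back-hom (u , v , e , refl , refl) =
    subst₂ (Adj T) (sym (back-φ (Graph.Adj⇒∈V T e))) (sym (back-φ (target e))) e

  φ-edge : ∀ {u v} → Adj T u v → EdgeImage (φ u) (φ v)
  φ-edge e = _ , _ , e , refl , refl

  acyclic′ : ∀ v vs → ¬ IsCycle T′ v vs
  acyclic′ v vs cycle = acyclic (back v) (map back vs) record
    { long   = subst (2 ≤_) (sym (length-map back vs)) long
    ; linked = subst (λ ys → Listᴸ.Linked (Adj T) (back v ∷ ys)) (map-++ back vs (v ∷ []))
                 (Linked.map⁺ (Listᴸ.map back-hom linked))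
    ; unique = unique-map back back-inj (linked-sources (Graph.Adj⇒∈V T′) (v ∷ vs) linked) unique }
    where
    open IsCycle cycle

  isCaterpillar : IsCaterpillar T′
  isCaterpillar = record
    { isTree = record
      { nonempty  = φ (proj₁ nonempty) , ∈-image⁺ (proj₂ nonempty)
      ; connected = λ {x} {y} x∈ y∈ → subst₂ (Star EdgeImage) (proj₂ (back-∈ x∈)) (proj₂ (back-∈ y∈))
          (Star.gmap φ φ-edge (connected (proj₁ (back-∈ x∈)) (proj₁ (back-∈ y∈))))
      ; acyclic   = acyclic′ }
    ; spine = map φ spine
    ; spineIsPath = record
      { nonempty = λ eq → spine≢[] (map-[] spine eq)
      ; inside   = All.map⁺ (All.map ∈-image⁺ spine⊆V)
      ; linked   = Linked.map⁺ (Listᴸ.map φ-edge spine-linked)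
      ; unique   = unique-map φ φ-inj spine⊆V spine-unique }
    ; incident = λ { (u , v , e , refl , refl) → [ inj₁ ∘ ∈-map⁺ φ , inj₂ ∘ ∈-map⁺ φ ]′ (incident e) } }
    where
    map-[] : ∀ xs → map φ xs ≡ [] → xs ≡ []
    map-[] [] _ = refl

  vertex-≡ : ∀ {k} (H : Graph k) {x y : Vertex H} → proj₁ x ≡ proj₁ y → x ≡ y
  vertex-≡ H {x , x∈} {.x , y∈} refl = cong (x ,_) ([]=-irrelevant x∈ y∈)

  isomorphic : T′ ≅ T
  isomorphic = record
    { vertices = mk↔ₛ′ (λ (x , x∈) → back x , proj₁ (back-∈ x∈)) (λ (u , u∈) → φ u , ∈-image⁺ u∈)
        (λ (u , u∈) → vertex-≡ T (back-φ u∈)) (λ (x , x∈) → vertex-≡ T′ (proj₂ (back-∈ x∈)))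
    ; edges = λ (x , x∈) (y , y∈) → mk⇔ back-hom
        λ e → subst₂ EdgeImage (proj₂ (back-∈ x∈)) (proj₂ (back-∈ y∈)) (φ-edge e) }

theorem3p1 : ∀ {m n : ℕ} (T : Graph m) (X Y : Subset m) →
    IsCaterpillar T → IsBipartition T X Y →
    (G : Graph n) → IsConnected[ 3 ] G → Bipartite G →
    δ G ≥ (∣ X ∣ ⊔ ∣ Y ∣) + 3 →
    ∃[ T' ] IsSubgraph T' G × IsCaterpillar T' × (T' ≅ T) × IsConnected[ 3 ] (G - V T')
theorem3p1 {m} {n} T X Y cat bip G conn (A , B , bipG) δ≥ =
  T′ , isSubgraph , isCaterpillar , isomorphic ,
  isConnected₃ (G - V T′) r
    (λ σ τ u∈ v∈ p q p′ q′ → Star.map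
      (λ (e , (u-out , u≢) , (v-out , v≢)) → (e , outside⇒∉ u-out , outside⇒∉ v-out) , u≢ , v≢)
      (separated σ τ (∈⇒outside u∈) (∈⇒outside v∈) p q p′ q′))
    (λ p q r → let (b , out , ≢) = plenty p q r in
      b , x∈p∧x∉q⇒x∈p─q (proj₁ out) (outside⇒∉ out) , ≢)
  where
  open CaterpillarComb T X Y cat bip using (comb; 0<len)
  open Sides G A B bipG using (side; side-≢)

  host : ColouredGraph n
  host = record
    { Vert = _∈ V G ; Vert? = _∈? V G ; E = Adj G ; E? = Graph.Adj? G ; E-sym = Graph.sym G
    ; E⇒Vert = Graph.Adj⇒∈V G ; colour = side ; colour-≢ = side-≢ }

  r : Fin n
  r = proj₁ (3-connected-has-vertex G conn)

  degree≥ : ∀ {u} → u ∈ V G → AtLeast ((∣ X ∣ ⊔ ∣ Y ∣) + 3) (Adj G u)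
  degree≥ = GraphFacts.degree-bound G δ≥

  positive : ∀ {k} → 0 < k → ∃[ j ] k ≡ suc j
  positive (s≤s _) = _ , refl

  module H = Growth comb host degree≥ (avoid-two G conn)

  good : ∃[ φ ] H.Good φ
  good = Decide.good-copy comb host (Graph.Adj? T) degree≥ (avoid-two G conn)
    (proj₂ (positive 0<len)) (proj₂ (3-connected-has-vertex G conn))

  φ = proj₁ good
  open H.Good (proj₂ good)
  open Embeddings.Embeds copy
  open Image T cat G φ into injective (λ e → hom (Graph.Adj⇒∈V T e) (Graph.Adj⇒∈V T (Graph.sym T e)) e)

  outside⇒∉ : ∀ {u} → H.Outside φ u → u ∉ V T′
  outside⇒∉ (_ , ¬im) u∈ = ¬im (∈-image⁻ u∈)

  ∈⇒outside : ∀ {u} → u ∈ V (G - V T′) → H.Outside φ u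
  ∈⇒outside u∈ = p─q⊆p (V G) (V T′) u∈ ,
    λ { (w , w∈ , refl) → ∈─⇒∉ (V G) (V T′) u∈ (∈-image⁺ w∈) }
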